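{- Let $\eta=(\eta_1,\dots,\eta_{\ell(\eta)})\vdash n$ be a partition (with $\eta_1\ge\eta_2\ge\cdots\ge\eta_{\ell(\eta)}\geq 1$). Assign a variable $u_i$ to the $i$th partite set (of size $\eta_i$) of the complete multipartite graph $K_\eta$, set $u=(u_1,\dots,u_{\ell(\eta)})$, and write $u^\eta=u_1^{\eta_1}\cdots u_{\ell(\eta)}^{\eta_{\ell(\eta)}}$. For each integer $j$ with $1\le j\le \eta_1$ let $$E_j=\frac1{j!}\sum_{\substack{1\le i\le \ell(\eta)\\ \eta_i\ge j}}u_i^j,$$ and let $y=(y_1,\dots,y_{\eta_1})$ be the sequence of roots of the polynomial $$z^{\eta_1}-E_1z^{\eta_1-1}+E_2z^{\eta_1-2}-\dots+(-1)^{\eta_1}E_{\eta_1}.$$ Then $$X_{K_\eta}=\eta!\sum_{\mu\vdash n}\bigl([u^\eta]\,m_\mu(y)\bigr)\,e_\mu(x),$$ where $\eta!=\prod_{i=1}^{\ell(\eta)}\eta_i!$.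
   Context: For a partition $\eta$, $\ell(\eta)$ is its number of parts and $K_\eta$ is the complete multipartite graph whose partite sets have sizes equal to the parts of $\eta$. For a finite simple graph $G=(V,E)$, the chromatic symmetric function is $X_G(x)=\sum_{\kappa}\prod_{v\in V}x_{\kappa(v)}$, where $x=(x_1,x_2,\dots)$ are commuting indeterminates and the sum is over all proper colorings $\kappa\colon V\to\mathbb Z_{>0}$. $e_\mu$ and $m_\mu$ denote the elementary and monomial symmetric functions; $m_\mu(y)$ is the specialization of $m_\mu$ to the finite alphabet $y$ (all further variables set to $0$, so $m_\mu(y)=0$ if $\ell(\mu)>\eta_1$). The $u_i$ are independent commuting indeterminates, and the roots $y_a$ are taken, with multiplicity, in a splitting algebra over $\mathbb Q[u_1,\dots,u_{\ell(\eta)}]$, so that the polynomial equals $\prod_{a=1}^{\eta_1}(z-y_a)$ and $e_j(y)=E_j$. Since $m_\mu(y)$ is symmetric in the roots, it is a polynomial in $E_1,\dots,E_{\eta_1}$ and hence an element of $\mathbb Q[u_1,\dots,u_{\ell(\eta)}]$; $[u^\eta]F$ denotes the coefficient of the monomial $u^\eta$ in $F$. -}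

module Defs where

open import Algebra.Bundles using (CommutativeRing)
open import Algebra.Bundles.Raw using (RawRing)
open import Algebra.Core using (Op₂)
import Algebra.Definitions.RawSemiring as RawSemiringDefinitions
open import Algebra.Morphism.Structures using (module RingMorphisms)
open import Data.Bool.Base using (if_then_else_)
open import Data.Fin.Base using (Fin; zero; suc; splitAt)
import Data.Fin.Properties as Fin
open import Data.Integer.Base using (+_)
open import Data.List.Base using (List; []; _∷_; _++_; map; foldr; concatMap; filter; length; lookup; upTo; allFin; cartesianProductWith)
open import Data.List.Membership.DecPropositional using (_∈?_)
open import Data.List.Membership.Propositional.Properties using (∈-∃++)
open import Data.List.Relation.Binary.Permutation.Propositional using (_↭_; ↭-refl; ↭-sym; ↭-trans; prep)
open import Data.List.Relation.Binary.Permutation.Propositional.Properties using (¬x∷xs↭[]; ∈-resp-↭; drop-mid; shift)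
open import Data.List.Relation.Unary.All using (All)
open import Data.List.Relation.Unary.Any using (here)
open import Data.List.Relation.Unary.Linked using (Linked; linked?)
open import Data.Nat.Base using (ℕ; zero; suc; _+_; _∸_; _≤_; _≥_; _!)
open import Data.Nat.ListAction using (sum)
import Data.Nat.Properties as ℕ
open import Data.Product.Base using (_×_; _,_; map₁)
open import Data.Rational.Base using (ℚ; 0ℚ; 1ℚ) renaming (_/_ to _/ℚ_; _+_ to _+ℚ_; _*_ to _*ℚ_)
import Data.Rational.Properties as ℚ
open import Data.Sum.Base using ([_,_]′)
open import Data.Vec.Base using (Vec; []; _∷_; toList; replicate; zipWith; tabulate; count; _[_]≔_) renaming (lookup to lookupᵛ; sum to sumᵛ)
open import Data.Vec.Properties using (≡-dec)
import Data.Vec.Relation.Unary.All as Vec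
open import Function.Base using (_∘_)
open import Level using (Level; _⊔_) renaming (suc to lsuc)
open import Relation.Binary.Definitions using (DecidableEquality; Decidable; Symmetric; Irreflexive)
open import Relation.Binary.PropositionalEquality using (_≡_; _≢_; refl; ≢-sym)
open import Relation.Nullary.Decidable using (Dec; yes; no; does; map′; ¬?; _×-dec_; _→-dec_)

private
  variable
    a c r ℓ ℓ′ : Level
    k N : ℕ

infix 4 _⊢_
_⊢_ : List ℕ → ℕ → Set
η ⊢ n = Linked _≥_ η × All (1 ≤_) η × sum η ≡ n

firstPart : List ℕ → ℕ
firstPart []      = 0
firstPart (h ∷ _) = h

compositions : ℕ → List (List ℕ)
compositions zero    = [] ∷ []
compositions (suc n) = concatMap grow (compositions n)
  where
  grow : List ℕ → List (List ℕ)
  grow []       = (1 ∷ []) ∷ []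
  grow (p ∷ ps) = (1 ∷ p ∷ ps) ∷ (suc p ∷ ps) ∷ []

partitions : ℕ → List (List ℕ)
partitions n = filter (linked? ℕ._≥?_) (compositions n)

infix 4 _↭?_
_↭?_ : (xs ys : List ℕ) → Dec (xs ↭ ys)
[]     ↭? []     = yes ↭-refl
[]     ↭? y ∷ ys = no (¬x∷xs↭[] ∘ ↭-sym)
x ∷ xs ↭? ys with _∈?_ ℕ._≟_ x ys
... | no  x∉ys = no λ p → x∉ys (∈-resp-↭ p (here refl))
... | yes x∈ys with ∈-∃++ x∈ys
...   | as , bs , refl = map′ (λ p → ↭-trans (prep x p) (↭-sym (shift x as bs)))
                              (drop-mid [] as)
                              (xs ↭? as ++ bs)

below : Vec ℕ N → List (Vec ℕ N)
below []      = [] ∷ []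
below (b ∷ β) = cartesianProductWith _∷_ (upTo (suc b)) (below β)

module Sums (R : RawRing c ℓ) where
  open RawRing R using (Carrier; 0#; 1#) renaming (_+_ to _⊕_; _*_ to _⊗_)
  open RawSemiringDefinitions (RawRing.rawSemiring R) using (_^_) public

  ∑ : {A : Set a} → List A → (A → Carrier) → Carrier
  ∑ xs f = foldr _⊕_ 0# (map f xs)

  ∏ : {A : Set a} → List A → (A → Carrier) → Carrier
  ∏ xs f = foldr _⊗_ 1# (map f xs)

  syntax ∑ xs (λ x → t) = ∑[ x ∈ xs ] t
  syntax ∏ xs (λ x → t) = ∏[ x ∈ xs ] t

-- Finite formal sums of terms r·m, with r in R and m in the commutative monoid
-- M of exponents.  A monomial may occur in several terms, or with coefficient
-- zero, so equality compares coefficients.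

module MonoidAlgebra (R : RawRing c ℓ) {M : Set} (_≟_ : DecidableEquality M) (_∙_ : Op₂ M) (ε : M) where
  private module R = RawRing R

  Polynomial : Set c
  Polynomial = List (R.Carrier × M)

  coeff : M → Polynomial → R.Carrier
  coeff m = foldr (λ (b , m′) s → if does (m′ ≟ m) then b R.+ s else s) R.0#

  const : R.Carrier → Polynomial
  const b = (b , ε) ∷ []

  rawRing : RawRing c ℓ
  rawRing = record
    { Carrier = Polynomial
    ; _≈_     = λ p q → ∀ m → coeff m p R.≈ coeff m q
    ; _+_     = _++_
    ; _*_     = cartesianProductWith (λ (b , m) (b′ , m′) → b R.* b′ , m ∙ m′)
    ; -_      = map (map₁ R.-_)
    ; 0#      = []
    ; 1#      = const R.1#
    }

module Univariate {c ℓ : Level} (R : RawRing c ℓ) = MonoidAlgebra R ℕ._≟_ _+_ 0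

module Multivariate {c ℓ : Level} (R : RawRing c ℓ) (k : ℕ) =
  MonoidAlgebra R (≡-dec {n = k} ℕ._≟_) (zipWith _+_) (replicate k 0)

ℚ[u] : ℕ → RawRing _ _
ℚ[u] k = Multivariate.rawRing ℚ.+-*-rawRing k

u : Fin k → RawRing.Carrier (ℚ[u] k)
u {k} i = (1ℚ , (replicate k 0 [ i ]≔ 1)) ∷ []

[u^_] : Vec ℕ k → RawRing.Carrier (ℚ[u] k) → ℚ
[u^_] {k} = Multivariate.coeff ℚ.+-*-rawRing k

-- A commutative extension ring of R over which the polynomial f of R[z] is the
-- product of the d linear factors z - yₐ.  As ι is injective, an element of S is
-- the image of at most one element of R.

record SplittingAlgebra (R : RawRing r ℓ′) (f : Univariate.Polynomial R) (d : ℕ)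
                        (c ℓ : Level) : Set (r ⊔ ℓ′ ⊔ lsuc (c ⊔ ℓ)) where
  field
    S : CommutativeRing c ℓ
  open CommutativeRing S using (Carrier; 1#; -_)
  open CommutativeRing S public using (_≈_; rawRing)
  open RingMorphisms R rawRing using (IsRingMonomorphism)
  private
    S[z] = Univariate.rawRing rawRing
    open Sums S[z] using (∏)
  field
    ι                  : RawRing.Carrier R → Carrier
    isRingMonomorphism : IsRingMonomorphism ι
    y                  : Vec Carrier d
    splits             : RawRing._≈_ S[z] (map (map₁ ι) f)
                           (∏[ yₐ ∈ toList y ] ((1# , 1) ∷ (- yₐ , 0) ∷ []))

-- For η weakly decreasing, firstPart η is the largest part η₁ (0 if η is empty).

module _ (η : List ℕ) where
  open RawRing (ℚ[u] (length η)) using (Carrier; _*_; -_; 1#)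
  open Sums (ℚ[u] (length η))

  E : ℕ → Carrier
  E j = Multivariate.const ℚ.+-*-rawRing (length η) (((+ 1) /ℚ (j !)) {{j ℕ.!≢0}})
        * (∑[ i ∈ filter (λ i → j ℕ.≤? lookup η i) (allFin (length η)) ] (u i ^ j))

  -- The leading coefficient is given separately because E 0 is not 1.
  rootPolynomial : Univariate.Polynomial (ℚ[u] (length η))
  rootPolynomial =
    (1# , firstPart η) ∷
    map (λ j → ((- 1#) ^ j * E j , firstPart η ∸ j)) (map suc (upTo (firstPart η)))

-- m_μ(y₁,…,y_d) is the sum of the distinct monomials y^α, α ∈ ℕᵈ, such that the
-- nonzero entries of α are a rearrangement of μ.  Such α have entries at most |μ|.

module _ (R : RawRing c ℓ) where
  open RawRing R using (Carrier)
  open Sums R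

  monomial : Vec ℕ k → Vec Carrier k → Carrier
  monomial α y = ∏[ t ∈ toList (zipWith _^_ y α) ] t

  m : List ℕ → Vec Carrier k → Carrier
  m {k} μ y =
    ∑[ α ∈ filter (λ α → filter (1 ℕ.≤?_) (toList α) ↭? μ) (below (replicate k (sum μ))) ]
      monomial α y

-- Formal power series in x₁, x₂, …: f α, for α ∈ ℕᴺ, is the coefficient of
-- x₁^α₁ ⋯ x_N^α_N.  Every monomial involves finitely many variables, so it is of
-- this form for all large N.

Series : Set
Series = ∀ {N} → Vec ℕ N → ℚ

indicator : {P : Set a} → Dec P → ℚ
indicator P? = if does P? then 1ℚ else 0ℚ

fromℕ : ℕ → ℚ
fromℕ n = (+ n) /ℚ 1

1ₛ : Series
1ₛ α = indicator (Vec.all? (ℕ._≟ 0) α)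

infixl 7 _*ₛ_
_*ₛ_ : Series → Series → Series
(f *ₛ g) α = ∑[ β ∈ below α ] (f β *ℚ g (zipWith _∸_ α β))
  where open Sums ℚ.+-*-rawRing

eₖ : ℕ → Series
eₖ k α = indicator (Vec.all? (ℕ._≤? 1) α ×-dec (sumᵛ α ℕ.≟ k))

e : List ℕ → Series
e []      = 1ₛ
e (k ∷ μ) = eₖ k *ₛ e μ

record Graph : Set₁ where
  field
    order  : ℕ
    Adj    : Fin order → Fin order → Set
    adj?   : Decidable Adj
    sym    : Symmetric Adj
    irrefl : Irreflexive _≡_ Adj

part : (η : List ℕ) → Fin (sum η) → Fin (length η)
part (h ∷ η) v = [ (λ _ → zero) , suc ∘ part η ]′ (splitAt h v)

K : List ℕ → Graph
K η = record
  { order  = sum η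
  ; Adj    = λ v w → part η v ≢ part η w
  ; adj?   = λ v w → ¬? (part η v Fin.≟ part η w)
  ; sym    = ≢-sym
  ; irrefl = λ { refl v≢v → v≢v refl }
  }

-- A colouring contributing to the coefficient of x₁^α₁ ⋯ x_N^α_N uses only the
-- first N colours.

module _ (G : Graph) where
  open Graph G

  Colouring : ℕ → Set
  Colouring N = Vec (Fin N) order

  Proper : Colouring N → Set
  Proper κ = ∀ v w → Adj v w → lookupᵛ κ v ≢ lookupᵛ κ w

  proper? : (κ : Colouring N) → Dec (Proper κ)
  proper? κ = Fin.all? λ v → Fin.all? λ w →
    adj? v w →-dec ¬? (lookupᵛ κ v Fin.≟ lookupᵛ κ w)

  colourCounts : Colouring N → Vec ℕ N
  colourCounts κ = tabulate λ i → count (Fin._≟ i) κ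

  words : (N n : ℕ) → List (Vec (Fin N) n)
  words N zero    = [] ∷ []
  words N (suc n) = cartesianProductWith _∷_ (allFin N) (words N n)

  X : Series
  X {N} α = fromℕ (length (filter (λ κ → proper? κ ×-dec ≡-dec ℕ._≟_ (colourCounts κ) α)
                                  (words N order)))

{-# OPTIONS --safe #-}
module Submission where

-- Comparing coefficients of x^α in the dual Cauchy identity
-- ∏ᵢ (1 + e₁(y) xᵢ + e₂(y) xᵢ² + …) = ∑_μ m_μ(y) e_μ(x) and using e_j(y) = E_j, the
-- coefficient of x^α in ∑_μ m_μ(y) e_μ(x) is ∏ᵢ E_{αᵢ}.  Its u^η-coefficient is
-- 1/α! times the number of ways to give each colour to one part so that the part
-- η_j receives η_j uses of colours in total; multiplying by η! turns this into a
-- product of multinomial coefficients, which counts the proper colourings of K_η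
-- with colour counts α.  That m_μ(y) lies in ℚ[u] follows from Newton's identities:
-- power sums are polynomials in the e_j(y), and multiplying a monomial symmetric
-- function by a power sum adds one part, up to functions with fewer parts.

open import Defs
open import Algebra.Bundles.Raw using (RawRing)
open import Data.List.Base using (List; length; map)
open import Data.Nat.Base using (ℕ; _!)
open import Data.Nat.ListAction using (product)
open import Data.Product.Base using (Σ-syntax; _×_)
open import Data.Rational.Base using (ℚ; _*_)
open import Data.Rational.Properties using (+-*-rawRing)
open import Data.Vec.Base using (Vec; fromList)
open import Relation.Binary.PropositionalEquality using (_≡_)

open import Algebra.Bundles using (CommutativeRing)
open import Algebra.Core using (Op₂)
open import Algebra.Morphism.Structures using (module RingMorphisms)
import Algebra.Properties.Ring as RingProperties
import Algebra.Solver.Ring.NaturalCoefficients.Default as Solver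
open import Data.Bool.Base using (true; false; if_then_else_)
open import Data.Fin.Base using (Fin; zero; suc; _↑ˡ_; _↑ʳ_; splitAt)
import Data.Fin.Properties as Fin
import Data.Integer.Base as ℤ
import Data.Integer.Properties as ℤ
open import Data.List.Base as List using ([]; _∷_; _++_; concatMap; filter; upTo; allFin; cartesianProductWith)
open import Data.List.Membership.Propositional using (_∈_)
open import Data.List.Membership.Propositional.Properties using (∈-upTo⁻; ∈-cartesianProductWith⁻; ∈-filter⁻)
open import Data.List.Properties as List using (∷-injectiveʳ; map-upTo; map-tabulate; map-∘; map-cong; filter-reject; filter-none; ++-identityʳ)
open import Data.List.Relation.Binary.Permutation.Propositional as ↭ using (_↭_; refl; prep; swap; trans; ↭-refl; ↭-sym; ↭-trans; ↭⇒↭ₛ)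
open import Data.List.Relation.Binary.Permutation.Propositional.Properties using (filter-↭; ↭-length; drop-∷; All-resp-↭)
open import Data.List.Relation.Binary.Pointwise using (Pointwise-≡⇒≡)
open import Data.List.Relation.Unary.All as All using (All; []; _∷_)
import Data.List.Relation.Unary.All.Properties as All
open import Data.List.Relation.Unary.Any using (here; there)
open import Data.List.Relation.Unary.Linked using (Linked; linked?; _∷_)
open import Data.List.Relation.Unary.Sorted.TotalOrder.Properties using (↗↭↗⇒≋)
import Data.List.Sort as Sort
open import Data.Nat.Base using (zero; suc; _+_; _∸_; _≤_; _≥_; _<_; z≤n; s≤s; NonZero) renaming (_*_ to _*ℕ_)
open import Data.Nat.ListAction using (sum)
open import Data.Nat.ListAction.Properties using (sum-↭)
import Data.Nat.Properties as ℕ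
open import Algebra.Properties.CommutativeSemigroup ℕ.+-commutativeSemigroup using (interchange)
open import Data.Product.Base using (∃-syntax; _,_; proj₁; proj₂; uncurry; map₁)
import Data.Rational.Base as ℚ
open import Data.Rational.Base using (0ℚ; 1ℚ) renaming (_/_ to _/ℚ_)
import Data.Rational.Properties as ℚ
open import Data.Rational.Unnormalised.Base as ℚᵘ using (mkℚᵘ; *≡*)
import Data.Rational.Unnormalised.Properties as ℚᵘ
open import Data.Sum.Base using (_⊎_; inj₁; inj₂; [_,_]′)
open import Data.Vec.Base using ([]; _∷_; toList; replicate; zipWith; tabulate; count; lookup; updateAt; _[_]≔_) renaming (sum to sumᵛ; _++_ to _++ᵥ_)
import Data.Vec.Properties as Vec
open import Data.Vec.Relation.Binary.Pointwise.Inductive as Pointwise using (Pointwise; []; _∷_)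
open import Data.Vec.Relation.Unary.All as AllV using ([]; _∷_)
open import Function.Base using (_∘_; id)
open import Level using (Level; _⊔_)
open import Relation.Binary.Bundles using (DecTotalOrder)
open import Relation.Binary.Definitions using (DecidableEquality)
open import Relation.Binary.Properties.DecTotalOrder ℕ.≤-decTotalOrder using (≥-decTotalOrder)
open import Relation.Binary.PropositionalEquality as ≡ using (_≢_)
open import Relation.Nullary using (¬_; contradiction)
open import Relation.Nullary.Decidable using (Dec; yes; no; does; _×-dec_; _⊎-dec_; dec-true; dec-false)
open import Relation.Unary using (Pred)

-- The splitting algebra `S` is an arbitrary commutative extension, and polynomials over ℚ are
-- unnormalised lists, so ring calculations are carried out in `S` or in ℚ. An identity reaches ℚ[u]
-- only through injectivity of `ι`, and its `u`-coefficients are then compared in ℚ.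
--
-- The condition η_i ≥ j in E_j has two effects. It makes E_j empty for j > η_1, in agreement with
-- e_j(y) = 0 for η_1 roots, so e_j(y) = E_j holds for every j ≥ 1 and no bound on the entries of α
-- is required. It loses nothing in the coefficient of u^η, since u_i^j can only contribute there if
-- j ≤ η_i.
--
-- Both sides of the theorem meet in the number `distributions`. It is defined by recursion on the
-- parts, which suits colourings; its recursion on the colours suits the product of the E's, and the
-- agreement of the two recursions is the double count. Statements are multiplied by α! throughout,
-- so that the counting takes place in any commutative ring; α! is cancelled in ℚ at the end.

private
  variable
    a b p p′ : Level
    A B : Set a
    d k n N : ℕ

infix 4 _≤ᵥ_
_≤ᵥ_ : Vec ℕ N → Vec ℕ N → Set
_≤ᵥ_ = Pointwise _≤_

infixl 6 _∸ᵥ_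
_∸ᵥ_ : Vec ℕ N → Vec ℕ N → Vec ℕ N
_∸ᵥ_ = zipWith _∸_

-- Finite sums in a commutative ring, with conditions written as 0-1 factors.

module FiniteSums {c ℓ} (S : CommutativeRing c ℓ) where
  open CommutativeRing S public hiding (zero; _≉_) renaming
    ( _+_ to infixl 6 _⊕_; _*_ to infixl 7 _⊗_; -_ to infix 8 ⊖_
    ; refl to ≈-refl; sym to ≈-sym; trans to ≈-trans; reflexive to ≈-reflexive )
  open Sums rawRing public
  open import Relation.Binary.Reasoning.Setoid setoid public
  open Solver commutativeSemiring public using (solve; _:+_; _:*_; _:=_)

  ind : {P : Set p} → Dec P → Carrier
  ind P? = if does P? then 1# else 0#

  ind-true : {P : Set p} (P? : Dec P) → P → ind P? ≡ 1#
  ind-true P? p rewrite dec-true P? p = ≡.refl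

  ind-false : {P : Set p} (P? : Dec P) → ¬ P → ind P? ≡ 0#
  ind-false P? ¬p rewrite dec-false P? ¬p = ≡.refl

  ind-true-⊗ : {P : Set p} (P? : Dec P) → P → ∀ {x} → ind P? ⊗ x ≈ x
  ind-true-⊗ P? p = ≈-trans (*-congʳ (≈-reflexive (ind-true P? p))) (*-identityˡ _)

  ind-false-⊗ : {P : Set p} (P? : Dec P) → ¬ P → ∀ {x} → ind P? ⊗ x ≈ 0#
  ind-false-⊗ P? ¬p = ≈-trans (*-congʳ (≈-reflexive (ind-false P? ¬p))) (zeroˡ _)

  ind-cong : {P : Set p} {Q : Set p′} (P? : Dec P) (Q? : Dec Q) →
             (P → Q) → (Q → P) → ind P? ≈ ind Q?
  ind-cong (yes p) Q? f g = ≈-reflexive (≡.sym (ind-true Q? (f p)))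
  ind-cong (no ¬p) Q? f g = ≈-reflexive (≡.sym (ind-false Q? (¬p ∘ g)))

  ind-× : {P : Set p} {Q : Set p′} (P? : Dec P) (Q? : Dec Q) →
          ind (P? ×-dec Q?) ≈ ind P? ⊗ ind Q?
  ind-× (yes p) Q? = ≈-sym (*-identityˡ _)
  ind-× (no ¬p) Q? = ≈-sym (zeroˡ _)

  -- Allows a summand to be rewritten under the assumption that its indicator tests: where the
  -- assumption fails, both products vanish.
  ind-⊗-cong : {P : Set p} (P? : Dec P) {x y : Carrier} → (P → x ≈ y) → ind P? ⊗ x ≈ ind P? ⊗ y
  ind-⊗-cong (yes p) f = *-congˡ (f p)
  ind-⊗-cong (no ¬p) f = ≈-trans (zeroˡ _) (≈-sym (zeroˡ _))

  ⊗-swap : ∀ x y z → x ⊗ (y ⊗ z) ≈ y ⊗ (x ⊗ z)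
  ⊗-swap = solve 3 (λ x y z → (x :* (y :* z)) := (y :* (x :* z))) ≈-refl

  ⊗-interchange : ∀ w x y z → w ⊗ x ⊗ (y ⊗ z) ≈ w ⊗ y ⊗ (x ⊗ z)
  ⊗-interchange = solve 4 (λ w x y z → w :* x :* (y :* z) := w :* y :* (x :* z)) ≈-refl

  ^-⊕ : ∀ x m n → x ^ (m + n) ≈ x ^ m ⊗ x ^ n
  ^-⊕ x zero    n = ≈-sym (*-identityˡ _)
  ^-⊕ x (suc m) n = ≈-trans (*-congˡ (^-⊕ x m n)) (≈-sym (*-assoc _ _ _))

  ∑-cong-∈ : (xs : List A) {f g : A → Carrier} → (∀ x → x ∈ xs → f x ≈ g x) → ∑ xs f ≈ ∑ xs g
  ∑-cong-∈ []       f≈g = ≈-refl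
  ∑-cong-∈ (x ∷ xs) f≈g = +-cong (f≈g x (here ≡.refl)) (∑-cong-∈ xs (λ z z∈ → f≈g z (there z∈)))

  ∑-cong : (xs : List A) {f g : A → Carrier} → (∀ x → f x ≈ g x) → ∑ xs f ≈ ∑ xs g
  ∑-cong xs f≈g = ∑-cong-∈ xs (λ x _ → f≈g x)

  ∑-0 : (xs : List A) → ∑[ x ∈ xs ] 0# ≈ 0#
  ∑-0 []       = ≈-refl
  ∑-0 (x ∷ xs) = ≈-trans (+-identityˡ _) (∑-0 xs)

  ∑-zero : (xs : List A) {f : A → Carrier} → (∀ x → f x ≈ 0#) → ∑ xs f ≈ 0#
  ∑-zero xs f≈0 = ≈-trans (∑-cong xs f≈0) (∑-0 xs)

  ⊕-interchange : ∀ w x y z → (w ⊕ x) ⊕ (y ⊕ z) ≈ (w ⊕ y) ⊕ (x ⊕ z)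
  ⊕-interchange = solve 4 (λ w x y z → ((w :+ x) :+ (y :+ z)) := ((w :+ y) :+ (x :+ z))) ≈-refl

  ∑-⊕ : (xs : List A) (f g : A → Carrier) → ∑[ x ∈ xs ] (f x ⊕ g x) ≈ ∑ xs f ⊕ ∑ xs g
  ∑-⊕ []       f g = ≈-sym (+-identityˡ _)
  ∑-⊕ (x ∷ xs) f g = ≈-trans (+-congˡ (∑-⊕ xs f g)) (⊕-interchange _ _ _ _)

  ∑-⊗ˡ : ∀ r (xs : List A) (f : A → Carrier) → r ⊗ ∑ xs f ≈ ∑[ x ∈ xs ] (r ⊗ f x)
  ∑-⊗ˡ r []       f = zeroʳ r
  ∑-⊗ˡ r (x ∷ xs) f = ≈-trans (distribˡ r _ _) (+-congˡ (∑-⊗ˡ r xs f))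

  ∑-⊗ʳ : ∀ r (xs : List A) (f : A → Carrier) → ∑ xs f ⊗ r ≈ ∑[ x ∈ xs ] (f x ⊗ r)
  ∑-⊗ʳ r []       f = zeroˡ r
  ∑-⊗ʳ r (x ∷ xs) f = ≈-trans (distribʳ r _ _) (+-congˡ (∑-⊗ʳ r xs f))

  ∑-comm : (xs : List A) (ys : List B) (f : A → B → Carrier) →
           ∑[ x ∈ xs ] ∑[ y ∈ ys ] f x y ≈ ∑[ y ∈ ys ] ∑[ x ∈ xs ] f x y
  ∑-comm []       ys f = ≈-sym (∑-0 ys)
  ∑-comm (x ∷ xs) ys f = ≈-trans (+-congˡ (∑-comm xs ys f)) (≈-sym (∑-⊕ ys _ _))

  ∑-++ : (xs ys : List A) (f : A → Carrier) → ∑ (xs ++ ys) f ≈ ∑ xs f ⊕ ∑ ys f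
  ∑-++ []       ys f = ≈-sym (+-identityˡ _)
  ∑-++ (x ∷ xs) ys f = ≈-trans (+-congˡ (∑-++ xs ys f)) (≈-sym (+-assoc _ _ _))

  ∑-map : (h : A → B) (xs : List A) (f : B → Carrier) → ∑ (map h xs) f ≡ ∑ xs (f ∘ h)
  ∑-map h []       f = ≡.refl
  ∑-map h (x ∷ xs) f = ≡.cong (f (h x) ⊕_) (∑-map h xs f)

  ∑-concatMap : (h : A → List B) (xs : List A) (f : B → Carrier) →
                ∑ (concatMap h xs) f ≈ ∑[ x ∈ xs ] ∑ (h x) f
  ∑-concatMap h []       f = ≈-refl
  ∑-concatMap h (x ∷ xs) f = ≈-trans (∑-++ (h x) _ f) (+-congˡ (∑-concatMap h xs f))

  ∑-cartesianProductWith : {C : Set b} (h : A → B → C) (xs : List A) (ys : List B) (f : C → Carrier) →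
    ∑ (cartesianProductWith h xs ys) f ≈ ∑[ x ∈ xs ] ∑[ y ∈ ys ] f (h x y)
  ∑-cartesianProductWith h []       ys f = ≈-refl
  ∑-cartesianProductWith h (x ∷ xs) ys f = ≈-trans (∑-++ (map (h x) ys) _ f)
    (+-cong (≈-reflexive (∑-map (h x) ys f)) (∑-cartesianProductWith h xs ys f))

  ∑-filter : {P : Pred A p} (P? : ∀ x → Dec (P x)) (xs : List A) (f : A → Carrier) →
             ∑ (filter P? xs) f ≈ ∑[ x ∈ xs ] (ind (P? x) ⊗ f x)
  ∑-filter P? []       f = ≈-refl
  ∑-filter P? (x ∷ xs) f with does (P? x)
  ... | true  = +-cong (≈-sym (*-identityˡ _)) (∑-filter P? xs f)
  ... | false = ≈-trans (∑-filter P? xs f) (≈-trans (≈-sym (+-identityˡ _)) (+-congʳ (≈-sym (zeroˡ _))))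

  ∑-↭ : {xs ys : List A} (f : A → Carrier) → xs ↭ ys → ∑ xs f ≈ ∑ ys f
  ∑-↭ f refl         = ≈-refl
  ∑-↭ f (prep x p)   = +-congˡ (∑-↭ f p)
  ∑-↭ f (swap x y p) = ≈-trans (+-congˡ (+-congˡ (∑-↭ f p)))
    (≈-trans (≈-sym (+-assoc _ _ _)) (≈-trans (+-congʳ (+-comm _ _)) (+-assoc _ _ _)))
  ∑-↭ f (trans p q)  = ≈-trans (∑-↭ f p) (∑-↭ f q)

  ∑-upTo-suc : ∀ n (f : ℕ → Carrier) → ∑ (upTo (suc n)) f ≡ f 0 ⊕ ∑ (upTo n) (f ∘ suc)
  ∑-upTo-suc n f = ≡.cong (f 0 ⊕_)
    (≡.trans (≡.cong (λ xs → ∑ xs f) (≡.sym (map-upTo suc n))) (∑-map suc (upTo n) f))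

  ∑-allFin-suc : ∀ n (f : Fin (suc n) → Carrier) → ∑ (allFin (suc n)) f ≡ f zero ⊕ ∑ (allFin n) (f ∘ suc)
  ∑-allFin-suc n f = ≡.cong (f zero ⊕_)
    (≡.trans (≡.cong (λ xs → ∑ xs f) (≡.sym (map-tabulate id suc))) (∑-map suc (allFin n) f))

  ∑-upTo-ind : ∀ n {i} → i < n → (f : ℕ → Carrier) → ∑[ j ∈ upTo n ] (ind (j ℕ.≟ i) ⊗ f j) ≈ f i
  ∑-upTo-ind (suc n) {zero}  _         f = begin
    ∑ (upTo (suc n)) (λ j → ind (j ℕ.≟ 0) ⊗ f j)  ≡⟨ ∑-upTo-suc n _ ⟩
    1# ⊗ f 0 ⊕ ∑ (upTo n) (λ j → 0# ⊗ f (suc j))  ≈⟨ +-cong (*-identityˡ _) (∑-zero (upTo n) (λ j → zeroˡ _)) ⟩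
    f 0 ⊕ 0#                                      ≈⟨ +-identityʳ _ ⟩
    f 0                                           ∎
  ∑-upTo-ind (suc n) {suc i} (s≤s i<n) f = begin
    ∑ (upTo (suc n)) (λ j → ind (j ℕ.≟ suc i) ⊗ f j)                ≡⟨ ∑-upTo-suc n _ ⟩
    0# ⊗ f 0 ⊕ ∑ (upTo n) (λ j → ind (suc j ℕ.≟ suc i) ⊗ f (suc j)) ≈⟨ +-cong (zeroˡ _) (∑-cong (upTo n) (λ j → *-congʳ
                                                                         (ind-cong (suc j ℕ.≟ suc i) (j ℕ.≟ i) ℕ.suc-injective (≡.cong suc)))) ⟩
    0# ⊕ ∑ (upTo n) (λ j → ind (j ℕ.≟ i) ⊗ f (suc j))               ≈⟨ +-identityˡ _ ⟩
    ∑ (upTo n) (λ j → ind (j ℕ.≟ i) ⊗ f (suc j))                    ≈⟨ ∑-upTo-ind n i<n (f ∘ suc) ⟩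
    f (suc i)                                                       ∎

  ∑-upTo-≤ : ∀ {m n} → m ≤ n → (f : ℕ → Carrier) →
             ∑ (upTo m) f ≈ ∑[ j ∈ upTo n ] (ind (j ℕ.<? m) ⊗ f j)
  ∑-upTo-≤ {zero}  {n}     z≤n       f = ≈-sym (∑-zero (upTo n) (λ j → zeroˡ _))
  ∑-upTo-≤ {suc m} {suc n} (s≤s m≤n) f = begin
    ∑ (upTo (suc m)) f                                                   ≡⟨ ∑-upTo-suc m f ⟩
    f 0 ⊕ ∑ (upTo m) (f ∘ suc)                                           ≈⟨ +-cong (≈-sym (*-identityˡ _)) (∑-upTo-≤ m≤n (f ∘ suc)) ⟩
    1# ⊗ f 0 ⊕ ∑ (upTo n) (λ j → ind (j ℕ.<? m) ⊗ f (suc j))             ≈⟨ +-congˡ (∑-cong (upTo n) (λ j → *-congʳ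
                                                                              (ind-cong (j ℕ.<? m) (suc j ℕ.<? suc m) s≤s ℕ.≤-pred))) ⟩
    1# ⊗ f 0 ⊕ ∑ (upTo n) (λ j → ind (suc j ℕ.<? suc m) ⊗ f (suc j))     ≡⟨ ≡.sym (∑-upTo-suc n _) ⟩
    ∑ (upTo (suc n)) (λ j → ind (j ℕ.<? suc m) ⊗ f j)                    ∎

  -- The inner range depends on `i`, so the two sums cannot be exchanged directly. Moving the bound
  -- into an indicator makes both ranges fixed and the condition symmetric in `i` and `j`.
  ∑-triangle : ∀ n (f : ℕ → ℕ → Carrier) →
    ∑[ i ∈ upTo (suc n) ] ∑[ j ∈ upTo (suc (n ∸ i)) ] f i j ≈
    ∑[ i ∈ upTo (suc n) ] ∑[ j ∈ upTo (suc n) ] (ind (i + j ℕ.≤? n) ⊗ f i j)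
  ∑-triangle n f = ∑-cong-∈ (upTo (suc n)) λ i i∈ → ≈-trans (∑-upTo-≤ (s≤s (ℕ.m∸n≤m n i)) (f i))
    (∑-cong (upTo (suc n)) λ j → *-congʳ (ind-cong (j ℕ.<? suc (n ∸ i)) (i + j ℕ.≤? n) (from i i∈ j) (to i i∈ j)))
    where
    from : ∀ i → i ∈ upTo (suc n) → ∀ j → j < suc (n ∸ i) → i + j ≤ n
    from i i∈ j (s≤s j≤) = ≡.subst (i + j ≤_) (ℕ.m+[n∸m]≡n (ℕ.≤-pred (∈-upTo⁻ i∈))) (ℕ.+-monoʳ-≤ i j≤)
    to : ∀ i → i ∈ upTo (suc n) → ∀ j → i + j ≤ n → j < suc (n ∸ i)
    to i i∈ j i+j≤n = s≤s (ℕ.m+n≤o⇒m≤o∸n j (≡.subst (_≤ n) (ℕ.+-comm i j) i+j≤n))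

  ∑-triangle-comm : ∀ n (f : ℕ → ℕ → Carrier) →
    ∑[ i ∈ upTo (suc n) ] ∑[ j ∈ upTo (suc (n ∸ i)) ] f i j ≈
    ∑[ j ∈ upTo (suc n) ] ∑[ i ∈ upTo (suc (n ∸ j)) ] f i j
  ∑-triangle-comm n f = begin
    ∑[ i ∈ upTo (suc n) ] ∑[ j ∈ upTo (suc (n ∸ i)) ] f i j                        ≈⟨ ∑-triangle n f ⟩
    ∑[ i ∈ upTo (suc n) ] ∑[ j ∈ upTo (suc n) ] (ind (i + j ℕ.≤? n) ⊗ f i j)       ≈⟨ ∑-comm (upTo (suc n)) (upTo (suc n)) _ ⟩
    ∑[ j ∈ upTo (suc n) ] ∑[ i ∈ upTo (suc n) ] (ind (i + j ℕ.≤? n) ⊗ f i j)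
      ≈⟨ ∑-cong (upTo (suc n)) (λ j → ∑-cong (upTo (suc n)) λ i → *-congʳ
           (ind-cong (i + j ℕ.≤? n) (j + i ℕ.≤? n)
           (≡.subst (_≤ n) (ℕ.+-comm i j)) (≡.subst (_≤ n) (ℕ.+-comm j i)))) ⟩
    ∑[ j ∈ upTo (suc n) ] ∑[ i ∈ upTo (suc n) ] (ind (j + i ℕ.≤? n) ⊗ f i j)       ≈⟨ ∑-triangle n (λ j i → f i j) ⟨
    ∑[ j ∈ upTo (suc n) ] ∑[ i ∈ upTo (suc (n ∸ j)) ] f i j                        ∎

  ∑-below-∷ : ∀ a (α : Vec ℕ N) (f : Vec ℕ (suc N) → Carrier) →
    ∑ (below (a ∷ α)) f ≈ ∑[ b ∈ upTo (suc a) ] ∑[ β ∈ below α ] f (b ∷ β)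
  ∑-below-∷ a α f = ∑-cartesianProductWith _∷_ (upTo (suc a)) (below α) f

  -- Both sides run over the pairs with β + γ ≤ α entrywise. This is what makes multiplication of
  -- formal power series independent of the order of the factors.
  ∑-below-comm : (α : Vec ℕ N) (f : Vec ℕ N → Vec ℕ N → Carrier) →
    ∑[ β ∈ below α ] ∑[ γ ∈ below (α ∸ᵥ β) ] f β γ ≈
    ∑[ γ ∈ below α ] ∑[ β ∈ below (α ∸ᵥ γ) ] f β γ
  ∑-below-comm []      f = ≈-refl
  ∑-below-comm (a ∷ α) f = begin
    ∑[ β ∈ below (a ∷ α) ] ∑[ γ ∈ below ((a ∷ α) ∸ᵥ β) ] f β γ
      ≈⟨ regroup f ⟩
    ∑[ i ∈ upTo (suc a) ] ∑[ j ∈ upTo (suc (a ∸ i)) ] ∑[ β ∈ below α ] ∑[ γ ∈ below (α ∸ᵥ β) ] f (i ∷ β) (j ∷ γ)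
      ≈⟨ ∑-cong (upTo (suc a)) (λ i → ∑-cong (upTo (suc (a ∸ i))) λ j → ∑-below-comm α _) ⟩
    ∑[ i ∈ upTo (suc a) ] ∑[ j ∈ upTo (suc (a ∸ i)) ] ∑[ γ ∈ below α ] ∑[ β ∈ below (α ∸ᵥ γ) ] f (i ∷ β) (j ∷ γ)
      ≈⟨ ∑-triangle-comm a _ ⟩
    ∑[ j ∈ upTo (suc a) ] ∑[ i ∈ upTo (suc (a ∸ j)) ] ∑[ γ ∈ below α ] ∑[ β ∈ below (α ∸ᵥ γ) ] f (i ∷ β) (j ∷ γ)
      ≈⟨ regroup (λ γ β → f β γ) ⟨
    ∑[ γ ∈ below (a ∷ α) ] ∑[ β ∈ below ((a ∷ α) ∸ᵥ γ) ] f β γ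
      ∎
    where
    regroup : (g : Vec ℕ (suc _) → Vec ℕ (suc _) → Carrier) → ∑[ β ∈ below (a ∷ α) ] ∑[ γ ∈ below ((a ∷ α) ∸ᵥ β) ] g β γ ≈
      ∑[ i ∈ upTo (suc a) ] ∑[ j ∈ upTo (suc (a ∸ i)) ] ∑[ β ∈ below α ] ∑[ γ ∈ below (α ∸ᵥ β) ] g (i ∷ β) (j ∷ γ)
    regroup g = begin
      ∑[ β ∈ below (a ∷ α) ] ∑[ γ ∈ below ((a ∷ α) ∸ᵥ β) ] g β γ
        ≈⟨ ∑-below-∷ a α _ ⟩
      ∑[ i ∈ upTo (suc a) ] ∑[ β ∈ below α ] ∑[ γ ∈ below ((a ∷ α) ∸ᵥ (i ∷ β)) ] g (i ∷ β) γ
        ≈⟨ ∑-cong (upTo (suc a)) (λ i → ∑-cong (below α) λ β → ∑-below-∷ (a ∸ i) (α ∸ᵥ β) _) ⟩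
      ∑[ i ∈ upTo (suc a) ] ∑[ β ∈ below α ] ∑[ j ∈ upTo (suc (a ∸ i)) ] ∑[ γ ∈ below (α ∸ᵥ β) ] g (i ∷ β) (j ∷ γ)
        ≈⟨ ∑-cong (upTo (suc a)) (λ i → ∑-comm (below α) (upTo (suc (a ∸ i))) _) ⟩
      ∑[ i ∈ upTo (suc a) ] ∑[ j ∈ upTo (suc (a ∸ i)) ] ∑[ β ∈ below α ] ∑[ γ ∈ below (α ∸ᵥ β) ] g (i ∷ β) (j ∷ γ)
        ∎

  -- The bound on `γ` guarantees that it occurs in the box; the box lists each vector once, so
  -- exactly one summand survives.
  ∑-below-ind : {α γ : Vec ℕ N} → γ ≤ᵥ α → (f : Vec ℕ N → Carrier) →
    ∑[ β ∈ below α ] (ind (Vec.≡-dec ℕ._≟_ β γ) ⊗ f β) ≈ f γ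
  ∑-below-ind []                              f = ≈-trans (+-identityʳ _) (*-identityˡ _)
  ∑-below-ind {α = a ∷ α} {c ∷ γ} (c≤a ∷ γ≤α) f = begin
    ∑[ β ∈ below (a ∷ α) ] (ind (Vec.≡-dec ℕ._≟_ β (c ∷ γ)) ⊗ f β)
      ≈⟨ ∑-below-∷ a α _ ⟩
    ∑[ b ∈ upTo (suc a) ] ∑[ β ∈ below α ] (ind (Vec.≡-dec ℕ._≟_ (b ∷ β) (c ∷ γ)) ⊗ f (b ∷ β))
      ≈⟨ ∑-cong (upTo (suc a)) (λ b → ∑-cong (below α) λ β → ≈-trans (*-congʳ (split b β)) (*-assoc _ _ _)) ⟩
    ∑[ b ∈ upTo (suc a) ] ∑[ β ∈ below α ] (ind (b ℕ.≟ c) ⊗ (ind (Vec.≡-dec ℕ._≟_ β γ) ⊗ f (b ∷ β)))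
      ≈⟨ ∑-cong (upTo (suc a)) (λ b → ∑-⊗ˡ (ind (b ℕ.≟ c)) (below α) _) ⟨
    ∑[ b ∈ upTo (suc a) ] (ind (b ℕ.≟ c) ⊗ ∑[ β ∈ below α ] (ind (Vec.≡-dec ℕ._≟_ β γ) ⊗ f (b ∷ β)))
      ≈⟨ ∑-upTo-ind (suc a) (s≤s c≤a) _ ⟩
    ∑[ β ∈ below α ] (ind (Vec.≡-dec ℕ._≟_ β γ) ⊗ f (c ∷ β))
      ≈⟨ ∑-below-ind γ≤α (λ β → f (c ∷ β)) ⟩
    f (c ∷ γ)
      ∎
    where
    split : ∀ b β → ind (Vec.≡-dec ℕ._≟_ (b ∷ β) (c ∷ γ)) ≈ ind (b ℕ.≟ c) ⊗ ind (Vec.≡-dec ℕ._≟_ β γ)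
    split b β = ≈-trans
      (ind-cong (Vec.≡-dec ℕ._≟_ (b ∷ β) (c ∷ γ)) (b ℕ.≟ c ×-dec Vec.≡-dec ℕ._≟_ β γ)
        (λ { ≡.refl → ≡.refl , ≡.refl }) (λ { (≡.refl , ≡.refl) → ≡.refl }))
      (ind-× (b ℕ.≟ c) (Vec.≡-dec ℕ._≟_ β γ))

∈-below : {α β : Vec ℕ N} → β ∈ below α → β ≤ᵥ α
∈-below {α = []}    {[]}    _  = []
∈-below {α = a ∷ α} {b ∷ β} β∈ with ∈-cartesianProductWith⁻ _∷_ (upTo (suc a)) (below α) β∈
... | _ , _ , b∈ , β∈ , ≡.refl = ℕ.≤-pred (∈-upTo⁻ b∈) ∷ ∈-below β∈

-- Newton's identities and augmented monomial symmetric functions.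

picks : List A → List (A × List A)
picks []       = []
picks (x ∷ xs) = (x , xs) ∷ map (λ (z , zs) → z , x ∷ zs) (picks xs)

-- When a power sum of exponent `k` multiplies an augmented monomial function, these are the cases
-- in which its variable coincides with one already in use.
merges : ℕ → List ℕ → List (List ℕ)
merges k []       = []
merges k (x ∷ xs) = (k + x ∷ xs) ∷ map (x ∷_) (merges k xs)

module SymmetricPolynomials {c ℓ} (S : CommutativeRing c ℓ) where
  open FiniteSums S

  esym : ℕ → Vec Carrier d → Carrier
  esym zero    _        = 1#
  esym (suc j) []       = 0#
  esym (suc j) (y ∷ ys) = esym (suc j) ys ⊕ y ⊗ esym j ys

  -- ∑ₐ yₐⁱ e_j(y without yₐ); for j = 0 these are the power sums.
  hook : ℕ → ℕ → Vec Carrier d → Carrier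
  hook i j       []       = 0#
  hook i zero    (y ∷ ys) = y ^ i ⊕ hook i zero ys
  hook i (suc j) (y ∷ ys) = y ^ i ⊗ esym (suc j) ys ⊕ hook i (suc j) ys ⊕ y ⊗ hook i j ys

  fromℕᴿ : ℕ → Carrier
  fromℕᴿ zero    = 0#
  fromℕᴿ (suc n) = 1# ⊕ fromℕᴿ n

  fromℕᴿ-+ : ∀ m n → fromℕᴿ (m + n) ≈ fromℕᴿ m ⊕ fromℕᴿ n
  fromℕᴿ-+ zero    n = ≈-sym (+-identityˡ _)
  fromℕᴿ-+ (suc m) n = ≈-trans (+-congˡ (fromℕᴿ-+ m n)) (≈-sym (+-assoc _ _ _))

  fromℕᴿ-* : ∀ m n → fromℕᴿ (m *ℕ n) ≈ fromℕᴿ m ⊗ fromℕᴿ n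
  fromℕᴿ-* zero    n = ≈-sym (zeroˡ _)
  fromℕᴿ-* (suc m) n = begin
    fromℕᴿ (n + m *ℕ n)                   ≈⟨ fromℕᴿ-+ n (m *ℕ n) ⟩
    fromℕᴿ n ⊕ fromℕᴿ (m *ℕ n)            ≈⟨ +-cong (≈-sym (*-identityˡ _)) (fromℕᴿ-* m n) ⟩
    1# ⊗ fromℕᴿ n ⊕ fromℕᴿ m ⊗ fromℕᴿ n  ≈⟨ distribʳ _ _ _ ⟨
    (1# ⊕ fromℕᴿ m) ⊗ fromℕᴿ n           ∎

  ∑-ind : {P : A → Set p} (P? : ∀ x → Dec (P x)) (xs : List A) →
          ∑[ x ∈ xs ] ind (P? x) ≈ fromℕᴿ (length (filter P? xs))
  ∑-ind P? []       = ≈-refl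
  ∑-ind P? (x ∷ xs) with does (P? x)
  ... | true  = +-congˡ (∑-ind P? xs)
  ... | false = ≈-trans (+-identityˡ _) (∑-ind P? xs)

  -- A product of j + 1 distinct variables arises once for each choice of the factor that is singled
  -- out.
  hook₁ : ∀ j (ys : Vec Carrier d) → hook 1 j ys ≈ fromℕᴿ (suc j) ⊗ esym (suc j) ys
  hook₁ j       []       = ≈-sym (zeroʳ _)
  hook₁ zero    (y ∷ ys) = begin
    y ⊗ 1# ⊕ hook 1 0 ys                          ≈⟨ +-congˡ (hook₁ 0 ys) ⟩
    y ⊗ 1# ⊕ (1# ⊕ 0#) ⊗ esym 1 ys
      ≈⟨ solve 4 (λ y u o e → (y :* u :+ (u :+ o) :* e) := ((u :+ o) :* e :+ y :* u)) ≈-refl y 1# 0# (esym 1 ys) ⟩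
    (1# ⊕ 0#) ⊗ esym 1 ys ⊕ y ⊗ 1#                ≈⟨ +-congˡ (≈-sym (≈-trans (*-congʳ (+-identityʳ _)) (*-identityˡ _))) ⟩
    (1# ⊕ 0#) ⊗ esym 1 ys ⊕ (1# ⊕ 0#) ⊗ (y ⊗ 1#)  ≈⟨ distribˡ _ _ _ ⟨
    (1# ⊕ 0#) ⊗ (esym 1 ys ⊕ y ⊗ 1#)              ∎
  hook₁ (suc j) (y ∷ ys) = begin
    y ⊗ 1# ⊗ e₁ ⊕ hook 1 (suc j) ys ⊕ y ⊗ hook 1 j ys
      ≈⟨ +-cong (+-cong (*-congʳ (*-identityʳ y)) (hook₁ (suc j) ys)) (*-congˡ (hook₁ j ys)) ⟩
    y ⊗ e₁ ⊕ (1# ⊕ r) ⊗ esym (suc (suc j)) ys ⊕ y ⊗ (r ⊗ e₁)             ≈⟨ +-congʳ (+-congʳ (*-identityˡ _)) ⟨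
    1# ⊗ (y ⊗ e₁) ⊕ (1# ⊕ r) ⊗ esym (suc (suc j)) ys ⊕ y ⊗ (r ⊗ e₁)
      ≈⟨ solve 5 (λ u y e n e₂ → (u :* (y :* e) :+ (u :+ n) :* e₂ :+ y :* (n :* e)) := ((u :+ n) :* (e₂ :+ y :* e)))
           ≈-refl 1# y e₁ r (esym (suc (suc j)) ys) ⟩
    (1# ⊕ r) ⊗ (esym (suc (suc j)) ys ⊕ y ⊗ e₁)                          ∎
    where
    e₁ = esym (suc j) ys
    r  = fromℕᴿ (suc j)

  -- A term is a power yₐⁱ times j + 1 distinct variables. Either yₐ is not among these, or it is,
  -- and then its exponent rises to i + 1 and j others remain.
  newton : ∀ i j (ys : Vec Carrier d) → hook i 0 ys ⊗ esym (suc j) ys ≈ hook i (suc j) ys ⊕ hook (suc i) j ys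
  newton i j       []       = ≈-trans (zeroˡ _) (≈-sym (+-identityˡ _))
  newton i zero    (y ∷ ys) = begin
    (y ^ i ⊕ h₀) ⊗ (esym 1 ys ⊕ y ⊗ 1#)                                    ≈⟨ *-congˡ (+-congˡ (*-identityʳ y)) ⟩
    (y ^ i ⊕ h₀) ⊗ (esym 1 ys ⊕ y)
      ≈⟨ solve 4 (λ w h e y → ((w :+ h) :* (e :+ y)) := (w :* e :+ h :* e :+ y :* h :+ y :* w))
           ≈-refl (y ^ i) h₀ (esym 1 ys) y ⟩
    y ^ i ⊗ esym 1 ys ⊕ h₀ ⊗ esym 1 ys ⊕ y ⊗ h₀ ⊕ y ⊗ y ^ i                ≈⟨ +-congʳ (+-congʳ (+-congˡ (newton i 0 ys))) ⟩
    y ^ i ⊗ esym 1 ys ⊕ (h₁ ⊕ h₀⁺) ⊕ y ⊗ h₀ ⊕ y ⊗ y ^ i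
      ≈⟨ solve 5 (λ w h h₁ h₂ y → (w :+ (h₁ :+ h₂) :+ h :+ y) := (w :+ h₁ :+ h :+ (y :+ h₂)))
           ≈-refl (y ^ i ⊗ esym 1 ys) (y ⊗ h₀) h₁ h₀⁺ (y ⊗ y ^ i) ⟩
    y ^ i ⊗ esym 1 ys ⊕ h₁ ⊕ y ⊗ h₀ ⊕ (y ⊗ y ^ i ⊕ h₀⁺)                    ∎
    where
    h₀ = hook i 0 ys
    h₁ = hook i 1 ys
    h₀⁺ = hook (suc i) 0 ys
  newton i (suc j) (y ∷ ys) = begin
    (y ^ i ⊕ h) ⊗ (e₂ ⊕ y ⊗ e₁)
      ≈⟨ solve 5 (λ w h e₂ y e₁ → ((w :+ h) :* (e₂ :+ y :* e₁)) := (w :* e₂ :+ h :* e₂ :+ y :* (h :* e₁) :+ y :* w :* e₁))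
           ≈-refl (y ^ i) h e₂ y e₁ ⟩
    y ^ i ⊗ e₂ ⊕ h ⊗ e₂ ⊕ y ⊗ (h ⊗ e₁) ⊕ y ⊗ y ^ i ⊗ e₁
      ≈⟨ +-congʳ (+-cong (+-congˡ (newton i (suc j) ys)) (*-congˡ (newton i j ys))) ⟩
    y ^ i ⊗ e₂ ⊕ (h₂ ⊕ h₁⁺) ⊕ y ⊗ (h₁ ⊕ h₀⁺) ⊕ y ⊗ y ^ i ⊗ e₁
      ≈⟨ solve 7 (λ a h₂ h₁⁺ y h₁ h₀⁺ b → (a :+ (h₂ :+ h₁⁺) :+ y :* (h₁ :+ h₀⁺) :+ b) := (a :+ h₂ :+ y :* h₁ :+ (b :+ h₁⁺ :+ y :* h₀⁺)))
           ≈-refl (y ^ i ⊗ e₂) h₂ h₁⁺ y h₁ h₀⁺ (y ⊗ y ^ i ⊗ e₁) ⟩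
    y ^ i ⊗ e₂ ⊕ h₂ ⊕ y ⊗ h₁ ⊕ (y ⊗ y ^ i ⊗ e₁ ⊕ h₁⁺ ⊕ y ⊗ h₀⁺)            ∎
    where
    h = hook i 0 ys
    e₁ = esym (suc j) ys
    e₂ = esym (suc (suc j)) ys
    h₁ = hook i (suc j) ys
    h₂ = hook i (suc (suc j)) ys
    h₀⁺ = hook (suc i) j ys
    h₁⁺ = hook (suc i) (suc j) ys

  -- The sum of y_{a₁}^μ₁ ⋯ y_{aₗ}^μₗ over all distinct a₁, …, aₗ.
  aug : List ℕ → Vec Carrier d → Carrier
  aug μ       (y ∷ ys) = aug μ ys ⊕ ∑[ (k , ν) ∈ picks μ ] (y ^ k ⊗ aug ν ys)
  aug []      []       = 1#
  aug (_ ∷ _) []       = 0#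

  -- The entry picked after a merge is either the merged one, of size k + z, or another one, in
  -- which case picking and merging can be done in the opposite order.
  ∑-merges-picks : ∀ k μ (f : ℕ → List ℕ → Carrier) →
    ∑[ ρ ∈ merges k μ ] ∑[ (z , ν) ∈ picks ρ ] f z ν ≈
    ∑[ (z , ν) ∈ picks μ ] f (k + z) ν ⊕ ∑[ (z , ν) ∈ picks μ ] ∑[ ρ ∈ merges k ν ] f z ρ
  ∑-merges-picks k []       f = ≈-sym (+-identityˡ _)
  ∑-merges-picks k (x ∷ xs) f = begin
    (f (k + x) xs ⊕ ∑ (map (λ (z , zs) → z , k + x ∷ zs) (picks xs)) (uncurry f))
      ⊕ ∑ (map (x ∷_) (merges k xs)) (λ ρ → ∑ (picks ρ) (uncurry f))
      ≡⟨ ≡.cong₂ (λ s t → (f (k + x) xs ⊕ s) ⊕ t) (∑-map _ (picks xs) _) (∑-map _ (merges k xs) _) ⟩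
    (f (k + x) xs ⊕ s₁) ⊕ ∑[ ρ ∈ merges k xs ] (f x ρ ⊕ ∑ (map (λ (z , zs) → z , x ∷ zs) (picks ρ)) (uncurry f))
      ≈⟨ +-congˡ (≈-trans (∑-cong (merges k xs) (λ ρ → +-congˡ (≈-reflexive (∑-map _ (picks ρ) _)))) (∑-⊕ (merges k xs) _ _)) ⟩
    (f (k + x) xs ⊕ s₁) ⊕ (s₂ ⊕ ∑[ ρ ∈ merges k xs ] ∑[ (z , ν) ∈ picks ρ ] f z (x ∷ ν))
      ≈⟨ +-congˡ (+-congˡ (∑-merges-picks k xs (λ z ν → f z (x ∷ ν)))) ⟩
    (f (k + x) xs ⊕ s₁) ⊕ (s₂ ⊕ (s₃ ⊕ s₄))
      ≈⟨ solve 5 (λ a s₁ s₂ s₃ s₄ → ((a :+ s₁) :+ (s₂ :+ (s₃ :+ s₄))) := ((a :+ s₃) :+ (s₂ :+ (s₁ :+ s₄)))) ≈-refl _ s₁ s₂ s₃ s₄ ⟩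
    (f (k + x) xs ⊕ s₃) ⊕ (s₂ ⊕ (s₁ ⊕ s₄))
      ≈⟨ +-congˡ (+-congˡ (≈-trans (∑-cong (picks xs) (λ (z , ν) → +-congˡ (≈-reflexive (∑-map (x ∷_) (merges k ν) (f z))))) (∑-⊕ (picks xs) _ _))) ⟨
    (f (k + x) xs ⊕ s₃) ⊕ (s₂ ⊕ ∑[ (z , ν) ∈ picks xs ] ∑[ ρ ∈ merges k (x ∷ ν) ] f z ρ)
      ≡⟨ ≡.cong₂ (λ s t → (f (k + x) xs ⊕ s) ⊕ (s₂ ⊕ t)) (∑-map _ (picks xs) _) (∑-map _ (picks xs) _) ⟨
    (f (k + x) xs ⊕ ∑ (map (λ (z , zs) → z , x ∷ zs) (picks xs)) (λ (z , ν) → f (k + z) ν))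
      ⊕ (s₂ ⊕ ∑ (map (λ (z , zs) → z , x ∷ zs) (picks xs)) (λ (z , ν) → ∑ (merges k ν) (f z)))
      ∎
    where
    s₁ = ∑[ (z , ν) ∈ picks xs ] f z (k + x ∷ ν)
    s₂ = ∑[ ρ ∈ merges k xs ] f x ρ
    s₃ = ∑[ (z , ν) ∈ picks xs ] f (k + z) (x ∷ ν)
    s₄ = ∑[ (z , ν) ∈ picks xs ] ∑[ ρ ∈ merges k ν ] f z (x ∷ ρ)

  -- The variable chosen by the power sum is either new, which adds the part `k`, or already carries
  -- some part of `μ`, to which `k` is then added.
  psum-aug : ∀ k μ (ys : Vec Carrier d) →
    hook k 0 ys ⊗ aug μ ys ≈ aug (k ∷ μ) ys ⊕ ∑[ ρ ∈ merges k μ ] aug ρ ys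
  psum-aug k []      []       = ≈-trans (zeroˡ _) (≈-sym (+-identityˡ _))
  psum-aug k (x ∷ μ) []       = begin
    0# ⊗ 0#                                          ≈⟨ zeroˡ _ ⟩
    0#                                               ≈⟨ ∑-0 (merges k μ) ⟨
    ∑[ ρ ∈ merges k μ ] 0#                           ≡⟨ ∑-map (x ∷_) (merges k μ) (λ ρ → aug ρ []) ⟨
    ∑ (map (x ∷_) (merges k μ)) (λ ρ → aug ρ [])     ≈⟨ ≈-trans (+-identityˡ _) (+-identityˡ _) ⟨
    0# ⊕ (0# ⊕ ∑ (map (x ∷_) (merges k μ)) (λ ρ → aug ρ [])) ∎
  psum-aug k μ       (y ∷ ys) = begin
    (y ^ k ⊕ h) ⊗ (aug μ ys ⊕ s)
      ≈⟨ solve 4 (λ w h a s → ((w :+ h) :* (a :+ s)) := (h :* a :+ h :* s :+ w :* a :+ w :* s)) ≈-refl (y ^ k) h (aug μ ys) s ⟩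
    h ⊗ aug μ ys ⊕ h ⊗ s ⊕ y ^ k ⊗ aug μ ys ⊕ y ^ k ⊗ s
      ≈⟨ +-cong (+-congʳ (+-cong (psum-aug k μ ys) h⊗s)) yᵏ⊗s ⟩
    (aug (k ∷ μ) ys ⊕ s₁) ⊕ (s₂ ⊕ s₃) ⊕ y ^ k ⊗ aug μ ys ⊕ s₄
      ≈⟨ solve 6 (λ a s₁ s₂ s₃ b s₄ → (a :+ s₁ :+ (s₂ :+ s₃) :+ b :+ s₄) := (a :+ (b :+ s₂) :+ (s₁ :+ (s₄ :+ s₃)))) ≈-refl
          (aug (k ∷ μ) ys) s₁ s₂ s₃ (y ^ k ⊗ aug μ ys) s₄ ⟩
    (aug (k ∷ μ) ys ⊕ (y ^ k ⊗ aug μ ys ⊕ s₂)) ⊕ (s₁ ⊕ (s₄ ⊕ s₃))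
      ≈⟨ +-congˡ (+-congˡ (∑-merges-picks k μ (λ z ν → y ^ z ⊗ aug ν ys))) ⟨
    (aug (k ∷ μ) ys ⊕ (y ^ k ⊗ aug μ ys ⊕ s₂)) ⊕ (s₁ ⊕ ∑[ ρ ∈ merges k μ ] ∑[ (z , ν) ∈ picks ρ ] (y ^ z ⊗ aug ν ys))
      ≈⟨ +-cong (+-congˡ (+-congˡ (≈-reflexive (∑-map _ (picks μ) _)))) (∑-⊕ (merges k μ) _ _) ⟨
    aug (k ∷ μ) (y ∷ ys) ⊕ ∑[ ρ ∈ merges k μ ] (aug ρ ys ⊕ ∑[ (z , ν) ∈ picks ρ ] (y ^ z ⊗ aug ν ys))
      ∎
    where
    h = hook k 0 ys
    s = ∑[ (z , ν) ∈ picks μ ] (y ^ z ⊗ aug ν ys)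
    s₁ = ∑[ ρ ∈ merges k μ ] aug ρ ys
    s₂ = ∑[ (z , ν) ∈ picks μ ] (y ^ z ⊗ aug (k ∷ ν) ys)
    s₃ = ∑[ (z , ν) ∈ picks μ ] ∑[ ρ ∈ merges k ν ] (y ^ z ⊗ aug ρ ys)
    s₄ = ∑[ (z , ν) ∈ picks μ ] (y ^ (k + z) ⊗ aug ν ys)
    h⊗s : h ⊗ s ≈ s₂ ⊕ s₃
    h⊗s = begin
      h ⊗ s
        ≈⟨ ∑-⊗ˡ h (picks μ) _ ⟩
      ∑[ (z , ν) ∈ picks μ ] (h ⊗ (y ^ z ⊗ aug ν ys))
        ≈⟨ ∑-cong (picks μ) (λ (z , ν) → ≈-trans (⊗-swap _ _ _) (≈-trans (*-congˡ (psum-aug k ν ys)) (distribˡ _ _ _))) ⟩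
      ∑[ (z , ν) ∈ picks μ ] (y ^ z ⊗ aug (k ∷ ν) ys ⊕ y ^ z ⊗ ∑[ ρ ∈ merges k ν ] aug ρ ys)
        ≈⟨ ∑-⊕ (picks μ) _ _ ⟩
      s₂ ⊕ ∑[ (z , ν) ∈ picks μ ] (y ^ z ⊗ ∑[ ρ ∈ merges k ν ] aug ρ ys)
        ≈⟨ +-congˡ (∑-cong (picks μ) (λ (z , ν) → ∑-⊗ˡ _ (merges k ν) _)) ⟩
      s₂ ⊕ s₃
        ∎
    yᵏ⊗s : y ^ k ⊗ s ≈ s₄
    yᵏ⊗s = ≈-trans (∑-⊗ˡ _ (picks μ) _)
      (∑-cong (picks μ) λ (z , ν) → ≈-trans (≈-sym (*-assoc _ _ _)) (*-congʳ (≈-sym (^-⊕ y k z))))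

  -- To be applied to the image of `ι`. Passing from elementary symmetric polynomials to power sums
  -- and to `aug` takes only subtraction, so plain subring closure suffices up to that point.
  record IsSubring (P : Carrier → Set p) : Set (c ⊔ ℓ ⊔ p) where
    field
      resp : ∀ {x y} → x ≈ y → P x → P y
      1-closed : P 1#
      ⊕-closed : ∀ {x y} → P x → P y → P (x ⊕ y)
      ⊗-closed : ∀ {x y} → P x → P y → P (x ⊗ y)
      ⊖-closed : ∀ {x} → P x → P (⊖ x)

    0-closed : P 0#
    0-closed = resp (-‿inverseʳ 1#) (⊕-closed 1-closed (⊖-closed 1-closed))

    fromℕᴿ-closed : ∀ n → P (fromℕᴿ n)
    fromℕᴿ-closed zero    = 0-closed
    fromℕᴿ-closed (suc n) = ⊕-closed 1-closed (fromℕᴿ-closed n)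

    ∑-closed : {xs : List A} {f : A → Carrier} → All (P ∘ f) xs → P (∑ xs f)
    ∑-closed []         = 0-closed
    ∑-closed (px ∷ pxs) = ⊕-closed px (∑-closed pxs)

    cancelˡ : ∀ {x y z} → x ≈ y ⊕ z → P x → P y → P z
    cancelˡ {x} {y} {z} x≈y+z px py = resp
      (begin
        x ⊕ ⊖ y        ≈⟨ +-congʳ (≈-trans x≈y+z (+-comm y z)) ⟩
        z ⊕ y ⊕ ⊖ y    ≈⟨ +-assoc z y (⊖ y) ⟩
        z ⊕ (y ⊕ ⊖ y)  ≈⟨ +-congˡ (-‿inverseʳ y) ⟩
        z ⊕ 0#         ≈⟨ +-identityʳ z ⟩
        z              ∎)
      (⊕-closed px (⊖-closed py))

  module _ {P : Carrier → Set p} (sub : IsSubring P) (ys : Vec Carrier d) (esym∈ : ∀ j → P (esym (suc j) ys)) where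
    open IsSubring sub

    -- Power sums are the case j = 0, but raising the exponent by one calls for the previous
    -- exponent with j + 1; hence the induction on `i` covers all `j` together.
    hook-closed : ∀ i j → P (hook (suc i) j ys)
    hook-closed zero    j = resp (≈-sym (hook₁ j ys)) (⊗-closed (fromℕᴿ-closed (suc j)) (esym∈ j))
    hook-closed (suc i) j = cancelˡ (newton (suc i) j ys)
      (⊗-closed (hook-closed i 0) (esym∈ j)) (hook-closed i (suc j))

    psum-closed : ∀ k → P (hook k 0 ys)
    -- `hook-closed` starts at exponent 1. The power sum of exponent 0 is the number of variables, a
    -- sum of ones.
    psum-closed zero    = hook₀ ys
      where
      hook₀ : ∀ {d} (ys : Vec Carrier d) → P (hook 0 0 ys)
      hook₀ []       = 0-closed
      hook₀ (y ∷ ys) = ⊕-closed 1-closed (hook₀ ys)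
    psum-closed (suc k) = hook-closed k 0

    length-merges : ∀ k μ → All (λ ρ → length ρ ≡ length μ) (merges k μ)
    length-merges k []      = []
    length-merges k (x ∷ μ) = ≡.refl ∷ All.map⁺ (All.map (≡.cong suc) (length-merges k μ))

    aug-[] : ∀ {d} (ys : Vec Carrier d) → aug [] ys ≈ 1#
    aug-[] []       = ≈-refl
    aug-[] (y ∷ ys) = ≈-trans (+-identityʳ _) (aug-[] ys)

    -- The merged lists are not sublists of `k ∷ μ`, but they are shorter by one, so the recursion
    -- is on the length `l`.
    aug-closed : ∀ l μ → length μ ≡ l → P (aug μ ys)
    aug-closed zero    []      _  = resp (≈-sym (aug-[] ys)) 1-closed
    aug-closed (suc l) (k ∷ μ) eq = cancelˡ (≈-trans (psum-aug k μ ys) (+-comm _ _))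
      (⊗-closed (psum-closed k) (aug-closed l μ |μ|))
      (∑-closed (All.map (λ {ρ} |ρ| → aug-closed l ρ (≡.trans |ρ| |μ|)) (length-merges k μ)))
      where |μ| = ℕ.suc-injective eq

-- From augmented to ordinary monomial symmetric functions.

nonzeros : Vec ℕ d → List ℕ
nonzeros α = filter (1 ℕ.≤?_) (toList α)

mult : ℕ → List ℕ → ℕ
mult k μ = length (filter (k ℕ.≟_) μ)

-- The product of the factorials of the multiplicities of the entries.
stabiliser : List ℕ → ℕ
stabiliser []      = 1
stabiliser (k ∷ μ) = suc (mult k μ) *ℕ stabiliser μ

stabiliser-nonZero : ∀ μ → NonZero (stabiliser μ)
stabiliser-nonZero []      = _
stabiliser-nonZero (k ∷ μ) = ℕ.m*n≢0 (suc (mult k μ)) (stabiliser μ) {{_}} {{stabiliser-nonZero μ}}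

mult-↭ : ∀ k {μ ν} → μ ↭ ν → mult k μ ≡ mult k ν
mult-↭ k p = ↭-length (filter-↭ (k ℕ.≟_) p)

stabiliser-swap : ∀ k l μ → stabiliser (k ∷ l ∷ μ) ≡ stabiliser (l ∷ k ∷ μ)
stabiliser-swap k l μ with k ℕ.≟ l
... | yes ≡.refl = ≡.refl
... | no k≢l     = begin
  suc (mult k (l ∷ μ)) *ℕ (suc (mult l μ) *ℕ stabiliser μ)  ≡⟨ ≡.cong (λ xs → suc (length xs) *ℕ _) (filter-reject (k ℕ.≟_) k≢l) ⟩
  suc (mult k μ) *ℕ (suc (mult l μ) *ℕ stabiliser μ)        ≡⟨ ⊗-comm (suc (mult k μ)) (suc (mult l μ)) (stabiliser μ) ⟩
  suc (mult l μ) *ℕ (suc (mult k μ) *ℕ stabiliser μ)        ≡⟨ ≡.cong (λ xs → suc (length xs) *ℕ _) (filter-reject (l ℕ.≟_) (k≢l ∘ ≡.sym)) ⟨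
  suc (mult l (k ∷ μ)) *ℕ (suc (mult k μ) *ℕ stabiliser μ)  ∎
  where
  open ≡.≡-Reasoning
  ⊗-comm : ∀ x y z → x *ℕ (y *ℕ z) ≡ y *ℕ (x *ℕ z)
  ⊗-comm x y z = ≡.trans (≡.sym (ℕ.*-assoc x y z)) (≡.trans (≡.cong (_*ℕ z) (ℕ.*-comm x y)) (ℕ.*-assoc y x z))

stabiliser-↭ : ∀ {μ ν} → μ ↭ ν → stabiliser μ ≡ stabiliser ν
stabiliser-↭ refl                       = ≡.refl
stabiliser-↭ (prep k p)                 = ≡.cong₂ _*ℕ_ (≡.cong suc (mult-↭ k p)) (stabiliser-↭ p)
stabiliser-↭ (swap {ys = ν} k l p)      = ≡.trans
  (≡.cong₂ _*ℕ_ (≡.cong suc (mult-↭ k (prep l p))) (≡.cong₂ _*ℕ_ (≡.cong suc (mult-↭ l p)) (stabiliser-↭ p)))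
  (stabiliser-swap k l ν)
stabiliser-↭ (trans p q)                = ≡.trans (stabiliser-↭ p) (stabiliser-↭ q)

map-proj₁-picks : (xs : List A) → map proj₁ (picks xs) ≡ xs
map-proj₁-picks []       = ≡.refl
map-proj₁-picks (x ∷ xs) = ≡.cong (x ∷_) (≡.trans (≡.sym (map-∘ (picks xs))) (map-proj₁-picks xs))

picks-↭ : (xs : List A) → All (λ (z , zs) → z ∷ zs ↭ xs) (picks xs)
picks-↭ []       = []
picks-↭ (x ∷ xs) = ↭-refl ∷ All.map⁺ (All.map (λ p → ↭-trans (swap _ _ ↭-refl) (prep x p)) (picks-↭ xs))

≤-sum : ∀ μ → All (_≤ sum μ) μ
≤-sum []      = []
≤-sum (k ∷ μ) = ℕ.m≤m+n k (sum μ) ∷ All.map (λ l≤ → ℕ.≤-trans l≤ (ℕ.m≤n+m (sum μ) k)) (≤-sum μ)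

module AugmentedMonomials {c ℓ} (S : CommutativeRing c ℓ) where
  open FiniteSums S
  open SymmetricPolynomials S

  -- The number of bijections from the positions of `ξ` to those of `μ` that preserve entries,
  -- viewed in `S`.
  weight : List ℕ → List ℕ → Carrier
  weight ξ μ = fromℕᴿ (stabiliser ξ) ⊗ ind (ξ ↭? μ)

  -- Counts such bijections by the image of the first position: the leading `k` goes to one of the
  -- equal entries of `μ`, of which there are 1 + `mult k ξ` if any bijection exists, and `ξ` is
  -- matched with what remains.
  ∑-picks-weight : ∀ k ξ μ → ∑[ (l , ν) ∈ picks μ ] (ind (k ℕ.≟ l) ⊗ weight ξ ν) ≈ weight (k ∷ ξ) μ
  ∑-picks-weight k ξ μ with k ∷ ξ ↭? μ
  ... | yes kξ↭μ = begin
    ∑[ (l , ν) ∈ picks μ ] (ind (k ℕ.≟ l) ⊗ weight ξ ν)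
      ≈⟨ ∑-cong-∈ (picks μ) (λ (l , ν) lν∈ → ind-⊗-cong (k ℕ.≟ l) λ k≡l → *-congˡ (≈-reflexive (ind-true (ξ ↭? ν)
           (drop-∷ (↭-trans kξ↭μ (↭-trans (↭-sym (All.lookup (picks-↭ μ) lν∈)) (↭.↭-reflexive (≡.cong (_∷ ν) (≡.sym k≡l)))))))) ) ⟩
    ∑[ (l , ν) ∈ picks μ ] (ind (k ℕ.≟ l) ⊗ (fromℕᴿ (stabiliser ξ) ⊗ 1#))
      ≈⟨ ∑-⊗ʳ _ (picks μ) _ ⟨
    ∑[ (l , ν) ∈ picks μ ] ind (k ℕ.≟ l) ⊗ (fromℕᴿ (stabiliser ξ) ⊗ 1#)
      ≡⟨ ≡.cong (_⊗ _) (∑-map proj₁ (picks μ) (λ l → ind (k ℕ.≟ l))) ⟨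
    ∑[ l ∈ map proj₁ (picks μ) ] ind (k ℕ.≟ l) ⊗ (fromℕᴿ (stabiliser ξ) ⊗ 1#)
      ≡⟨ ≡.cong (λ xs → ∑[ l ∈ xs ] ind (k ℕ.≟ l) ⊗ (fromℕᴿ (stabiliser ξ) ⊗ 1#)) (map-proj₁-picks μ) ⟩
    ∑[ l ∈ μ ] ind (k ℕ.≟ l) ⊗ (fromℕᴿ (stabiliser ξ) ⊗ 1#)
      ≈⟨ *-congʳ (∑-↭ _ (↭-sym kξ↭μ)) ⟩
    (ind (k ℕ.≟ k) ⊕ ∑[ l ∈ ξ ] ind (k ℕ.≟ l)) ⊗ (fromℕᴿ (stabiliser ξ) ⊗ 1#)
      ≈⟨ *-congʳ (+-cong (≈-reflexive (ind-true (k ℕ.≟ k) ≡.refl)) (∑-ind (k ℕ.≟_) ξ)) ⟩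
    fromℕᴿ (suc (mult k ξ)) ⊗ (fromℕᴿ (stabiliser ξ) ⊗ 1#)
      ≈⟨ *-assoc _ _ _ ⟨
    fromℕᴿ (suc (mult k ξ)) ⊗ fromℕᴿ (stabiliser ξ) ⊗ 1#
      ≈⟨ *-congʳ (fromℕᴿ-* (suc (mult k ξ)) (stabiliser ξ)) ⟨
    fromℕᴿ (stabiliser (k ∷ ξ)) ⊗ 1#
      ∎
  ... | no kξ↭̸μ = begin
    ∑[ (l , ν) ∈ picks μ ] (ind (k ℕ.≟ l) ⊗ weight ξ ν)
      ≈⟨ ∑-cong-∈ (picks μ) (λ (l , ν) lν∈ → ≈-trans (ind-⊗-cong (k ℕ.≟ l) λ k≡l →
           ≈-trans (*-congˡ (≈-reflexive (ind-false (ξ ↭? ν) λ ξ↭ν → kξ↭̸μ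
             (↭-trans (↭-trans (↭.↭-reflexive (≡.cong (_∷ ξ) k≡l)) (prep l ξ↭ν)) (All.lookup (picks-↭ μ) lν∈))))) (zeroʳ _))
           (zeroʳ _)) ⟩
    ∑[ lν ∈ picks μ ] 0#
      ≈⟨ ∑-0 (picks μ) ⟩
    0#
      ≈⟨ zeroʳ _ ⟨
    fromℕᴿ (stabiliser (k ∷ ξ)) ⊗ 0#
      ∎

  ∑-upTo-ind-suc : ∀ {B k} → 1 ≤ k → k ≤ B → (f : ℕ → Carrier) →
                   ∑[ g ∈ upTo B ] (ind (suc g ℕ.≟ k) ⊗ f (suc g)) ≈ f k
  ∑-upTo-ind-suc {B} {suc k} _ k<B f = ≈-trans
    (∑-cong (upTo B) (λ g → *-congʳ (ind-cong (suc g ℕ.≟ suc k) (g ℕ.≟ k) ℕ.suc-injective (≡.cong suc))))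
    (∑-upTo-ind B k<B (f ∘ suc))

  -- The exponent of the first variable is 0 if no part uses that variable, and otherwise it is the
  -- part removed by `picks`; positivity of the parts keeps the two cases apart. The bound `B` is
  -- separate from `sum μ` because the box has to stay the same while parts are removed from `μ`.
  aug-expand : ∀ B μ (ys : Vec Carrier d) → All (1 ≤_) μ → All (_≤ B) μ →
    aug μ ys ≈ ∑[ γ ∈ below (replicate d B) ] (weight (nonzeros γ) μ ⊗ monomial rawRing γ ys)
  aug-expand B []      []       _ _ = ≈-sym (begin
    (1# ⊕ 0#) ⊗ 1# ⊗ 1# ⊕ 0#  ≈⟨ +-identityʳ _ ⟩
    (1# ⊕ 0#) ⊗ 1# ⊗ 1#       ≈⟨ ≈-trans (*-identityʳ _) (*-identityʳ _) ⟩
    1# ⊕ 0#                   ≈⟨ +-identityʳ _ ⟩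
    1#                        ∎)
  aug-expand B (k ∷ μ) []       _ _ = ≈-sym (≈-trans (+-identityʳ _) (≈-trans (*-congʳ (zeroʳ _)) (zeroˡ _)))
  aug-expand {suc d} B μ (y ∷ ys) μ≥1 μ≤B = ≈-sym (begin
    ∑[ γ ∈ below (B ∷ replicate d B) ] (weight (nonzeros γ) μ ⊗ mono γ (y ∷ ys))
      ≈⟨ ∑-below-∷ B (replicate d B) _ ⟩
    ∑[ g ∈ upTo (suc B) ] ∑[ γ ∈ Γ ] (weight (nonzeros (g ∷ γ)) μ ⊗ mono (g ∷ γ) (y ∷ ys))
      ≡⟨ ∑-upTo-suc B _ ⟩
    ∑[ γ ∈ Γ ] (weight (nonzeros γ) μ ⊗ (1# ⊗ mono γ ys))
      ⊕ ∑[ g ∈ upTo B ] ∑[ γ ∈ Γ ] (weight (suc g ∷ nonzeros γ) μ ⊗ (y ^ suc g ⊗ mono γ ys))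
      ≈⟨ +-cong (≈-trans (∑-cong Γ (λ γ → *-congˡ (*-identityˡ _))) (≈-sym (aug-expand B μ ys μ≥1 μ≤B))) positive ⟩
    aug μ ys ⊕ ∑[ (k , ν) ∈ picks μ ] (y ^ k ⊗ aug ν ys)
      ∎)
    where
    mono : ∀ {d} → Vec ℕ d → Vec Carrier d → Carrier
    mono = monomial rawRing
    Γ = below (replicate d B)
    w : List ℕ → Vec ℕ d → Carrier
    w ν γ = weight (nonzeros γ) ν ⊗ mono γ ys
    expand : ∀ kν → kν ∈ picks μ → let (k , ν) = kν in
      ∑[ g ∈ upTo B ] (ind (suc g ℕ.≟ k) ⊗ (y ^ suc g ⊗ ∑[ γ ∈ Γ ] w ν γ)) ≈ y ^ k ⊗ aug ν ys
    expand (k , ν) kν∈ with All.lookup (picks-↭ μ) kν∈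
    ... | kν↭μ with All-resp-↭ (↭-sym kν↭μ) μ≥1 | All-resp-↭ (↭-sym kν↭μ) μ≤B
    ...   | k≥1 ∷ ν≥1 | k≤B ∷ ν≤B = begin
      ∑[ g ∈ upTo B ] (ind (suc g ℕ.≟ k) ⊗ (y ^ suc g ⊗ ∑[ γ ∈ Γ ] w ν γ))
        ≈⟨ ∑-upTo-ind-suc k≥1 k≤B (λ g → y ^ g ⊗ ∑[ γ ∈ Γ ] w ν γ) ⟩
      y ^ k ⊗ ∑[ γ ∈ Γ ] w ν γ
        ≈⟨ *-congˡ (aug-expand B ν ys ν≥1 ν≤B) ⟨
      y ^ k ⊗ aug ν ys
        ∎
    positive : ∑[ g ∈ upTo B ] ∑[ γ ∈ Γ ] (weight (suc g ∷ nonzeros γ) μ ⊗ (y ^ suc g ⊗ mono γ ys))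
               ≈ ∑[ (k , ν) ∈ picks μ ] (y ^ k ⊗ aug ν ys)
    positive = begin
      ∑[ g ∈ upTo B ] ∑[ γ ∈ Γ ] (weight (suc g ∷ nonzeros γ) μ ⊗ (y ^ suc g ⊗ mono γ ys))
        ≈⟨ ∑-cong (upTo B) (λ g → ∑-cong Γ λ γ → ≈-trans
             (*-congʳ (≈-sym (∑-picks-weight (suc g) (nonzeros γ) μ))) (∑-⊗ʳ _ (picks μ) _)) ⟩
      ∑[ g ∈ upTo B ] ∑[ γ ∈ Γ ] ∑[ (k , ν) ∈ picks μ ] (ind (suc g ℕ.≟ k) ⊗ weight (nonzeros γ) ν ⊗ (y ^ suc g ⊗ mono γ ys))
        ≈⟨ ∑-cong (upTo B) (λ g → ∑-comm Γ (picks μ) _) ⟩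
      ∑[ g ∈ upTo B ] ∑[ (k , ν) ∈ picks μ ] ∑[ γ ∈ Γ ] (ind (suc g ℕ.≟ k) ⊗ weight (nonzeros γ) ν ⊗ (y ^ suc g ⊗ mono γ ys))
        ≈⟨ ∑-comm (upTo B) (picks μ) _ ⟩
      ∑[ (k , ν) ∈ picks μ ] ∑[ g ∈ upTo B ] ∑[ γ ∈ Γ ] (ind (suc g ℕ.≟ k) ⊗ weight (nonzeros γ) ν ⊗ (y ^ suc g ⊗ mono γ ys))
        ≈⟨ ∑-cong (picks μ) (λ (k , ν) → ∑-cong (upTo B) λ g → ≈-trans
             (∑-cong Γ λ γ → solve 4 (λ i w z m → i :* w :* (z :* m) := i :* z :* (w :* m)) ≈-refl _ _ _ _)
             (≈-trans (≈-sym (∑-⊗ˡ _ Γ (w ν))) (*-assoc _ _ _))) ⟩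
      ∑[ (k , ν) ∈ picks μ ] ∑[ g ∈ upTo B ] (ind (suc g ℕ.≟ k) ⊗ (y ^ suc g ⊗ ∑[ γ ∈ Γ ] w ν γ))
        ≈⟨ ∑-cong-∈ (picks μ) expand ⟩
      ∑[ (k , ν) ∈ picks μ ] (y ^ k ⊗ aug ν ys)
        ∎

  -- Where the indicator is nonzero, the exponents rearrange `μ`, so the factor `stabiliser` is the
  -- same in all surviving terms and can be taken out of the sum.
  aug-m : ∀ μ (ys : Vec Carrier d) → All (1 ≤_) μ → aug μ ys ≈ fromℕᴿ (stabiliser μ) ⊗ m rawRing μ ys
  aug-m {d} μ ys μ≥1 = begin
    aug μ ys
      ≈⟨ aug-expand (sum μ) μ ys μ≥1 (≤-sum μ) ⟩
    ∑[ γ ∈ Γ ] (fromℕᴿ (stabiliser (nonzeros γ)) ⊗ ind (nonzeros γ ↭? μ) ⊗ monomial rawRing γ ys)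
      ≈⟨ ∑-cong Γ (λ γ → ≈-trans (*-assoc _ _ _) (≈-trans (⊗-swap _ _ _)
           (≈-trans (ind-⊗-cong (nonzeros γ ↭? μ) λ p → *-congʳ (≈-reflexive (≡.cong fromℕᴿ (stabiliser-↭ p)))) (⊗-swap _ _ _)))) ⟩
    ∑[ γ ∈ Γ ] (fromℕᴿ (stabiliser μ) ⊗ (ind (nonzeros γ ↭? μ) ⊗ monomial rawRing γ ys))
      ≈⟨ ∑-⊗ˡ _ Γ _ ⟨
    fromℕᴿ (stabiliser μ) ⊗ ∑[ γ ∈ Γ ] (ind (nonzeros γ ↭? μ) ⊗ monomial rawRing γ ys)
      ≈⟨ *-congˡ (∑-filter (λ γ → nonzeros γ ↭? μ) Γ _) ⟨
    fromℕᴿ (stabiliser μ) ⊗ m rawRing μ ys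
      ∎
    where Γ = below (replicate d (sum μ))

-- Each multiset of positive integers with sum n is represented by exactly one listed partition.

compositions-sound : ∀ n → All (λ μ → All (1 ≤_) μ × sum μ ≡ n) (compositions n)
compositions-sound zero    = ([] , ≡.refl) ∷ []
compositions-sound (suc n) = All.concat⁺ (All.map⁺ (All.map (λ
  { {[]}    (_         , eq) → (s≤s z≤n ∷ [] , ≡.cong suc eq) ∷ []
  ; {p ∷ μ} (p≥1 ∷ μ≥1 , eq) →
      (s≤s z≤n ∷ p≥1 ∷ μ≥1 , ≡.cong suc eq) ∷ (s≤s z≤n ∷ μ≥1 , ≡.cong suc eq) ∷ [] })
  (compositions-sound n)))

∈-partitions : ∀ {μ n} → μ ∈ partitions n → μ ⊢ n
∈-partitions {n = n} μ∈ with ∈-filter⁻ (linked? ℕ._≥?_) {xs = compositions n} μ∈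
... | μ∈ , μ↘ with All.lookup (compositions-sound n) μ∈
...   | μ≥1 , |μ| = μ↘ , μ≥1 , |μ|

open Sort ≥-decTotalOrder using (sort; sort-↭; sort-↗)

sorted-unique : ∀ {xs μ} → xs ↭ μ → Linked _≥_ μ → μ ≡ sort xs
sorted-unique {xs} xs↭μ μ↘ = Pointwise-≡⇒≡
  (↗↭↗⇒≋ (DecTotalOrder.totalOrder ≥-decTotalOrder) μ↘ (sort-↗ xs)
    (↭⇒↭ₛ (↭-trans (↭-sym xs↭μ) (↭-sym (sort-↭ xs)))))

module PartitionSums {c ℓ} (S : CommutativeRing c ℓ) where
  open FiniteSums S

  _≟_ = List.≡-dec ℕ._≟_

  -- A composition of n + 1 grows from exactly one composition of n.
  parent : List ℕ → List ℕ
  parent (suc (suc p) ∷ ν) = suc p ∷ ν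
  parent (_ ∷ ν)           = ν
  parent []                = []

  -- This and `grow-∷` express that `ν` occurs once among the compositions grown from its parent and
  -- never among those grown from another one. The head of `ν` decides: a head 1 was prepended, and
  -- a larger head was incremented.
  grow-[] : ∀ {ν} → All (1 ≤_) ν → ν ≢ [] → ind ((1 ∷ []) ≟ ν) ⊕ 0# ≈ ind ([] ≟ parent ν)
  grow-[] {[]}              _       ν≢[] = contradiction ≡.refl ν≢[]
  grow-[] {zero ∷ _}        (() ∷ _)
  grow-[] {1 ∷ ν}           _       _    = ≈-trans (+-identityʳ _)
    (ind-cong ((1 ∷ []) ≟ (1 ∷ ν)) ([] ≟ ν) ∷-injectiveʳ (≡.cong (1 ∷_)))
  grow-[] {suc (suc p) ∷ ν} _       _    = +-identityʳ _

  grow-∷ : ∀ {p μ ν} → 1 ≤ p → All (1 ≤_) ν → ν ≢ [] →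
           ind ((1 ∷ p ∷ μ) ≟ ν) ⊕ (ind ((suc p ∷ μ) ≟ ν) ⊕ 0#) ≈ ind ((p ∷ μ) ≟ parent ν)
  grow-∷ {p}     {μ} {[]}              _   _    ν≢[] = contradiction ≡.refl ν≢[]
  grow-∷ {p}     {μ} {zero ∷ _}        _   (() ∷ _)
  grow-∷ {suc p} {μ} {1 ∷ ν}           _   _    _    = begin
    ind ((1 ∷ suc p ∷ μ) ≟ (1 ∷ ν)) ⊕ (0# ⊕ 0#)  ≈⟨ +-congˡ (+-identityʳ _) ⟩
    ind ((1 ∷ suc p ∷ μ) ≟ (1 ∷ ν)) ⊕ 0#         ≈⟨ +-identityʳ _ ⟩
    ind ((1 ∷ suc p ∷ μ) ≟ (1 ∷ ν))              ≈⟨ ind-cong ((1 ∷ suc p ∷ μ) ≟ (1 ∷ ν)) ((suc p ∷ μ) ≟ ν) ∷-injectiveʳ (≡.cong (1 ∷_)) ⟩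
    ind ((suc p ∷ μ) ≟ ν)                        ∎
  grow-∷ {p}     {μ} {suc (suc q) ∷ ν} _   _    _    = begin
    0# ⊕ (ind ((suc p ∷ μ) ≟ (suc (suc q) ∷ ν)) ⊕ 0#)  ≈⟨ ≈-trans (+-identityˡ _) (+-identityʳ _) ⟩
    ind ((suc p ∷ μ) ≟ (suc (suc q) ∷ ν))              ≈⟨ ind-cong ((suc p ∷ μ) ≟ (suc (suc q) ∷ ν)) ((p ∷ μ) ≟ (suc q ∷ ν))
                                                            (λ { ≡.refl → ≡.refl }) (λ { ≡.refl → ≡.refl }) ⟩
    ind ((p ∷ μ) ≟ (suc q ∷ ν))                        ∎

  parent-sound : ∀ {ν} → All (1 ≤_) ν → sum ν ≡ suc n → All (1 ≤_) (parent ν) × sum (parent ν) ≡ n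
  parent-sound {ν = 1 ∷ ν}           (_ ∷ ν≥1) eq = ν≥1 , ℕ.suc-injective eq
  parent-sound {ν = suc (suc p) ∷ ν} (_ ∷ ν≥1) eq = s≤s z≤n ∷ ν≥1 , ℕ.suc-injective eq

  ∑-compositions-ind : ∀ n {ν} → All (1 ≤_) ν → sum ν ≡ n → ∑[ μ ∈ compositions n ] ind (μ ≟ ν) ≈ 1#
  ∑-compositions-ind zero    {[]}        _        _  = +-identityʳ _
  ∑-compositions-ind zero    {suc _ ∷ _} _        ()
  ∑-compositions-ind zero    {zero ∷ _}  (() ∷ _) _
  ∑-compositions-ind (suc n) {ν}         ν≥1      eq = ≈-trans (∑-concatMap _ (compositions n) _) (≈-trans
    (∑-cong-∈ (compositions n) λ
      { []      _  → grow-[] ν≥1 ν≢[]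
      ; (p ∷ μ) μ∈ → grow-∷ (All.head (proj₁ (All.lookup (compositions-sound n) μ∈))) ν≥1 ν≢[] })
    (uncurry (∑-compositions-ind n) (parent-sound ν≥1 eq)))
    where
    ν≢[] : ν ≢ []
    ν≢[] ≡.refl = contradiction eq λ ()

  -- The only weakly decreasing rearrangement of `xs` is its sorted form, so the sum counts one
  -- composition. It follows that each monomial in the roots belongs to exactly one m_μ.
  ∑-partitions-ind : ∀ {n xs} → All (1 ≤_) xs → sum xs ≡ n → ∑[ μ ∈ partitions n ] ind (xs ↭? μ) ≈ 1#
  ∑-partitions-ind {n} {xs} xs≥1 |xs| = begin
    ∑[ μ ∈ partitions n ] ind (xs ↭? μ)
      ≈⟨ ∑-filter (linked? ℕ._≥?_) (compositions n) _ ⟩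
    ∑[ μ ∈ compositions n ] (ind (linked? ℕ._≥?_ μ) ⊗ ind (xs ↭? μ))
      ≈⟨ ∑-cong (compositions n) (λ μ → ≈-trans (≈-sym (ind-× (linked? ℕ._≥?_ μ) (xs ↭? μ)))
           (ind-cong (linked? ℕ._≥?_ μ ×-dec xs ↭? μ) (μ ≟ sort xs)
             (λ (μ↘ , xs↭μ) → sorted-unique xs↭μ μ↘) (λ { ≡.refl → sort-↗ xs , ↭-sym (sort-↭ xs) }))) ⟩
    ∑[ μ ∈ compositions n ] ind (μ ≟ sort xs)
      ≈⟨ ∑-compositions-ind n (All-resp-↭ (↭-sym (sort-↭ xs)) xs≥1) (≡.trans (sum-↭ (sort-↭ xs)) |xs|) ⟩
    1#
      ∎

-- Products of elementary symmetric functions as power series.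

sum-∸ᵥ : {α β : Vec ℕ N} → β ≤ᵥ α → sumᵛ β + sumᵛ (α ∸ᵥ β) ≡ sumᵛ α
sum-∸ᵥ []                                        = ≡.refl
sum-∸ᵥ {α = a ∷ α} {b ∷ β} (b≤a ∷ β≤α) = begin
  (b + sumᵛ β) + ((a ∸ b) + sumᵛ (α ∸ᵥ β))  ≡⟨ interchange b (sumᵛ β) (a ∸ b) _ ⟩
  (b + (a ∸ b)) + (sumᵛ β + sumᵛ (α ∸ᵥ β))  ≡⟨ ≡.cong₂ _+_ (ℕ.m+[n∸m]≡n b≤a) (sum-∸ᵥ β≤α) ⟩
  a + sumᵛ α                                ∎
  where open ≡.≡-Reasoning

∸ᵥ-comm : (α β γ : Vec ℕ N) → α ∸ᵥ β ∸ᵥ γ ≡ α ∸ᵥ γ ∸ᵥ β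
∸ᵥ-comm []      []      []      = ≡.refl
∸ᵥ-comm (a ∷ α) (b ∷ β) (c ∷ γ) = ≡.cong₂ _∷_
  (≡.trans (ℕ.∸-+-assoc a b c) (≡.trans (≡.cong (a ∸_) (ℕ.+-comm b c)) (≡.sym (ℕ.∸-+-assoc a c b)))) (∸ᵥ-comm α β γ)

∸ᵥ-identityʳ : (α : Vec ℕ N) → α ∸ᵥ replicate N 0 ≡ α
∸ᵥ-identityʳ []      = ≡.refl
∸ᵥ-identityʳ (a ∷ α) = ≡.cong (a ∷_) (∸ᵥ-identityʳ α)

zeros≤ : (α : Vec ℕ N) → replicate N 0 ≤ᵥ α
zeros≤ []      = []
zeros≤ (a ∷ α) = z≤n ∷ zeros≤ α

all-≡0⇒sum≡0 : {α : Vec ℕ N} → AllV.All (_≡ 0) α → sumᵛ α ≡ 0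
all-≡0⇒sum≡0 []            = ≡.refl
all-≡0⇒sum≡0 (≡.refl ∷ α≡0) = all-≡0⇒sum≡0 α≡0

sum≡0⇒zeros : (α : Vec ℕ N) → sumᵛ α ≡ 0 → α ≡ replicate N 0
sum≡0⇒zeros []         _  = ≡.refl
sum≡0⇒zeros (zero ∷ α) eq = ≡.cong (0 ∷_) (sum≡0⇒zeros α eq)

all-zeros : ∀ N {P : ℕ → Set} → P 0 → AllV.All P (replicate N 0)
all-zeros zero    p0 = []
all-zeros (suc N) p0 = p0 ∷ all-zeros N p0

sum-zeros : ∀ N → sumᵛ (replicate N 0) ≡ 0
sum-zeros zero    = ≡.refl
sum-zeros (suc N) = sum-zeros N

module _ where
  open FiniteSums ℚ.+-*-commutativeRing

  *ₛ-congʳ : (f : Series) {g h : Series} → (∀ {N} (α : Vec ℕ N) → g α ≡ h α) →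
             (α : Vec ℕ N) → (f *ₛ g) α ≡ (f *ₛ h) α
  *ₛ-congʳ f g≡h α = ∑-cong (below α) λ β → ≡.cong (f β ⊗_) (g≡h (α ∸ᵥ β))

  *ₛ-swap : (f g h : Series) (α : Vec ℕ N) → (f *ₛ (g *ₛ h)) α ≡ (g *ₛ (f *ₛ h)) α
  *ₛ-swap f g h α = begin
    ∑[ β ∈ below α ] (f β ⊗ ∑[ γ ∈ below (α ∸ᵥ β) ] (g γ ⊗ h (α ∸ᵥ β ∸ᵥ γ)))
      ≈⟨ ∑-cong (below α) (λ β → ∑-⊗ˡ (f β) (below (α ∸ᵥ β)) _) ⟩
    ∑[ β ∈ below α ] ∑[ γ ∈ below (α ∸ᵥ β) ] (f β ⊗ (g γ ⊗ h (α ∸ᵥ β ∸ᵥ γ)))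
      ≈⟨ ∑-below-comm α _ ⟩
    ∑[ γ ∈ below α ] ∑[ β ∈ below (α ∸ᵥ γ) ] (f β ⊗ (g γ ⊗ h (α ∸ᵥ β ∸ᵥ γ)))
      ≈⟨ ∑-cong (below α) (λ γ → ∑-cong (below (α ∸ᵥ γ)) λ β →
           ≡.trans (⊗-swap (f β) (g γ) _) (≡.cong (λ δ → g γ ⊗ (f β ⊗ h δ)) (∸ᵥ-comm α β γ))) ⟩
    ∑[ γ ∈ below α ] ∑[ β ∈ below (α ∸ᵥ γ) ] (g γ ⊗ (f β ⊗ h (α ∸ᵥ γ ∸ᵥ β)))
      ≈⟨ ∑-cong (below α) (λ γ → ∑-⊗ˡ (g γ) (below (α ∸ᵥ γ)) _) ⟨
    ∑[ γ ∈ below α ] (g γ ⊗ ∑[ β ∈ below (α ∸ᵥ γ) ] (f β ⊗ h (α ∸ᵥ γ ∸ᵥ β)))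
      ∎

  -- Expanding in the roots yields products of elementary functions indexed by arbitrary exponent
  -- vectors; this lemma and `e-nonzeros` identify them with those indexed by partitions.
  e-↭ : ∀ {μ ν} → μ ↭ ν → (α : Vec ℕ N) → e μ α ≡ e ν α
  e-↭ refl                  α = ≡.refl
  e-↭ (prep k p)            α = *ₛ-congʳ (eₖ k) (e-↭ p) α
  e-↭ (swap {xs = μ} k l p) α = ≡.trans (*ₛ-swap (eₖ k) (eₖ l) (e μ) α)
    (*ₛ-congʳ (eₖ l) (*ₛ-congʳ (eₖ k) (e-↭ p)) α)
  e-↭ (trans p q)           α = ≡.trans (e-↭ p α) (e-↭ q α)

  e-0∷ : ∀ μ (α : Vec ℕ N) → e (0 ∷ μ) α ≡ e μ α
  e-0∷ {N} μ α = begin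
    ∑[ β ∈ below α ] (eₖ 0 β ⊗ e μ (α ∸ᵥ β))
      ≈⟨ ∑-cong (below α) (λ β → ≡.cong (_⊗ e μ (α ∸ᵥ β))
           (ind-cong (AllV.all? (ℕ._≤? 1) β ×-dec (sumᵛ β ℕ.≟ 0)) (Vec.≡-dec ℕ._≟_ β (replicate N 0))
             (λ (_ , eq) → sum≡0⇒zeros β eq) (λ { ≡.refl → all-zeros N z≤n , sum-zeros N }))) ⟩
    ∑[ β ∈ below α ] (ind (Vec.≡-dec ℕ._≟_ β (replicate N 0)) ⊗ e μ (α ∸ᵥ β))
      ≈⟨ ∑-below-ind (zeros≤ α) (λ β → e μ (α ∸ᵥ β)) ⟩
    e μ (α ∸ᵥ replicate N 0)
      ≡⟨ ≡.cong (e μ) (∸ᵥ-identityʳ α) ⟩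
    e μ α
      ∎

  e-nonzeros : (γ : Vec ℕ d) (α : Vec ℕ N) → e (toList γ) α ≡ e (nonzeros γ) α
  e-nonzeros []          α = ≡.refl
  e-nonzeros (zero ∷ γ)  α = ≡.trans (e-0∷ (toList γ) α) (e-nonzeros γ α)
  e-nonzeros (suc g ∷ γ) α = *ₛ-congʳ (eₖ (suc g)) (e-nonzeros γ) α

  e-degree : ∀ μ (α : Vec ℕ N) → sum μ ≢ sumᵛ α → e μ α ≡ 0ℚ
  e-degree []      α |μ|≢|α| = ind-false (AllV.all? (ℕ._≟ 0) α) (|μ|≢|α| ∘ ≡.sym ∘ all-≡0⇒sum≡0)
  e-degree (k ∷ μ) α |μ|≢|α| = ≡.trans (∑-cong-∈ (below α) λ β β∈ → ≡.trans
    (ind-⊗-cong (AllV.all? (ℕ._≤? 1) β ×-dec (sumᵛ β ℕ.≟ k)) λ (_ , |β|≡k) →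
      e-degree μ (α ∸ᵥ β) λ |μ|≡ → |μ|≢|α|
        (≡.trans (≡.cong₂ _+_ (≡.sym |β|≡k) |μ|≡) (sum-∸ᵥ {α = α} (∈-below β∈))))
    (zeroʳ (eₖ k β))) (∑-0 (below α))

≤ᵥ⇒sum≤ : {α β : Vec ℕ N} → β ≤ᵥ α → sumᵛ (α ∸ᵥ β) ≤ sumᵛ α × sumᵛ β ≤ sumᵛ α
≤ᵥ⇒sum≤ {α = α} {β} β≤α =
  ≡.subst (sumᵛ (α ∸ᵥ β) ≤_) (sum-∸ᵥ β≤α) (ℕ.m≤n+m _ (sumᵛ β)) ,
  ≡.subst (sumᵛ β ≤_) (sum-∸ᵥ β≤α) (ℕ.m≤m+n (sumᵛ β) _)

-- The dual Cauchy identity, one coefficient at a time.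

module Cauchy {c ℓ} (S : CommutativeRing c ℓ) (q : ℚ → CommutativeRing.Carrier S)
  (q-hom : RingMorphisms.IsRingHomomorphism ℚ.+-*-rawRing (CommutativeRing.rawRing S) q) where
  open FiniteSums S
  open SymmetricPolynomials S using (esym)
  open PartitionSums S using (∑-partitions-ind)
  open RingMorphisms.IsRingHomomorphism q-hom
  module ∑ℚ = FiniteSums ℚ.+-*-commutativeRing

  q-∑ : (xs : List A) (f : A → ℚ) → q (∑ℚ.∑ xs f) ≈ ∑[ x ∈ xs ] q (f x)
  q-∑ []       f = 0#-homo
  q-∑ (x ∷ xs) f = ≈-trans (+-homo _ _) (+-congˡ (q-∑ xs f))

  q-ind : {P : Set p} (P? : Dec P) → q (indicator P?) ≈ ind P?
  q-ind P? with does P?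
  ... | true  = 1#-homo
  ... | false = 0#-homo

  -- The coefficient of x^α in the product of all 1 + xᵢ yₐ.
  esyms : Vec ℕ N → Vec Carrier d → Carrier
  esyms α ys = ∏[ a ∈ toList α ] esym a ys

  esym-∷ : ∀ a y (ys : Vec Carrier d) →
    esym a (y ∷ ys) ≈ ∑[ b ∈ upTo (suc a) ] (ind (b ℕ.≤? 1) ⊗ (y ^ b ⊗ esym (a ∸ b) ys))
  esym-∷ zero    y ys = ≈-sym (begin
    1# ⊗ (1# ⊗ 1#) ⊕ 0#  ≈⟨ +-identityʳ _ ⟩
    1# ⊗ (1# ⊗ 1#)       ≈⟨ ≈-trans (*-identityˡ _) (*-identityˡ _) ⟩
    1#                   ∎)
  esym-∷ (suc a) y ys = ≈-sym (begin
    ∑[ b ∈ upTo (suc (suc a)) ] t b                                  ≡⟨ ∑-upTo-suc (suc a) t ⟩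
    t 0 ⊕ ∑[ b ∈ upTo (suc a) ] t (suc b)                            ≡⟨ ≡.cong (t 0 ⊕_) (∑-upTo-suc a (t ∘ suc)) ⟩
    t 0 ⊕ (t 1 ⊕ ∑[ b ∈ upTo a ] t (suc (suc b)))
      ≈⟨ +-congˡ (≈-trans (+-congˡ (∑-zero (upTo a) (λ b → zeroˡ _))) (+-identityʳ _)) ⟩
    t 0 ⊕ t 1                                                        ≈⟨ +-cong (≈-trans (*-identityˡ _) (*-identityˡ _))
                                                                          (≈-trans (*-identityˡ _) (*-congʳ (*-identityʳ y))) ⟩
    esym (suc a) ys ⊕ y ⊗ esym a ys                                  ∎)
    where
    t : ℕ → Carrier
    t b = ind (b ℕ.≤? 1) ⊗ (y ^ b ⊗ esym (suc a ∸ b) ys)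

  -- The 0-1 vector `β` records for which `i` the term xᵢ y is taken from the factor 1 + xᵢ y
  -- belonging to the new root `y`.
  esyms-∷ : (α : Vec ℕ N) (y : Carrier) (ys : Vec Carrier d) →
    esyms α (y ∷ ys) ≈ ∑[ β ∈ below α ] (ind (AllV.all? (ℕ._≤? 1) β) ⊗ (y ^ sumᵛ β ⊗ esyms (α ∸ᵥ β) ys))
  esyms-∷ []      y ys = ≈-sym (≈-trans (+-identityʳ _) (≈-trans (*-identityˡ _) (*-identityˡ _)))
  esyms-∷ (a ∷ α) y ys = begin
    esym a (y ∷ ys) ⊗ esyms α (y ∷ ys)
      ≈⟨ *-cong (esym-∷ a y ys) (esyms-∷ α y ys) ⟩
    ∑[ b ∈ upTo (suc a) ] (i b ⊗ (y ^ b ⊗ esym (a ∸ b) ys)) ⊗ ∑[ β ∈ below α ] (i* β ⊗ (y ^ sumᵛ β ⊗ esyms (α ∸ᵥ β) ys))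
      ≈⟨ ∑-⊗ʳ _ (upTo (suc a)) _ ⟩
    ∑[ b ∈ upTo (suc a) ] (i b ⊗ (y ^ b ⊗ esym (a ∸ b) ys) ⊗ ∑[ β ∈ below α ] (i* β ⊗ (y ^ sumᵛ β ⊗ esyms (α ∸ᵥ β) ys)))
      ≈⟨ ∑-cong (upTo (suc a)) (λ b → ≈-trans (∑-⊗ˡ _ (below α) _) (∑-cong (below α) (step b))) ⟩
    ∑[ b ∈ upTo (suc a) ] ∑[ β ∈ below α ] (i* (b ∷ β) ⊗ (y ^ sumᵛ (b ∷ β) ⊗ esyms ((a ∷ α) ∸ᵥ (b ∷ β)) ys))
      ≈⟨ ∑-below-∷ a α _ ⟨
    ∑[ β ∈ below (a ∷ α) ] (i* β ⊗ (y ^ sumᵛ β ⊗ esyms ((a ∷ α) ∸ᵥ β) ys))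
      ∎
    where
    i : ℕ → Carrier
    i b = ind (b ℕ.≤? 1)
    i* : Vec ℕ n → Carrier
    i* β = ind (AllV.all? (ℕ._≤? 1) β)
    i*-∷ : ∀ b (β : Vec ℕ n) → i* (b ∷ β) ≈ i b ⊗ i* β
    i*-∷ b β = ≈-trans
      (ind-cong (AllV.all? (ℕ._≤? 1) (b ∷ β)) (b ℕ.≤? 1 ×-dec AllV.all? (ℕ._≤? 1) β) AllV.uncons (uncurry _∷_))
      (ind-× (b ℕ.≤? 1) (AllV.all? (ℕ._≤? 1) β))
    step : ∀ b β → i b ⊗ (y ^ b ⊗ esym (a ∸ b) ys) ⊗ (i* β ⊗ (y ^ sumᵛ β ⊗ esyms (α ∸ᵥ β) ys)) ≈
           i* (b ∷ β) ⊗ (y ^ (b + sumᵛ β) ⊗ (esym (a ∸ b) ys ⊗ esyms (α ∸ᵥ β) ys))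
    step b β = ≈-trans
      (solve 6 (λ i z e i* z* e* → i :* (z :* e) :* (i* :* (z* :* e*)) := (i :* i*) :* ((z :* z*) :* (e :* e*))) ≈-refl _ _ _ _ _ _)
      (*-cong (≈-sym (i*-∷ b β)) (*-congʳ (≈-sym (^-⊕ y b (sumᵛ β)))))

  q-eₖ : ∀ k (β : Vec ℕ N) → q (eₖ k β) ≈ ind (AllV.all? (ℕ._≤? 1) β) ⊗ ind (k ℕ.≟ sumᵛ β)
  q-eₖ k β = ≈-trans (q-ind (AllV.all? (ℕ._≤? 1) β ×-dec (sumᵛ β ℕ.≟ k)))
    (≈-trans (ind-× (AllV.all? (ℕ._≤? 1) β) (sumᵛ β ℕ.≟ k))
      (*-congˡ (ind-cong (sumᵛ β ℕ.≟ k) (k ℕ.≟ sumᵛ β) ≡.sym ≡.sym)))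

  -- For each root, the product over i of 1 + xᵢ y is the sum over g of y^g e_g(x); multiplying over
  -- the roots gives a sum over all exponent vectors, not yet grouped by partition. Peeling off one
  -- root, the exponent `g` must equal the degree of the vector `β` taken from α. It lies in the box
  -- because `B` bounds the degree of α, and the same `B` still serves as α shrinks to α ∸ᵥ β.
  ∑-monomial-e : ∀ B (α : Vec ℕ N) (ys : Vec Carrier d) → sumᵛ α ≤ B →
    ∑[ γ ∈ below (replicate d B) ] (monomial rawRing γ ys ⊗ q (e (toList γ) α)) ≈ esyms α ys
  ∑-monomial-e B α []       _ = ≈-trans (+-identityʳ _) (≈-trans (*-identityˡ _) (≈-trans (q-ind (AllV.all? (ℕ._≟ 0) α)) (base α)))
    where
    base : (α : Vec ℕ n) → ind (AllV.all? (ℕ._≟ 0) α) ≈ esyms α []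
    base []          = ≈-refl
    base (zero ∷ α)  = begin
      ind (AllV.all? (ℕ._≟ 0) (0 ∷ α))  ≈⟨ ind-cong (AllV.all? (ℕ._≟ 0) (0 ∷ α)) (AllV.all? (ℕ._≟ 0) α) AllV.tail (≡.refl ∷_) ⟩
      ind (AllV.all? (ℕ._≟ 0) α)        ≈⟨ base α ⟩
      esyms α []                        ≈⟨ *-identityˡ _ ⟨
      1# ⊗ esyms α []                   ∎
    base (suc a ∷ α) = ≈-sym (zeroˡ _)
  ∑-monomial-e {N} {suc d} B α (y ∷ ys) |α|≤B = begin
    ∑[ γ ∈ below (B ∷ replicate d B) ] (monomial rawRing γ (y ∷ ys) ⊗ q (e (toList γ) α))
      ≈⟨ ∑-below-∷ B (replicate d B) _ ⟩
    ∑[ g ∈ G ] ∑[ γ ∈ Γ ] (y ^ g ⊗ mono γ ⊗ q (e (g ∷ toList γ) α))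
      ≈⟨ ∑-cong G (λ g → ∑-cong Γ λ γ → ≈-trans (*-congˡ (≈-trans (q-∑ (below α) _) (∑-cong (below α) λ β → *-homo _ _)))
           (∑-⊗ˡ _ (below α) _)) ⟩
    ∑[ g ∈ G ] ∑[ γ ∈ Γ ] ∑[ β ∈ below α ] (y ^ g ⊗ mono γ ⊗ (q (eₖ g β) ⊗ q (e (toList γ) (α ∸ᵥ β))))
      ≈⟨ ∑-cong G (λ g → ∑-comm Γ (below α) _) ⟩
    ∑[ g ∈ G ] ∑[ β ∈ below α ] ∑[ γ ∈ Γ ] (y ^ g ⊗ mono γ ⊗ (q (eₖ g β) ⊗ q (e (toList γ) (α ∸ᵥ β))))
      ≈⟨ ∑-comm G (below α) _ ⟩
    ∑[ β ∈ below α ] ∑[ g ∈ G ] ∑[ γ ∈ Γ ] (y ^ g ⊗ mono γ ⊗ (q (eₖ g β) ⊗ q (e (toList γ) (α ∸ᵥ β))))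
      ≈⟨ ∑-cong (below α) (λ β → ∑-cong G λ g → ≈-trans
           (∑-cong Γ λ γ → ≈-trans (*-congˡ (*-congʳ (q-eₖ g β)))
             (solve 5 (λ z m i j e → z :* m :* ((i :* j) :* e) := i :* (j :* z) :* (m :* e)) ≈-refl _ _ _ _ _))
           (≈-sym (∑-⊗ˡ _ Γ _))) ⟩
    ∑[ β ∈ below α ] ∑[ g ∈ G ] (i* β ⊗ (ind (g ℕ.≟ sumᵛ β) ⊗ y ^ g) ⊗ F β)
      ≈⟨ ∑-cong-∈ (below α) (λ β β∈ → step β (∈-below β∈)) ⟩
    ∑[ β ∈ below α ] (i* β ⊗ (y ^ sumᵛ β ⊗ esyms (α ∸ᵥ β) ys))
      ≈⟨ esyms-∷ α y ys ⟨
    esyms α (y ∷ ys)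
      ∎
    where
    G = upTo (suc B)
    Γ = below (replicate d B)
    mono : Vec ℕ d → Carrier
    mono γ = monomial rawRing γ ys
    i* : Vec ℕ N → Carrier
    i* β = ind (AllV.all? (ℕ._≤? 1) β)
    F : Vec ℕ N → Carrier
    F β = ∑[ γ ∈ Γ ] (mono γ ⊗ q (e (toList γ) (α ∸ᵥ β)))
    step : ∀ β → β ≤ᵥ α → ∑[ g ∈ G ] (i* β ⊗ (ind (g ℕ.≟ sumᵛ β) ⊗ y ^ g) ⊗ F β) ≈
           i* β ⊗ (y ^ sumᵛ β ⊗ esyms (α ∸ᵥ β) ys)
    step β β≤α with ≤ᵥ⇒sum≤ β≤α
    ... | |α∸β|≤ , |β|≤ = begin
      ∑[ g ∈ G ] (i* β ⊗ (ind (g ℕ.≟ sumᵛ β) ⊗ y ^ g) ⊗ F β)    ≈⟨ ∑-⊗ʳ (F β) G _ ⟨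
      ∑[ g ∈ G ] (i* β ⊗ (ind (g ℕ.≟ sumᵛ β) ⊗ y ^ g)) ⊗ F β
        ≈⟨ *-cong (≈-sym (∑-⊗ˡ (i* β) G _)) (∑-monomial-e B (α ∸ᵥ β) ys (ℕ.≤-trans |α∸β|≤ |α|≤B)) ⟩
      i* β ⊗ ∑[ g ∈ G ] (ind (g ℕ.≟ sumᵛ β) ⊗ y ^ g) ⊗ esyms (α ∸ᵥ β) ys
        ≈⟨ *-congʳ (*-congˡ (∑-upTo-ind (suc B) (s≤s (ℕ.≤-trans |β|≤ |α|≤B)) (y ^_))) ⟩
      i* β ⊗ y ^ sumᵛ β ⊗ esyms (α ∸ᵥ β) ys                     ≈⟨ *-assoc _ _ _ ⟩
      i* β ⊗ (y ^ sumᵛ β ⊗ esyms (α ∸ᵥ β) ys)                   ∎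

  -- The coefficient of x^α in the dual Cauchy identity ∏ᵢ ∏ₐ (1 + xᵢ yₐ) = ∑_μ m_μ(y) e_μ(x).
  dual-cauchy : (α : Vec ℕ N) (ys : Vec Carrier d) →
    ∑[ μ ∈ partitions (sumᵛ α) ] (q (e μ α) ⊗ m rawRing μ ys) ≈ esyms α ys
  dual-cauchy {N} {d} α ys = begin
    ∑[ μ ∈ Π ] (q (e μ α) ⊗ m rawRing μ ys)
      ≈⟨ ∑-cong-∈ Π (λ μ μ∈ → expand μ (proj₂ (proj₂ (∈-partitions μ∈)))) ⟩
    ∑[ μ ∈ Π ] ∑[ γ ∈ Γ ] (mono γ ⊗ (ind (nonzeros γ ↭? μ) ⊗ q (e (toList γ) α)))
      ≈⟨ ∑-comm Π Γ _ ⟩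
    ∑[ γ ∈ Γ ] ∑[ μ ∈ Π ] (mono γ ⊗ (ind (nonzeros γ ↭? μ) ⊗ q (e (toList γ) α)))
      ≈⟨ ∑-cong Γ collapse ⟩
    ∑[ γ ∈ Γ ] (mono γ ⊗ q (e (toList γ) α))
      ≈⟨ ∑-monomial-e (sumᵛ α) α ys ℕ.≤-refl ⟩
    esyms α ys
      ∎
    where
    Π = partitions (sumᵛ α)
    Γ = below (replicate d (sumᵛ α))
    mono : Vec ℕ d → Carrier
    mono γ = monomial rawRing γ ys
    expand : ∀ μ → sum μ ≡ sumᵛ α → q (e μ α) ⊗ m rawRing μ ys ≈
             ∑[ γ ∈ Γ ] (mono γ ⊗ (ind (nonzeros γ ↭? μ) ⊗ q (e (toList γ) α)))
    expand μ |μ| = begin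
      q (e μ α) ⊗ m rawRing μ ys
        ≡⟨ ≡.cong (λ s → q (e μ α) ⊗ ∑ (filter (λ γ → nonzeros γ ↭? μ) (below (replicate d s))) mono) |μ| ⟩
      q (e μ α) ⊗ ∑ (filter (λ γ → nonzeros γ ↭? μ) Γ) mono
        ≈⟨ *-congˡ (∑-filter (λ γ → nonzeros γ ↭? μ) Γ mono) ⟩
      q (e μ α) ⊗ ∑[ γ ∈ Γ ] (ind (nonzeros γ ↭? μ) ⊗ mono γ)
        ≈⟨ ∑-⊗ˡ _ Γ _ ⟩
      ∑[ γ ∈ Γ ] (q (e μ α) ⊗ (ind (nonzeros γ ↭? μ) ⊗ mono γ))
        ≈⟨ ∑-cong Γ (λ γ → ≈-trans
             (solve 3 (λ e i m → e :* (i :* m) := m :* (i :* e)) ≈-refl _ _ _)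
             (*-congˡ (ind-⊗-cong (nonzeros γ ↭? μ) λ p →
               ⟦⟧-cong (≡.trans (e-↭ (↭-sym p) α) (≡.sym (e-nonzeros γ α)))))) ⟩
      ∑[ γ ∈ Γ ] (mono γ ⊗ (ind (nonzeros γ ↭? μ) ⊗ q (e (toList γ) α)))
        ∎
    collapse : ∀ γ → ∑[ μ ∈ Π ] (mono γ ⊗ (ind (nonzeros γ ↭? μ) ⊗ q (e (toList γ) α))) ≈ mono γ ⊗ q (e (toList γ) α)
    collapse γ = ≈-trans (≈-sym (∑-⊗ˡ (mono γ) Π _)) (*-congˡ (≈-trans (≈-sym (∑-⊗ʳ _ Π _)) unique))
      where
      unique : ∑[ μ ∈ Π ] ind (nonzeros γ ↭? μ) ⊗ q (e (toList γ) α) ≈ q (e (toList γ) α)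
      unique with sum (nonzeros γ) ℕ.≟ sumᵛ α
      ... | yes |γ|≡ = ≈-trans (*-congʳ (∑-partitions-ind (All.all-filter (1 ℕ.≤?_) (toList γ)) |γ|≡)) (*-identityˡ _)
      -- The box also contains exponent vectors of other degrees. For these the product of
      -- elementary functions has no x^α term, so both sides vanish.
      ... | no  |γ|≢ = ≈-trans (*-congˡ vanishes) (≈-trans (zeroʳ _) (≈-sym vanishes))
        where
        vanishes : q (e (toList γ) α) ≈ 0#
        vanishes = ≈-trans (⟦⟧-cong (≡.trans (e-nonzeros γ α) (e-degree (nonzeros γ) α |γ|≢))) 0#-homo

-- Among unnormalised rationals no gcd intervenes, and the claim reduces to one about integers.
fromℕ-suc : ∀ n → fromℕ (suc n) ≡ 1ℚ ℚ.+ fromℕ n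
fromℕ-suc n = ℚ.toℚᵘ-injective (begin
  ℚ.toℚᵘ (fromℕ (suc n))            ≈⟨ ℚ.toℚᵘ-fromℚᵘ (mkℚᵘ (ℤ.+ suc n) 0) ⟩
  mkℚᵘ (ℤ.+ suc n) 0                  ≈⟨ *≡* (≡.cong (ℤ._* ℤ.1ℤ) (≡.cong (λ i → ℤ.1ℤ ℤ.+ i) (≡.sym (ℤ.*-identityʳ (ℤ.+ n))))) ⟩
  ℚᵘ.1ℚᵘ ℚᵘ.+ mkℚᵘ (ℤ.+ n) 0          ≈⟨ ℚᵘ.+-congʳ ℚᵘ.1ℚᵘ (ℚ.toℚᵘ-fromℚᵘ (mkℚᵘ (ℤ.+ n) 0)) ⟨
  ℚᵘ.1ℚᵘ ℚᵘ.+ ℚ.toℚᵘ (fromℕ n)      ≈⟨ ℚ.toℚᵘ-homo-+ 1ℚ (fromℕ n) ⟨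
  ℚ.toℚᵘ (1ℚ ℚ.+ fromℕ n)           ∎)
  where open ℚᵘ.≃-Reasoning

1/n*n≡1 : ∀ n .{{_ : NonZero n}} → ℤ.1ℤ /ℚ n ℚ.* fromℕ n ≡ 1ℚ
1/n*n≡1 (suc n) = ℚ.toℚᵘ-injective (begin
  ℚ.toℚᵘ (ℤ.1ℤ /ℚ suc n ℚ.* fromℕ (suc n))                ≈⟨ ℚ.toℚᵘ-homo-* (ℤ.1ℤ /ℚ suc n) (fromℕ (suc n)) ⟩
  ℚ.toℚᵘ (ℤ.1ℤ /ℚ suc n) ℚᵘ.* ℚ.toℚᵘ (fromℕ (suc n))
    ≈⟨ ℚᵘ.*-cong (ℚ.toℚᵘ-fromℚᵘ (mkℚᵘ (ℤ.+ 1) n)) (ℚ.toℚᵘ-fromℚᵘ (mkℚᵘ (ℤ.+ suc n) 0)) ⟩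
  mkℚᵘ (ℤ.+ 1) n ℚᵘ.* mkℚᵘ (ℤ.+ suc n) 0                       ≈⟨ *≡* (ℤ.*-assoc ℤ.1ℤ (ℤ.+ suc n) ℤ.1ℤ) ⟩
  ℚᵘ.1ℚᵘ                                                   ∎)
  where open ℚᵘ.≃-Reasoning

-- Coefficients of sums and products in a monoid algebra.

module Coefficients {c ℓ} (S : CommutativeRing c ℓ) {M : Set} (_≟_ : DecidableEquality M) (_∙_ : Op₂ M) (ε : M) where
  open FiniteSums S
  open MonoidAlgebra (CommutativeRing.rawRing S) _≟_ _∙_ ε using (Polynomial; coeff; const)
  private module P = RawRing (MonoidAlgebra.rawRing (CommutativeRing.rawRing S) _≟_ _∙_ ε)

  coeff-∑-terms : ∀ k p → coeff k p ≈ ∑[ (b , m) ∈ p ] (ind (m ≟ k) ⊗ b)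
  coeff-∑-terms k []            = ≈-refl
  coeff-∑-terms k ((b , m) ∷ p) with does (m ≟ k)
  ... | true  = +-cong (≈-sym (*-identityˡ _)) (coeff-∑-terms k p)
  ... | false = ≈-trans (coeff-∑-terms k p) (≈-trans (≈-sym (+-identityˡ _)) (+-congʳ (≈-sym (zeroˡ _))))

  coeff-++ : ∀ k p q → coeff k (p ++ q) ≈ coeff k p ⊕ coeff k q
  coeff-++ k p q = begin
    coeff k (p ++ q)                                                       ≈⟨ coeff-∑-terms k (p ++ q) ⟩
    ∑[ (b , m) ∈ p ++ q ] (ind (m ≟ k) ⊗ b)                                ≈⟨ ∑-++ p q _ ⟩
    ∑[ (b , m) ∈ p ] (ind (m ≟ k) ⊗ b) ⊕ ∑[ (b , m) ∈ q ] (ind (m ≟ k) ⊗ b)  ≈⟨ +-cong (coeff-∑-terms k p) (coeff-∑-terms k q) ⟨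
    coeff k p ⊕ coeff k q                                                  ∎

  coeff-∑ : ∀ k (xs : List A) (f : A → Polynomial) →
    coeff k (Sums.∑ (MonoidAlgebra.rawRing (CommutativeRing.rawRing S) _≟_ _∙_ ε) xs f) ≈ ∑[ x ∈ xs ] coeff k (f x)
  coeff-∑ k []       f = ≈-refl
  coeff-∑ k (x ∷ xs) f = ≈-trans (coeff-++ k (f x) _) (+-congˡ (coeff-∑ k xs f))

  shift : Carrier × M → Polynomial → Polynomial
  shift (b , m) = map (λ (b′ , m′) → b ⊗ b′ , m ∙ m′)

  -- The equation m ∙ m′ = k may have no solution in a monoid. `P` is the condition of solvability
  -- and `k′` the solution; if `P` fails, any value may stand for `k′`, since the indicator is then
  -- zero.
  coeff-shift-ind : ∀ {P : Set p} (P? : Dec P) k k′ b m q → (∀ m′ → m ∙ m′ ≡ k → P × m′ ≡ k′) → (P → m ∙ k′ ≡ k) →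
                    coeff k (shift (b , m) q) ≈ ind P? ⊗ (b ⊗ coeff k′ q)
  coeff-shift-ind P? k k′ b m q to from = begin
    coeff k (shift (b , m) q)                                    ≈⟨ coeff-∑-terms k (shift (b , m) q) ⟩
    ∑[ (b′ , m′) ∈ shift (b , m) q ] (ind (m′ ≟ k) ⊗ b′)         ≡⟨ ∑-map _ q _ ⟩
    ∑[ (b′ , m′) ∈ q ] (ind ((m ∙ m′) ≟ k) ⊗ (b ⊗ b′))
      ≈⟨ ∑-cong q (λ (b′ , m′) → ≈-trans (*-congʳ (split m′)) (⊗-interchange _ _ _ _)) ⟩
    ∑[ (b′ , m′) ∈ q ] (ind P? ⊗ b ⊗ (ind (m′ ≟ k′) ⊗ b′))       ≈⟨ ∑-⊗ˡ _ q _ ⟨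
    ind P? ⊗ b ⊗ ∑[ (b′ , m′) ∈ q ] (ind (m′ ≟ k′) ⊗ b′)
      ≈⟨ ≈-trans (*-assoc _ _ _) (*-congˡ (*-congˡ (≈-sym (coeff-∑-terms k′ q)))) ⟩
    ind P? ⊗ (b ⊗ coeff k′ q)                                    ∎
    where
    split : ∀ m′ → ind ((m ∙ m′) ≟ k) ≈ ind P? ⊗ ind (m′ ≟ k′)
    split m′ = ≈-trans (ind-cong ((m ∙ m′) ≟ k) (P? ×-dec (m′ ≟ k′)) (to m′) (λ { (p , ≡.refl) → from p }))
      (ind-× P? (m′ ≟ k′))

  coeff-∷-* : ∀ k t p q → coeff k ((t ∷ p) P.* q) ≈ coeff k (shift t q) ⊕ coeff k (p P.* q)
  coeff-∷-* k t p q = coeff-++ k (shift t q) (p P.* q)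

  coeff-const-* : (∀ m → ε ∙ m ≡ m) → ∀ k b q → coeff k (const b P.* q) ≈ b ⊗ coeff k q
  coeff-const-* identityˡ k b q = begin
    coeff k (shift (b , ε) q ++ [])  ≡⟨ ≡.cong (coeff k) (++-identityʳ (shift (b , ε) q)) ⟩
    coeff k (shift (b , ε) q)
      ≈⟨ coeff-shift-ind (yes ≡.refl) k k b ε q (λ m′ eq → ≡.refl {x = ε} , ≡.trans (≡.sym (identityˡ m′)) eq) (λ _ → identityˡ k) ⟩
    1# ⊗ (b ⊗ coeff k q)             ≈⟨ *-identityˡ _ ⟩
    b ⊗ coeff k q                    ∎

-- Vieta's formulas over a commutative ring.

module Vieta {c ℓ} (S : CommutativeRing c ℓ) where
  open FiniteSums S
  open SymmetricPolynomials S using (esym)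
  open RingProperties (CommutativeRing.ring S) using (-1*x≈-x)
  open Univariate rawRing using (coeff)
  open Coefficients S ℕ._≟_ _+_ 0 using (shift; coeff-shift-ind; coeff-∷-*)
  private
    S[z] = Univariate.rawRing rawRing
    module S[z] = RawRing S[z]

  linearFactors : Vec Carrier d → S[z].Carrier
  linearFactors ys = Sums.∏ S[z] (toList ys) (λ y → (1# , 1) ∷ (⊖ y , 0) ∷ [])

  coeff-suc-linear : ∀ t y q → coeff (suc t) (((1# , 1) ∷ (⊖ y , 0) ∷ []) S[z].* q) ≈ coeff t q ⊕ ⊖ y ⊗ coeff (suc t) q
  coeff-suc-linear t y q = begin
    coeff (suc t) (((1# , 1) ∷ (⊖ y , 0) ∷ []) S[z].* q)
      ≈⟨ coeff-∷-* (suc t) (1# , 1) ((⊖ y , 0) ∷ []) q ⟩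
    coeff (suc t) (shift (1# , 1) q) ⊕ coeff (suc t) (((⊖ y , 0) ∷ []) S[z].* q)
      ≈⟨ +-cong (coeff-shift-ind (yes ≡.refl) (suc t) t 1# 1 q (λ m eq → ≡.refl {x = 0} , ℕ.suc-injective eq) (λ _ → ≡.refl))
                (coeff-∷-* (suc t) (⊖ y , 0) [] q) ⟩
    1# ⊗ (1# ⊗ coeff t q) ⊕ (coeff (suc t) (shift (⊖ y , 0) q) ⊕ 0#)
      ≈⟨ +-cong (≈-trans (*-identityˡ _) (*-identityˡ _)) (≈-trans (+-identityʳ _)
           (≈-trans (coeff-shift-ind (yes ≡.refl) (suc t) (suc t) (⊖ y) 0 q (λ m eq → ≡.refl {x = 0} , eq) (λ _ → ≡.refl)) (*-identityˡ _))) ⟩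
    coeff t q ⊕ ⊖ y ⊗ coeff (suc t) q
      ∎

  coeff-zero-linear : ∀ y q → coeff 0 (((1# , 1) ∷ (⊖ y , 0) ∷ []) S[z].* q) ≈ ⊖ y ⊗ coeff 0 q
  coeff-zero-linear y q = begin
    coeff 0 (((1# , 1) ∷ (⊖ y , 0) ∷ []) S[z].* q)
      ≈⟨ coeff-∷-* 0 (1# , 1) ((⊖ y , 0) ∷ []) q ⟩
    coeff 0 (shift (1# , 1) q) ⊕ coeff 0 (((⊖ y , 0) ∷ []) S[z].* q)
      -- A multiple of z has no constant term. The condition 0 ≡ 1 is never met, so the second 0 is
      -- only a placeholder.
      ≈⟨ +-cong (coeff-shift-ind (no λ ()) 0 0 1# 1 q (λ m ()) (λ (eq : 0 ≡ 1) → contradiction eq λ ())) (coeff-∷-* 0 (⊖ y , 0) [] q) ⟩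
    0# ⊗ (1# ⊗ coeff 0 q) ⊕ (coeff 0 (shift (⊖ y , 0) q) ⊕ 0#)
      ≈⟨ ≈-trans (+-congʳ (zeroˡ _)) (≈-trans (+-identityˡ _) (+-identityʳ _)) ⟩
    coeff 0 (shift (⊖ y , 0) q)
      ≈⟨ ≈-trans (coeff-shift-ind (yes ≡.refl) 0 0 (⊖ y) 0 q (λ m eq → ≡.refl {x = 0} , eq) (λ _ → ≡.refl)) (*-identityˡ _) ⟩
    ⊖ y ⊗ coeff 0 q
      ∎

  coeff-linearFactors-> : ∀ {t} (ys : Vec Carrier d) → d < t → coeff t (linearFactors ys) ≈ 0#
  coeff-linearFactors-> {t = suc t} []       _         = ≈-refl
  coeff-linearFactors-> {t = suc t} (y ∷ ys) (s≤s d<t) = begin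
    coeff (suc t) (linearFactors (y ∷ ys))                                      ≈⟨ coeff-suc-linear t y (linearFactors ys) ⟩
    coeff t (linearFactors ys) ⊕ ⊖ y ⊗ coeff (suc t) (linearFactors ys)
      ≈⟨ +-cong (coeff-linearFactors-> ys d<t) (*-congˡ (coeff-linearFactors-> ys (ℕ.m≤n⇒m≤1+n d<t))) ⟩
    0# ⊕ ⊖ y ⊗ 0#                                                               ≈⟨ ≈-trans (+-identityˡ _) (zeroʳ _) ⟩
    0#                                                                          ∎

  esym-> : ∀ {j} (ys : Vec Carrier d) → d < j → esym j ys ≈ 0#
  esym-> {j = suc j} []       _         = ≈-refl
  esym-> {j = suc j} (y ∷ ys) (s≤s d<j) = ≈-trans
    (+-cong (esym-> ys (ℕ.m≤n⇒m≤1+n d<j)) (≈-trans (*-congˡ (esym-> ys d<j)) (zeroʳ y))) (+-identityˡ _)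

  sign-step : ∀ y s x → ⊖ y ⊗ (s ⊗ x) ≈ ⊖ 1# ⊗ s ⊗ (y ⊗ x)
  sign-step y s x = begin
    ⊖ y ⊗ (s ⊗ x)            ≈⟨ *-congʳ (-1*x≈-x y) ⟨
    ⊖ 1# ⊗ y ⊗ (s ⊗ x)       ≈⟨ solve 4 (λ u y s x → u :* y :* (s :* x) := u :* s :* (y :* x)) ≈-refl (⊖ 1#) y s x ⟩
    ⊖ 1# ⊗ s ⊗ (y ⊗ x)       ∎

  -- Multiplying by z - y changes the coefficients by the same recursion, up to sign, as adding the
  -- variable `y` does to the elementary symmetric polynomials. At the two ends j = 0 and t = 0 one
  -- term of the recursion exceeds the degree or the number of variables and vanishes.
  vieta : ∀ j t (ys : Vec Carrier d) → j + t ≡ d → coeff t (linearFactors ys) ≈ (⊖ 1#) ^ j ⊗ esym j ys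
  vieta zero    zero    []       ≡.refl = ≈-trans (+-identityʳ _) (≈-sym (*-identityˡ _))
  vieta zero    (suc t) (y ∷ ys) ≡.refl = begin
    coeff (suc t) (linearFactors (y ∷ ys))                                      ≈⟨ coeff-suc-linear t y (linearFactors ys) ⟩
    coeff t (linearFactors ys) ⊕ ⊖ y ⊗ coeff (suc t) (linearFactors ys)
      ≈⟨ +-cong (vieta 0 t ys ≡.refl) (≈-trans (*-congˡ (coeff-linearFactors-> ys ℕ.≤-refl)) (zeroʳ _)) ⟩
    1# ⊗ 1# ⊕ 0#                                                                ≈⟨ +-identityʳ _ ⟩
    1# ⊗ 1#                                                                     ∎
  vieta (suc j) zero    (y ∷ ys) eq     = begin
    coeff 0 (linearFactors (y ∷ ys))                          ≈⟨ coeff-zero-linear y (linearFactors ys) ⟩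
    ⊖ y ⊗ coeff 0 (linearFactors ys)                          ≈⟨ *-congˡ (vieta j 0 ys (ℕ.suc-injective eq)) ⟩
    ⊖ y ⊗ ((⊖ 1#) ^ j ⊗ esym j ys)                            ≈⟨ sign-step y _ _ ⟩
    (⊖ 1#) ^ suc j ⊗ (y ⊗ esym j ys)                          ≈⟨ *-congˡ (≈-trans (+-congʳ (esym-> ys d<)) (+-identityˡ _)) ⟨
    (⊖ 1#) ^ suc j ⊗ (esym (suc j) ys ⊕ y ⊗ esym j ys)        ∎
    where d< = ℕ.≤-reflexive (≡.cong suc (≡.sym (≡.trans (≡.sym (ℕ.+-identityʳ j)) (ℕ.suc-injective eq))))
  vieta (suc j) (suc t) (y ∷ ys) eq     = begin
    coeff (suc t) (linearFactors (y ∷ ys))                                          ≈⟨ coeff-suc-linear t y (linearFactors ys) ⟩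
    coeff t (linearFactors ys) ⊕ ⊖ y ⊗ coeff (suc t) (linearFactors ys)
      ≈⟨ +-cong (vieta (suc j) t ys (≡.trans (≡.sym (ℕ.+-suc j t)) (ℕ.suc-injective eq)))
           (*-congˡ (vieta j (suc t) ys (ℕ.suc-injective eq))) ⟩
    (⊖ 1#) ^ suc j ⊗ esym (suc j) ys ⊕ ⊖ y ⊗ ((⊖ 1#) ^ j ⊗ esym j ys)               ≈⟨ +-congˡ (sign-step y _ _) ⟩
    (⊖ 1#) ^ suc j ⊗ esym (suc j) ys ⊕ (⊖ 1#) ^ suc j ⊗ (y ⊗ esym j ys)             ≈⟨ distribˡ _ _ _ ⟨
    (⊖ 1#) ^ suc j ⊗ (esym (suc j) ys ⊕ y ⊗ esym j ys)                              ∎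

-- Distributing whole colour classes among the parts.

Disjoint : Vec ℕ N → Vec ℕ N → Set
Disjoint = Pointwise λ b c → b ≡ 0 ⊎ c ≡ 0

disjoint? : (β γ : Vec ℕ N) → Dec (Disjoint β γ)
disjoint? = Pointwise.decidable λ b c → (b ℕ.≟ 0) ⊎-dec (c ℕ.≟ 0)

_≟ᵥ_ : (α β : Vec ℕ N) → Dec (α ≡ β)
_≟ᵥ_ = Vec.≡-dec ℕ._≟_

lower : ℕ → Fin k → Vec ℕ k → Vec ℕ k
lower a i w = updateAt w i (_∸ a)

module Distributions {c ℓ} (S : CommutativeRing c ℓ) where
  open FiniteSums S

  -- The number of ways to distribute the colours with αᵢ ≠ 0 over the parts so
  -- that the αᵢ given to the part h add up to h.
  distributions : Vec ℕ k → Vec ℕ N → Carrier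
  distributions []      α = ind (AllV.all? (ℕ._≟ 0) α)
  distributions (h ∷ w) α = ∑[ β ∈ below α ]
    (ind (disjoint? β (α ∸ᵥ β)) ⊗ (ind (sumᵛ β ℕ.≟ h) ⊗ distributions w (α ∸ᵥ β)))

  ind-disjoint-∷ : ∀ b c (β γ : Vec ℕ N) → ind (disjoint? (b ∷ β) (c ∷ γ)) ≈
                   ind ((b ℕ.≟ 0) ⊎-dec (c ℕ.≟ 0)) ⊗ ind (disjoint? β γ)
  ind-disjoint-∷ b c β γ = ≈-trans
    (ind-cong (disjoint? (b ∷ β) (c ∷ γ)) (((b ℕ.≟ 0) ⊎-dec (c ℕ.≟ 0)) ×-dec disjoint? β γ) Pointwise.uncons (uncurry _∷_))
    (ind-× ((b ℕ.≟ 0) ⊎-dec (c ℕ.≟ 0)) (disjoint? β γ))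

  distributions-0∷ : (w : Vec ℕ k) (α : Vec ℕ N) → distributions w (0 ∷ α) ≈ distributions w α
  distributions-0∷ []      α = ind-cong (AllV.all? (ℕ._≟ 0) (0 ∷ α)) (AllV.all? (ℕ._≟ 0) α) AllV.tail (≡.refl ∷_)
  distributions-0∷ (h ∷ w) α = ≈-trans (∑-below-∷ 0 α _) (≈-trans (+-identityʳ _) (∑-cong (below α) λ β → *-cong
    (≈-trans (ind-disjoint-∷ 0 0 β (α ∸ᵥ β)) (*-identityˡ _)) (*-congˡ (distributions-0∷ w (α ∸ᵥ β)))))

  -- A colour that occurs goes entirely to the rest or entirely to the first part. The two cases
  -- exclude each other because suc a is not 0, so the indicators add up.
  ind-disjoint-∸ : ∀ {a b} → b ≤ suc a → ind ((b ℕ.≟ 0) ⊎-dec (suc a ∸ b ℕ.≟ 0)) ≈ ind (b ℕ.≟ 0) ⊕ ind (b ℕ.≟ suc a)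
  ind-disjoint-∸ {a} {zero}  b≤a = ≈-sym (+-identityʳ _)
  ind-disjoint-∸ {a} {suc b} b≤a = ≈-trans
    (ind-cong ((suc b ℕ.≟ 0) ⊎-dec (a ∸ b ℕ.≟ 0)) (suc b ℕ.≟ suc a)
      (λ { (inj₂ eq) → ℕ.≤-antisym b≤a (s≤s (ℕ.m∸n≡0⇒m≤n eq)) }) (λ { ≡.refl → inj₂ (ℕ.n∸n≡0 a) }))
    (≈-sym (+-identityˡ _))

  -- The definition recurs on the parts; here the recursion is on the colours. The first colour goes
  -- to some part `i`, whose remaining demand drops by the multiplicity of that colour, just as a
  -- term of E_j uses up u_i^j.
  distributions-suc∷ : (w : Vec ℕ k) (a : ℕ) (α : Vec ℕ N) → distributions w (suc a ∷ α) ≈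
    ∑[ i ∈ allFin k ] (ind (suc a ℕ.≤? lookup w i) ⊗ distributions (lower (suc a) i w) α)
  distributions-suc∷ []      a α = ≈-refl
  distributions-suc∷ {k = suc k} (h ∷ w) a α = begin
    distributions (h ∷ w) (suc a ∷ α)
      ≈⟨ ∑-below-∷ (suc a) α _ ⟩
    ∑[ b ∈ upTo (suc (suc a)) ] ∑[ β ∈ below α ] (ind (disjoint? (b ∷ β) (suc a ∸ b ∷ α ∸ᵥ β)) ⊗ t b β)
      ≈⟨ ∑-cong-∈ (upTo (suc (suc a))) (λ b b∈ → ∑-cong (below α) λ β → ≈-trans
           (*-congʳ (≈-trans (ind-disjoint-∷ b (suc a ∸ b) β (α ∸ᵥ β)) (*-congʳ (ind-disjoint-∸ (ℕ.≤-pred (∈-upTo⁻ b∈))))))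
           (*-assoc _ _ _)) ⟩
    ∑[ b ∈ upTo (suc (suc a)) ] ∑[ β ∈ below α ] ((ind (b ℕ.≟ 0) ⊕ ind (b ℕ.≟ suc a)) ⊗ (ind (disjoint? β (α ∸ᵥ β)) ⊗ t b β))
      ≈⟨ ∑-cong (upTo (suc (suc a))) (λ b → ≈-trans (≈-sym (∑-⊗ˡ _ (below α) _)) (distribʳ _ _ _)) ⟩
    ∑[ b ∈ upTo (suc (suc a)) ] (ind (b ℕ.≟ 0) ⊗ T b ⊕ ind (b ℕ.≟ suc a) ⊗ T b)
      ≈⟨ ∑-⊕ (upTo (suc (suc a))) _ _ ⟩
    ∑[ b ∈ upTo (suc (suc a)) ] (ind (b ℕ.≟ 0) ⊗ T b) ⊕ ∑[ b ∈ upTo (suc (suc a)) ] (ind (b ℕ.≟ suc a) ⊗ T b)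
      ≈⟨ +-cong (∑-upTo-ind (suc (suc a)) (s≤s z≤n) T) (∑-upTo-ind (suc (suc a)) ℕ.≤-refl T) ⟩
    -- In `T 0` the first colour is left to the later parts; in `T (suc a)` the part `h` receives
    -- it.
    T 0 ⊕ T (suc a)
      ≈⟨ ≈-trans (+-comm _ _) (+-cong first rest) ⟩
    ind (suc a ℕ.≤? h) ⊗ distributions (h ∸ suc a ∷ w) α
      ⊕ ∑[ i ∈ allFin k ] (ind (suc a ℕ.≤? lookup w i) ⊗ distributions (h ∷ lower (suc a) i w) α)
      ≡⟨ ∑-allFin-suc k _ ⟨
    ∑[ i ∈ allFin (suc k) ] (ind (suc a ℕ.≤? lookup (h ∷ w) i) ⊗ distributions (lower (suc a) i (h ∷ w)) α)
      ∎
    where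
    t : ℕ → Vec ℕ _ → Carrier
    t b β = ind (b + sumᵛ β ℕ.≟ h) ⊗ distributions w (suc a ∸ b ∷ α ∸ᵥ β)
    T : ℕ → Carrier
    T b = ∑[ β ∈ below α ] (ind (disjoint? β (α ∸ᵥ β)) ⊗ t b β)
    split : ∀ s → ind (suc a + s ℕ.≟ h) ≈ ind (suc a ℕ.≤? h) ⊗ ind (s ℕ.≟ h ∸ suc a)
    split s = ≈-trans (ind-cong (suc a + s ℕ.≟ h) ((suc a ℕ.≤? h) ×-dec (s ℕ.≟ h ∸ suc a))
      (λ { ≡.refl → ℕ.m≤m+n (suc a) s , ≡.sym (ℕ.m+n∸m≡n (suc a) s) })
      (λ { (a<h , ≡.refl) → ℕ.m+[n∸m]≡n a<h }))
      (ind-× (suc a ℕ.≤? h) (s ℕ.≟ h ∸ suc a))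
    first : T (suc a) ≈ ind (suc a ℕ.≤? h) ⊗ distributions (h ∸ suc a ∷ w) α
    first = ≈-trans
      (∑-cong (below α) λ β → ≈-trans
        (*-congˡ (≈-trans (*-cong (split (sumᵛ β))
          (≈-trans (≈-reflexive (≡.cong (λ c → distributions w (c ∷ α ∸ᵥ β)) (ℕ.n∸n≡0 a))) (distributions-0∷ w (α ∸ᵥ β))))
          (*-assoc _ _ _)))
        (⊗-swap _ _ _))
      (≈-sym (∑-⊗ˡ _ (below α) _))
    rest : T 0 ≈ ∑[ i ∈ allFin k ] (ind (suc a ℕ.≤? lookup w i) ⊗ distributions (h ∷ lower (suc a) i w) α)
    rest = begin
      T 0
        ≈⟨ ∑-cong (below α) (λ β → ≈-trans
             (*-congˡ (≈-trans (*-congˡ (distributions-suc∷ w a (α ∸ᵥ β))) (∑-⊗ˡ _ (allFin k) _)))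
             (∑-⊗ˡ _ (allFin k) _)) ⟩
      ∑[ β ∈ below α ] ∑[ i ∈ allFin k ] (ind (disjoint? β (α ∸ᵥ β)) ⊗ (ind (sumᵛ β ℕ.≟ h) ⊗
        (ind (suc a ℕ.≤? lookup w i) ⊗ distributions (lower (suc a) i w) (α ∸ᵥ β))))
        ≈⟨ ∑-comm (below α) (allFin k) _ ⟩
      ∑[ i ∈ allFin k ] ∑[ β ∈ below α ] (ind (disjoint? β (α ∸ᵥ β)) ⊗ (ind (sumᵛ β ℕ.≟ h) ⊗
        (ind (suc a ℕ.≤? lookup w i) ⊗ distributions (lower (suc a) i w) (α ∸ᵥ β))))
        ≈⟨ ∑-cong (allFin k) (λ i → ≈-trans
             (∑-cong (below α) λ β → ≈-trans (*-congˡ (⊗-swap _ _ _)) (⊗-swap _ _ _))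
             (≈-sym (∑-⊗ˡ _ (below α) _))) ⟩
      ∑[ i ∈ allFin k ] (ind (suc a ℕ.≤? lookup w i) ⊗ distributions (h ∷ lower (suc a) i w) α)
        ∎

  distributions-[] : (w : Vec ℕ k) → distributions w [] ≈ ind (replicate k 0 ≟ᵥ w)
  distributions-[] []      = ≈-refl
  distributions-[] {suc k} (h ∷ w) = begin
    1# ⊗ (ind (0 ℕ.≟ h) ⊗ distributions w []) ⊕ 0#    ≈⟨ ≈-trans (+-identityʳ _) (*-identityˡ _) ⟩
    ind (0 ℕ.≟ h) ⊗ distributions w []                ≈⟨ *-congˡ (distributions-[] w) ⟩
    ind (0 ℕ.≟ h) ⊗ ind (replicate k 0 ≟ᵥ w)          ≈⟨ ind-× (0 ℕ.≟ h) (replicate k 0 ≟ᵥ w) ⟨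
    ind ((0 ℕ.≟ h) ×-dec (replicate k 0 ≟ᵥ w))        ≈⟨ ind-cong ((0 ℕ.≟ h) ×-dec (replicate k 0 ≟ᵥ w)) ((0 ∷ replicate k 0) ≟ᵥ (h ∷ w))
                                                          (λ { (≡.refl , ≡.refl) → ≡.refl }) (λ { ≡.refl → ≡.refl , ≡.refl }) ⟩
    ind ((0 ∷ replicate k 0) ≟ᵥ (h ∷ w))              ∎

-- Counting the proper colourings of a complete multipartite graph.

counts : Vec (Fin N) n → Vec ℕ N
counts κ = tabulate λ i → count (Fin._≟ i) κ

counts-∷ : (i : Fin N) (κ : Vec (Fin N) n) → counts (i ∷ κ) ≡ updateAt (counts κ) i suc
counts-∷ i κ = tabulate-updateAt i λ j → count (Fin._≟ j) κ
  where
  tabulate-updateAt : ∀ {N} (i : Fin N) (f : Fin N → ℕ) →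
    tabulate (λ j → (if does (i Fin.≟ j) then suc else id) (f j)) ≡ updateAt (tabulate f) i suc
  tabulate-updateAt zero    f = ≡.refl
  tabulate-updateAt (suc i) f = ≡.cong (f zero ∷_) (tabulate-updateAt i (f ∘ suc))

counts-[] : ∀ N → counts {N} [] ≡ replicate N 0
counts-[] zero    = ≡.refl
counts-[] (suc N) = ≡.cong (0 ∷_) (counts-[] N)

infixl 6 _+ᵥ_
_+ᵥ_ : Vec ℕ N → Vec ℕ N → Vec ℕ N
_+ᵥ_ = zipWith _+_

counts-++ : ∀ {m} (κ : Vec (Fin N) m) (κ′ : Vec (Fin N) n) → counts (κ ++ᵥ κ′) ≡ counts κ +ᵥ counts κ′
counts-++ {N} []      κ′ = ≡.sym (≡.trans (≡.cong (_+ᵥ counts κ′) (counts-[] N))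
  (Vec.zipWith-identityˡ ℕ.+-identityˡ (counts κ′)))
counts-++ {N} (i ∷ κ) κ′ = begin
  counts (i ∷ κ ++ᵥ κ′)                       ≡⟨ counts-∷ i (κ ++ᵥ κ′) ⟩
  updateAt (counts (κ ++ᵥ κ′)) i suc          ≡⟨ ≡.cong (λ α → updateAt α i suc) (counts-++ κ κ′) ⟩
  updateAt (counts κ +ᵥ counts κ′) i suc     ≡⟨ updateAt-+ᵥ i (counts κ) (counts κ′) ⟩
  updateAt (counts κ) i suc +ᵥ counts κ′     ≡⟨ ≡.cong (_+ᵥ counts κ′) (counts-∷ i κ) ⟨
  counts (i ∷ κ) +ᵥ counts κ′                ∎
  where
  open ≡.≡-Reasoning
  updateAt-+ᵥ : ∀ {N} (i : Fin N) (α β : Vec ℕ N) → updateAt (α +ᵥ β) i suc ≡ updateAt α i suc +ᵥ β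
  updateAt-+ᵥ zero    (a ∷ α) (b ∷ β) = ≡.refl
  updateAt-+ᵥ (suc i) (a ∷ α) (b ∷ β) = ≡.cong (a + b ∷_) (updateAt-+ᵥ i α β)

updateAt-suc-≡ : (i : Fin N) (α β : Vec ℕ N) → updateAt α i suc ≡ β → 1 ≤ lookup β i × α ≡ lower 1 i β
updateAt-suc-≡ zero    (a ∷ α) .(suc a ∷ α) ≡.refl = s≤s z≤n , ≡.refl
updateAt-suc-≡ (suc i) (a ∷ α) (b ∷ β)      eq with Vec.∷-injective eq
... | ≡.refl , eq′ with updateAt-suc-≡ i α β eq′
...   | βᵢ≥1 , α≡ = βᵢ≥1 , ≡.cong (a ∷_) α≡

lower-1-suc : (i : Fin N) (β : Vec ℕ N) → 1 ≤ lookup β i → updateAt (lower 1 i β) i suc ≡ β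
lower-1-suc zero    (suc b ∷ β) _    = ≡.refl
lower-1-suc (suc i) (b ∷ β)     βᵢ≥1 = ≡.cong (b ∷_) (lower-1-suc i β βᵢ≥1)

sum-lower-1 : (i : Fin N) (β : Vec ℕ N) → 1 ≤ lookup β i → suc (sumᵛ (lower 1 i β)) ≡ sumᵛ β
sum-lower-1 zero    (suc b ∷ β) _    = ≡.refl
sum-lower-1 (suc i) (b ∷ β)     βᵢ≥1 = ≡.trans (≡.sym (ℕ.+-suc b _)) (≡.cong (b +_) (sum-lower-1 i β βᵢ≥1))

count≡0⇒∉ : (i : Fin N) (κ : Vec (Fin N) n) → count (Fin._≟ i) κ ≡ 0 → ∀ v → lookup κ v ≢ i
count≡0⇒∉ i (j ∷ κ) eq v       with j Fin.≟ i
count≡0⇒∉ i (j ∷ κ) () v       | yes _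
count≡0⇒∉ i (j ∷ κ) eq zero    | no j≢i = j≢i
count≡0⇒∉ i (j ∷ κ) eq (suc v) | no _   = count≡0⇒∉ i κ eq v

∉⇒count≡0 : (i : Fin N) (κ : Vec (Fin N) n) → (∀ v → lookup κ v ≢ i) → count (Fin._≟ i) κ ≡ 0
∉⇒count≡0 i []      _  = ≡.refl
∉⇒count≡0 i (j ∷ κ) i∉ with j Fin.≟ i
... | yes j≡i = contradiction j≡i (i∉ zero)
... | no _    = ∉⇒count≡0 i κ (i∉ ∘ suc)

module _ {m n N} (κ : Vec (Fin N) m) (κ′ : Vec (Fin N) n) where

  disjoint⇒≢ : Disjoint (counts κ) (counts κ′) → ∀ v w → lookup κ v ≢ lookup κ′ w
  disjoint⇒≢ dis v w eq with Pointwise.tabulate⁻ dis (lookup κ v)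
  ... | inj₁ count≡0 = count≡0⇒∉ (lookup κ v) κ count≡0 v ≡.refl
  ... | inj₂ count≡0 = count≡0⇒∉ (lookup κ v) κ′ count≡0 w (≡.sym eq)

  ≢⇒disjoint : (∀ v w → lookup κ v ≢ lookup κ′ w) → Disjoint (counts κ) (counts κ′)
  ≢⇒disjoint κ≢κ′ = Pointwise.tabulate⁺ disjointAt
    where
    disjointAt : ∀ i → count (Fin._≟ i) κ ≡ 0 ⊎ count (Fin._≟ i) κ′ ≡ 0
    disjointAt i with Fin.any? (λ v → lookup κ v Fin.≟ i)
    ... | yes (v , κv≡i) = inj₂ (∉⇒count≡0 i κ′ λ w κ′w≡i → κ≢κ′ v w (≡.trans κv≡i (≡.sym κ′w≡i)))
    ... | no  i∉κ        = inj₁ (∉⇒count≡0 i κ λ v κv≡i → i∉κ (v , κv≡i))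

module _ (h : ℕ) (η : List ℕ) (κ : Vec (Fin N) h) (κ′ : Vec (Fin N) (sum η)) where

  -- The first `h` vertices form one part: they impose no condition on each other, and each is
  -- adjacent to every later vertex, so the two halves can share no colour.
  proper-++⁻ : Proper (K (h ∷ η)) (κ ++ᵥ κ′) → Disjoint (counts κ) (counts κ′) × Proper (K η) κ′
  proper-++⁻ proper = ≢⇒disjoint κ κ′ across , within
    where
    part-↑ˡ : ∀ v → part (h ∷ η) (v ↑ˡ sum η) ≡ zero
    part-↑ˡ v = ≡.cong [ (λ _ → zero) , suc ∘ part η ]′ (Fin.splitAt-↑ˡ h v (sum η))
    part-↑ʳ : ∀ v → part (h ∷ η) (h ↑ʳ v) ≡ suc (part η v)
    part-↑ʳ v = ≡.cong [ (λ _ → zero) , suc ∘ part η ]′ (Fin.splitAt-↑ʳ h (sum η) v)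
    across : ∀ v w → lookup κ v ≢ lookup κ′ w
    across v w eq = proper (v ↑ˡ sum η) (h ↑ʳ w)
      (λ eq′ → Fin.0≢1+n (≡.trans (≡.sym (part-↑ˡ v)) (≡.trans eq′ (part-↑ʳ w))))
      (≡.trans (Vec.lookup-++ˡ κ κ′ v) (≡.trans eq (≡.sym (Vec.lookup-++ʳ κ κ′ w))))
    within : Proper (K η) κ′
    within v w part≢ eq = proper (h ↑ʳ v) (h ↑ʳ w)
      (λ eq′ → part≢ (Fin.suc-injective (≡.trans (≡.sym (part-↑ʳ v)) (≡.trans eq′ (part-↑ʳ w)))))
      (≡.trans (Vec.lookup-++ʳ κ κ′ v) (≡.trans eq (≡.sym (Vec.lookup-++ʳ κ κ′ w))))

  proper-++⁺ : Disjoint (counts κ) (counts κ′) → Proper (K η) κ′ → Proper (K (h ∷ η)) (κ ++ᵥ κ′)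
  proper-++⁺ dis proper v w
    -- Expresses the colour of a vertex through `splitAt`, which also determines its part; a single
    -- case split then decides both.
    rewrite Vec.lookup-splitAt h κ κ′ v | Vec.lookup-splitAt h κ κ′ w
    with splitAt h v | splitAt h w
  ... | inj₁ v′ | inj₁ w′ = λ part≢ → contradiction ≡.refl part≢
  ... | inj₁ v′ | inj₂ w′ = λ _ → disjoint⇒≢ κ κ′ dis v′ w′
  ... | inj₂ v′ | inj₁ w′ = λ _ → disjoint⇒≢ κ κ′ dis w′ v′ ∘ ≡.sym
  ... | inj₂ v′ | inj₂ w′ = λ part≢ → proper v′ w′ (part≢ ∘ ≡.cong suc)

-- `words` carries a graph as parameter, so the lists taken for different graphs must be identified
-- before a colouring is cut into the words of its parts.
words-irrelevant : (G G′ : Graph) → ∀ N n → words G N n ≡ words G′ N n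
words-irrelevant G G′ N zero    = ≡.refl
words-irrelevant G G′ N (suc n) = ≡.cong (cartesianProductWith _∷_ (allFin N)) (words-irrelevant G G′ N n)

≤ᵥ-+ᵥ : (α β : Vec ℕ N) → α ≤ᵥ (α +ᵥ β)
≤ᵥ-+ᵥ []      []      = []
≤ᵥ-+ᵥ (a ∷ α) (b ∷ β) = ℕ.m≤m+n a b ∷ ≤ᵥ-+ᵥ α β

+ᵥ-∸ᵥ : (α β : Vec ℕ N) → (α +ᵥ β) ∸ᵥ α ≡ β
+ᵥ-∸ᵥ []      []      = ≡.refl
+ᵥ-∸ᵥ (a ∷ α) (b ∷ β) = ≡.cong₂ _∷_ (ℕ.m+n∸m≡n a b) (+ᵥ-∸ᵥ α β)

∸ᵥ-+ᵥ : {α β : Vec ℕ N} → β ≤ᵥ α → β +ᵥ (α ∸ᵥ β) ≡ α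
∸ᵥ-+ᵥ []          = ≡.refl
∸ᵥ-+ᵥ (b≤a ∷ β≤α) = ≡.cong₂ _∷_ (ℕ.m+[n∸m]≡n b≤a) (∸ᵥ-+ᵥ β≤α)

module Colourings {c ℓ} (S : CommutativeRing c ℓ) where
  open FiniteSums S
  open SymmetricPolynomials S using (fromℕᴿ; fromℕᴿ-+; fromℕᴿ-*)
  open Distributions S

  fact : Vec ℕ N → Carrier
  fact []      = 1#
  fact (a ∷ α) = fromℕᴿ (a !) ⊗ fact α

  -- Each entry of `α` goes undivided to one of the two vectors, and the other receives 0, with 0! =
  -- 1.
  fact-disjoint : {α β : Vec ℕ N} → β ≤ᵥ α → Disjoint β (α ∸ᵥ β) → fact α ≈ fact β ⊗ fact (α ∸ᵥ β)
  fact-disjoint {α = []}    {[]}    []          []          = ≈-sym (*-identityˡ _)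
  fact-disjoint {α = a ∷ α} {b ∷ β} (b≤a ∷ β≤α) (dis ∷ diss) = begin
    fromℕᴿ (a !) ⊗ fact α                                                  ≈⟨ *-cong (head b≤a dis) (fact-disjoint β≤α diss) ⟩
    (fromℕᴿ (b !) ⊗ fromℕᴿ ((a ∸ b) !)) ⊗ (fact β ⊗ fact (α ∸ᵥ β))         ≈⟨ ⊗-interchange _ _ _ _ ⟩
    (fromℕᴿ (b !) ⊗ fact β) ⊗ (fromℕᴿ ((a ∸ b) !) ⊗ fact (α ∸ᵥ β))         ∎
    where
    head : ∀ {a b} → b ≤ a → b ≡ 0 ⊎ a ∸ b ≡ 0 → fromℕᴿ (a !) ≈ fromℕᴿ (b !) ⊗ fromℕᴿ ((a ∸ b) !)
    head         _   (inj₁ ≡.refl) = ≈-sym (≈-trans (*-congʳ (+-identityʳ _)) (*-identityˡ _))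
    head {a} {b} b≤a (inj₂ eq) = begin
      fromℕᴿ (a !)                      ≡⟨ ≡.cong (λ b → fromℕᴿ (b !)) (ℕ.≤-antisym (ℕ.m∸n≡0⇒m≤n eq) b≤a) ⟩
      fromℕᴿ (b !)                      ≈⟨ ≈-trans (*-congˡ (+-identityʳ _)) (*-identityʳ _) ⟨
      fromℕᴿ (b !) ⊗ fromℕᴿ (0 !)       ≡⟨ ≡.cong (λ c → fromℕᴿ (b !) ⊗ fromℕᴿ (c !)) eq ⟨
      fromℕᴿ (b !) ⊗ fromℕᴿ ((a ∸ b) !) ∎

  fact-lower-1 : (i : Fin N) (β : Vec ℕ N) → 1 ≤ lookup β i → fact β ≈ fromℕᴿ (lookup β i) ⊗ fact (lower 1 i β)
  fact-lower-1 zero    (suc b ∷ β) _    = ≈-trans (*-congʳ (fromℕᴿ-* (suc b) (b !))) (*-assoc _ _ _)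
  fact-lower-1 (suc i) (b ∷ β)     βᵢ≥1 = ≈-trans (*-congˡ (fact-lower-1 i β βᵢ≥1)) (⊗-swap _ _ _)

  fact-zeros : ∀ N → fact (replicate N 0) ≈ 1#
  fact-zeros zero    = ≈-refl
  fact-zeros (suc N) = ≈-trans (*-cong (+-identityʳ _) (fact-zeros N)) (*-identityˡ _)

  ∑-lookup : (β : Vec ℕ N) → ∑[ i ∈ allFin N ] fromℕᴿ (lookup β i) ≈ fromℕᴿ (sumᵛ β)
  ∑-lookup []              = ≈-refl
  ∑-lookup {suc N} (b ∷ β) = ≈-trans (≈-reflexive (∑-allFin-suc N _))
    (≈-trans (+-congˡ (∑-lookup β)) (≈-sym (fromℕᴿ-+ b (sumᵛ β))))

  -- The number of words with letter counts `β` is h!/β!, stated without division. Splitting off the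
  -- first letter `i` takes the factor β_i out of β!, and these factors add up to the length of the
  -- word.
  multinomial : ∀ G h (β : Vec ℕ N) →
    fact β ⊗ ∑[ κ ∈ words G N h ] ind (counts κ ≟ᵥ β) ≈ fromℕᴿ (h !) ⊗ ind (sumᵛ β ℕ.≟ h)
  multinomial {N} G zero    β = begin
    fact β ⊗ (ind (counts {N} [] ≟ᵥ β) ⊕ 0#)     ≈⟨ ≈-trans (*-congˡ (+-identityʳ _)) (*-comm _ _) ⟩
    ind (counts {N} [] ≟ᵥ β) ⊗ fact β
      ≈⟨ ind-⊗-cong (counts {N} [] ≟ᵥ β) (λ { ≡.refl → ≈-trans (≈-reflexive (≡.cong fact (counts-[] N))) (fact-zeros N) }) ⟩
    ind (counts {N} [] ≟ᵥ β) ⊗ 1#                ≈⟨ *-comm _ _ ⟩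
    1# ⊗ ind (counts {N} [] ≟ᵥ β)                ≈⟨ *-cong (≈-sym (+-identityʳ _)) (ind-cong (counts {N} [] ≟ᵥ β) (sumᵛ β ℕ.≟ 0)
                                                      (λ { ≡.refl → ≡.trans (≡.cong sumᵛ (counts-[] N)) (sum-zeros N) })
                                                      (λ eq → ≡.trans (counts-[] N) (≡.sym (sum≡0⇒zeros β eq)))) ⟩
    fromℕᴿ (0 !) ⊗ ind (sumᵛ β ℕ.≟ 0)            ∎
  multinomial {N} G (suc h) β = begin
    fact β ⊗ ∑[ κ ∈ words G N (suc h) ] ind (counts κ ≟ᵥ β)
      ≈⟨ *-congˡ (∑-cartesianProductWith _∷_ (allFin N) (words G N h) _) ⟩
    fact β ⊗ ∑[ i ∈ allFin N ] ∑[ κ ∈ words G N h ] ind (counts (i ∷ κ) ≟ᵥ β)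
      ≈⟨ *-congˡ (∑-cong (allFin N) λ i → ≈-trans (∑-cong (words G N h) (split i)) (≈-sym (∑-⊗ˡ _ (words G N h) _))) ⟩
    fact β ⊗ ∑[ i ∈ allFin N ] (ind (1 ℕ.≤? lookup β i) ⊗ ∑[ κ ∈ words G N h ] ind (counts κ ≟ᵥ lower 1 i β))
      ≈⟨ ∑-⊗ˡ _ (allFin N) _ ⟩
    ∑[ i ∈ allFin N ] (fact β ⊗ (ind (1 ℕ.≤? lookup β i) ⊗ ∑[ κ ∈ words G N h ] ind (counts κ ≟ᵥ lower 1 i β)))
      ≈⟨ ∑-cong (allFin N) (λ i → ≈-trans (⊗-swap _ _ _) (≈-trans (ind-⊗-cong (1 ℕ.≤? lookup β i) (step i)) (positive i))) ⟩
    ∑[ i ∈ allFin N ] (fromℕᴿ (lookup β i) ⊗ (fromℕᴿ (h !) ⊗ ind (sumᵛ β ℕ.≟ suc h)))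
      ≈⟨ ∑-⊗ʳ _ (allFin N) _ ⟨
    ∑[ i ∈ allFin N ] fromℕᴿ (lookup β i) ⊗ (fromℕᴿ (h !) ⊗ ind (sumᵛ β ℕ.≟ suc h))
      ≈⟨ *-congʳ (∑-lookup β) ⟩
    fromℕᴿ (sumᵛ β) ⊗ (fromℕᴿ (h !) ⊗ ind (sumᵛ β ℕ.≟ suc h))
      ≈⟨ solve 3 (λ s f i → s :* (f :* i) := i :* (s :* f)) ≈-refl _ _ _ ⟩
    ind (sumᵛ β ℕ.≟ suc h) ⊗ (fromℕᴿ (sumᵛ β) ⊗ fromℕᴿ (h !))
      ≈⟨ ind-⊗-cong (sumᵛ β ℕ.≟ suc h) (λ |β| → ≈-trans (≈-reflexive (≡.cong (λ s → fromℕᴿ s ⊗ fromℕᴿ (h !)) |β|)) (≈-sym (fromℕᴿ-* (suc h) (h !)))) ⟩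
    ind (sumᵛ β ℕ.≟ suc h) ⊗ fromℕᴿ (suc h !)
      ≈⟨ *-comm _ _ ⟩
    fromℕᴿ (suc h !) ⊗ ind (sumᵛ β ℕ.≟ suc h)
      ∎
    where
    split : ∀ i κ → ind (counts (i ∷ κ) ≟ᵥ β) ≈ ind (1 ℕ.≤? lookup β i) ⊗ ind (counts κ ≟ᵥ lower 1 i β)
    split i κ = ≈-trans (ind-cong (counts (i ∷ κ) ≟ᵥ β) ((1 ℕ.≤? lookup β i) ×-dec (counts κ ≟ᵥ lower 1 i β))
      (λ eq → updateAt-suc-≡ i (counts κ) β (≡.trans (≡.sym (counts-∷ i κ)) eq))
      (λ (βᵢ≥1 , eq) → ≡.trans (counts-∷ i κ) (≡.trans (≡.cong (λ α → updateAt α i suc) eq) (lower-1-suc i β βᵢ≥1))))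
      (ind-× (1 ℕ.≤? lookup β i) (counts κ ≟ᵥ lower 1 i β))
    step : ∀ i → 1 ≤ lookup β i → fact β ⊗ ∑[ κ ∈ words G N h ] ind (counts κ ≟ᵥ lower 1 i β) ≈
           fromℕᴿ (lookup β i) ⊗ (fromℕᴿ (h !) ⊗ ind (sumᵛ β ℕ.≟ suc h))
    step i βᵢ≥1 = ≈-trans (*-congʳ (fact-lower-1 i β βᵢ≥1)) (≈-trans (*-assoc _ _ _) (*-congˡ
      (≈-trans (multinomial G h (lower 1 i β)) (*-congˡ
        (ind-cong (sumᵛ (lower 1 i β) ℕ.≟ h) (sumᵛ β ℕ.≟ suc h)
          (λ eq → ≡.trans (≡.sym (sum-lower-1 i β βᵢ≥1)) (≡.cong suc eq))
          (λ eq → ℕ.suc-injective (≡.trans (sum-lower-1 i β βᵢ≥1) eq)))))))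
    positive : ∀ i {x} → ind (1 ℕ.≤? lookup β i) ⊗ (fromℕᴿ (lookup β i) ⊗ x) ≈ fromℕᴿ (lookup β i) ⊗ x
    positive i with lookup β i
    ... | zero  = ≈-trans (zeroˡ _) (≈-sym (zeroˡ _))
    ... | suc b = *-identityˡ _

  ∑-words-++ : ∀ G G₁ G₂ N m n (f : Vec (Fin N) (m + n) → Carrier) →
    ∑ (words G N (m + n)) f ≈ ∑[ κ ∈ words G₁ N m ] ∑[ κ′ ∈ words G₂ N n ] f (κ ++ᵥ κ′)
  ∑-words-++ G G₁ G₂ N zero    n f = ≈-trans (≈-reflexive (≡.cong (λ ws → ∑ ws f) (words-irrelevant G G₂ N n))) (≈-sym (+-identityʳ _))
  ∑-words-++ G G₁ G₂ N (suc m) n f = ≈-trans (∑-cartesianProductWith _∷_ (allFin N) (words G N (m + n)) f) (≈-trans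
    (∑-cong (allFin N) λ i → ∑-words-++ G G₁ G₂ N m n (f ∘ (i ∷_)))
    (≈-sym (∑-cartesianProductWith _∷_ (allFin N) (words G₁ N m) _)))

  colourings : List ℕ → Vec ℕ N → Carrier
  colourings {N} η α = ∑[ κ ∈ words (K η) N (sum η) ] (ind (proper? (K η) κ) ⊗ ind (counts κ ≟ᵥ α))

  -- Makes the colour counts `β` of the first part a summation variable. For fixed `β` the
  -- conditions on the two words separate, so the sum over pairs of words becomes a product.
  ind-proper-++ : ∀ h η (α : Vec ℕ N) (κ : Vec (Fin N) h) (κ′ : Vec (Fin N) (sum η)) →
    ind (proper? (K (h ∷ η)) (κ ++ᵥ κ′)) ⊗ ind (counts (κ ++ᵥ κ′) ≟ᵥ α) ≈
    ∑[ β ∈ below α ] (ind (counts κ ≟ᵥ β) ⊗ (ind (disjoint? β (α ∸ᵥ β)) ⊗ (ind (proper? (K η) κ′) ⊗ ind (counts κ′ ≟ᵥ (α ∸ᵥ β)))))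
  ind-proper-++ h η α κ κ′ with counts (κ ++ᵥ κ′) ≟ᵥ α
  ... | yes ≡.refl = ≈-sym (begin
    ∑[ β ∈ below α ] (ind (counts κ ≟ᵥ β) ⊗ g β)
      ≈⟨ ∑-cong (below α) (λ β → *-congʳ (ind-cong (counts κ ≟ᵥ β) (β ≟ᵥ counts κ) ≡.sym ≡.sym)) ⟩
    ∑[ β ∈ below α ] (ind (β ≟ᵥ counts κ) ⊗ g β)
      ≈⟨ ∑-below-ind (≡.subst (counts κ ≤ᵥ_) (≡.sym (counts-++ κ κ′)) (≤ᵥ-+ᵥ (counts κ) (counts κ′))) g ⟩
    g (counts κ)
      ≡⟨ ≡.cong (λ γ → ind (disjoint? (counts κ) γ) ⊗ (ind (proper? (K η) κ′) ⊗ ind (counts κ′ ≟ᵥ γ)))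
           (≡.trans (≡.cong (_∸ᵥ counts κ) (counts-++ κ κ′)) (+ᵥ-∸ᵥ (counts κ) (counts κ′))) ⟩
    ind (disjoint? (counts κ) (counts κ′)) ⊗ (ind (proper? (K η) κ′) ⊗ ind (counts κ′ ≟ᵥ counts κ′))
      ≈⟨ *-assoc _ _ _ ⟨
    ind (disjoint? (counts κ) (counts κ′)) ⊗ ind (proper? (K η) κ′) ⊗ ind (counts κ′ ≟ᵥ counts κ′)
      ≈⟨ *-cong (≈-sym (ind-× (disjoint? (counts κ) (counts κ′)) (proper? (K η) κ′))) (≈-reflexive (ind-true (counts κ′ ≟ᵥ counts κ′) ≡.refl)) ⟩
    ind (disjoint? (counts κ) (counts κ′) ×-dec proper? (K η) κ′) ⊗ 1#
      ≈⟨ *-congʳ (ind-cong (disjoint? (counts κ) (counts κ′) ×-dec proper? (K η) κ′) (proper? (K (h ∷ η)) (κ ++ᵥ κ′))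
           (uncurry (proper-++⁺ h η κ κ′)) (proper-++⁻ h η κ κ′)) ⟩
    ind (proper? (K (h ∷ η)) (κ ++ᵥ κ′)) ⊗ 1#
      ∎)
    where
    g : Vec ℕ _ → Carrier
    g β = ind (disjoint? β (α ∸ᵥ β)) ⊗ (ind (proper? (K η) κ′) ⊗ ind (counts κ′ ≟ᵥ (α ∸ᵥ β)))
  ... | no  ≢α = ≈-trans (zeroʳ _) (≈-sym (≈-trans (∑-cong-∈ (below α) vanish) (∑-0 (below α))))
    where
    vanish : ∀ β → β ∈ below α →
      ind (counts κ ≟ᵥ β) ⊗ (ind (disjoint? β (α ∸ᵥ β)) ⊗ (ind (proper? (K η) κ′) ⊗ ind (counts κ′ ≟ᵥ (α ∸ᵥ β)))) ≈ 0#
    vanish β β∈ = ≈-trans (ind-⊗-cong (counts κ ≟ᵥ β) λ { ≡.refl →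
      ≈-trans (*-congˡ (≈-trans (*-congˡ (≈-reflexive (ind-false (counts κ′ ≟ᵥ (α ∸ᵥ β)) λ eq → ≢α
        (≡.trans (counts-++ κ κ′) (≡.trans (≡.cong (counts κ +ᵥ_) eq) (∸ᵥ-+ᵥ (∈-below β∈))))))) (zeroʳ _))) (zeroʳ _) })
      (zeroʳ _)

  colourings-∷ : ∀ h η (α : Vec ℕ N) → colourings (h ∷ η) α ≈
    ∑[ β ∈ below α ] (ind (disjoint? β (α ∸ᵥ β)) ⊗ (∑[ κ ∈ words (K η) N h ] ind (counts κ ≟ᵥ β) ⊗ colourings η (α ∸ᵥ β)))
  colourings-∷ {N} h η α = begin
    colourings (h ∷ η) α
      ≈⟨ ∑-words-++ (K (h ∷ η)) (K η) (K η) N h (sum η) _ ⟩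
    ∑[ κ ∈ Kₕ ] ∑[ κ′ ∈ Kη ] (ind (proper? (K (h ∷ η)) (κ ++ᵥ κ′)) ⊗ ind (counts (κ ++ᵥ κ′) ≟ᵥ α))
      ≈⟨ ∑-cong Kₕ (λ κ → ≈-trans (∑-cong Kη (ind-proper-++ h η α κ)) (∑-comm Kη (below α) _)) ⟩
    ∑[ κ ∈ Kₕ ] ∑[ β ∈ below α ] ∑[ κ′ ∈ Kη ] (ind (counts κ ≟ᵥ β) ⊗ (ind (disjoint? β (α ∸ᵥ β)) ⊗ g κ′ β))
      ≈⟨ ∑-comm Kₕ (below α) _ ⟩
    ∑[ β ∈ below α ] ∑[ κ ∈ Kₕ ] ∑[ κ′ ∈ Kη ] (ind (counts κ ≟ᵥ β) ⊗ (ind (disjoint? β (α ∸ᵥ β)) ⊗ g κ′ β))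
      ≈⟨ ∑-cong (below α) (λ β → ≈-trans
           (∑-cong Kₕ λ κ → ≈-trans (∑-cong Kη λ κ′ → ⊗-swap _ _ _)
             (≈-trans (≈-sym (∑-⊗ˡ _ Kη _)) (*-congˡ (≈-sym (∑-⊗ˡ (ind (counts κ ≟ᵥ β)) Kη (λ κ′ → g κ′ β))))))
           (≈-trans (≈-sym (∑-⊗ˡ _ Kₕ _)) (*-congˡ (≈-sym (∑-⊗ʳ (colourings η (α ∸ᵥ β)) Kₕ _))))) ⟩
    ∑[ β ∈ below α ] (ind (disjoint? β (α ∸ᵥ β)) ⊗ (∑[ κ ∈ Kₕ ] ind (counts κ ≟ᵥ β) ⊗ colourings η (α ∸ᵥ β)))
      ∎
    where
    Kₕ = words (K η) N h
    Kη = words (K η) N (sum η)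
    g : Vec (Fin N) (sum η) → Vec ℕ N → Carrier
    g κ′ β = ind (proper? (K η) κ′) ⊗ ind (counts κ′ ≟ᵥ (α ∸ᵥ β))

  -- The first part can be coloured in h!/β! ways once its colour counts `β` are chosen. By
  -- disjointness α! is the product of β! and (α ∸ᵥ β)!; the first factor is absorbed here and the
  -- second in the recursive call.
  fact-colourings : ∀ η (α : Vec ℕ N) →
    fact α ⊗ colourings η α ≈ fromℕᴿ (product (map _! η)) ⊗ distributions (fromList η) α
  fact-colourings {N} [] α = begin
    fact α ⊗ (ind (proper? (K []) {N} []) ⊗ ind (counts {N} [] ≟ᵥ α) ⊕ 0#)
      ≈⟨ *-congˡ (≈-trans (+-identityʳ _) (≈-trans (*-congʳ (≈-reflexive (ind-true (proper? (K []) {N} []) λ ()))) (*-identityˡ _))) ⟩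
    fact α ⊗ ind (counts {N} [] ≟ᵥ α)
      ≈⟨ *-comm _ _ ⟩
    ind (counts {N} [] ≟ᵥ α) ⊗ fact α
      ≈⟨ ind-⊗-cong (counts {N} [] ≟ᵥ α) (λ { ≡.refl → ≈-trans (≈-reflexive (≡.cong fact (counts-[] N))) (fact-zeros N) }) ⟩
    ind (counts {N} [] ≟ᵥ α) ⊗ 1#
      ≈⟨ *-comm _ _ ⟩
    1# ⊗ ind (counts {N} [] ≟ᵥ α)
      ≈⟨ *-cong (≈-sym (+-identityʳ _)) (ind-cong (counts {N} [] ≟ᵥ α) (AllV.all? (ℕ._≟ 0) α)
           (λ { ≡.refl → ≡.subst (AllV.All (_≡ 0)) (≡.sym (counts-[] N)) (all-zeros N ≡.refl) })
           (λ α≡0 → ≡.trans (counts-[] N) (≡.sym (sum≡0⇒zeros α (all-≡0⇒sum≡0 α≡0))))) ⟩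
    fromℕᴿ 1 ⊗ ind (AllV.all? (ℕ._≟ 0) α)
      ∎
  fact-colourings {N} (h ∷ η) α = begin
    fact α ⊗ colourings (h ∷ η) α
      ≈⟨ ≈-trans (*-congˡ (colourings-∷ h η α)) (∑-⊗ˡ _ (below α) _) ⟩
    ∑[ β ∈ below α ] (fact α ⊗ (ind (disjoint? β (α ∸ᵥ β)) ⊗ (∑[ κ ∈ Kₕ ] ind (counts κ ≟ᵥ β) ⊗ colourings η (α ∸ᵥ β))))
      ≈⟨ ∑-cong-∈ (below α) (λ β β∈ → ≈-trans (⊗-swap _ _ _) (≈-trans
           (ind-⊗-cong (disjoint? β (α ∸ᵥ β)) (step β (∈-below β∈))) (⊗-swap _ _ _))) ⟩
    ∑[ β ∈ below α ] (fromℕᴿ (product (map _! (h ∷ η))) ⊗ (ind (disjoint? β (α ∸ᵥ β)) ⊗ (ind (sumᵛ β ℕ.≟ h) ⊗ distributions (fromList η) (α ∸ᵥ β))))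
      ≈⟨ ∑-⊗ˡ _ (below α) _ ⟨
    fromℕᴿ (product (map _! (h ∷ η))) ⊗ distributions (fromList (h ∷ η)) α
      ∎
    where
    Kₕ = words (K η) N h
    step : ∀ β → β ≤ᵥ α → Disjoint β (α ∸ᵥ β) →
      fact α ⊗ (∑[ κ ∈ Kₕ ] ind (counts κ ≟ᵥ β) ⊗ colourings η (α ∸ᵥ β)) ≈
      fromℕᴿ (product (map _! (h ∷ η))) ⊗ (ind (sumᵛ β ℕ.≟ h) ⊗ distributions (fromList η) (α ∸ᵥ β))
    step β β≤α dis = begin
      fact α ⊗ (w ⊗ colourings η (α ∸ᵥ β))
        ≈⟨ *-congʳ (fact-disjoint β≤α dis) ⟩
      fact β ⊗ fact (α ∸ᵥ β) ⊗ (w ⊗ colourings η (α ∸ᵥ β))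
        ≈⟨ ⊗-interchange _ _ _ _ ⟩
      (fact β ⊗ w) ⊗ (fact (α ∸ᵥ β) ⊗ colourings η (α ∸ᵥ β))
        ≈⟨ *-cong (multinomial (K η) h β) (fact-colourings η (α ∸ᵥ β)) ⟩
      (fromℕᴿ (h !) ⊗ ind (sumᵛ β ℕ.≟ h)) ⊗ (fromℕᴿ (product (map _! η)) ⊗ distributions (fromList η) (α ∸ᵥ β))
        ≈⟨ ⊗-interchange _ _ _ _ ⟩
      (fromℕᴿ (h !) ⊗ fromℕᴿ (product (map _! η))) ⊗ (ind (sumᵛ β ℕ.≟ h) ⊗ distributions (fromList η) (α ∸ᵥ β))
        ≈⟨ *-congʳ (fromℕᴿ-* (h !) (product (map _! η))) ⟨
      fromℕᴿ (product (map _! (h ∷ η))) ⊗ (ind (sumᵛ β ℕ.≟ h) ⊗ distributions (fromList η) (α ∸ᵥ β))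
        ∎
      where
      w = ∑[ κ ∈ Kₕ ] ind (counts κ ≟ᵥ β)

-- The u-coefficients of products of the E_j.

unit : Fin k → ℕ → Vec ℕ k
unit {k} i j = replicate k 0 [ i ]≔ j

unit-+ᵥ : (i : Fin k) (j j′ : ℕ) → unit i j +ᵥ unit i j′ ≡ unit i (j + j′)
unit-+ᵥ {suc k} zero    j j′ = ≡.cong (j + j′ ∷_) (Vec.zipWith-identityˡ ℕ.+-identityˡ (replicate k 0))
unit-+ᵥ         (suc i) j j′ = ≡.cong (0 ∷_) (unit-+ᵥ i j j′)

unit-0 : (i : Fin k) → unit i 0 ≡ replicate k 0
unit-0 zero    = ≡.refl
unit-0 (suc i) = ≡.cong (0 ∷_) (unit-0 i)

unit-+ᵥ-≡ : (i : Fin k) (j : ℕ) (v w : Vec ℕ k) → unit i j +ᵥ v ≡ w → j ≤ lookup w i × v ≡ lower j i w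
unit-+ᵥ-≡ {suc k} zero    j (a ∷ v) .(unit zero j +ᵥ (a ∷ v)) ≡.refl = ℕ.m≤m+n j a ,
  ≡.cong₂ _∷_ (≡.sym (ℕ.m+n∸m≡n j a)) (≡.sym (Vec.zipWith-identityˡ ℕ.+-identityˡ v))
unit-+ᵥ-≡         (suc i) j (a ∷ v) (b ∷ w) eq with Vec.∷-injective eq
... | ≡.refl , eq′ with unit-+ᵥ-≡ i j v w eq′
...   | j≤wᵢ , v≡ = j≤wᵢ , ≡.cong (a ∷_) v≡

unit-+ᵥ-lower : (i : Fin k) (j : ℕ) (w : Vec ℕ k) → j ≤ lookup w i → unit i j +ᵥ lower j i w ≡ w
unit-+ᵥ-lower zero    j (b ∷ w) j≤b  = ≡.cong₂ _∷_ (ℕ.m+[n∸m]≡n j≤b) (Vec.zipWith-identityˡ ℕ.+-identityˡ w)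
unit-+ᵥ-lower (suc i) j (b ∷ w) j≤wᵢ = ≡.cong (b ∷_) (unit-+ᵥ-lower i j w j≤wᵢ)

lookup-lower-≤ : ∀ j (i i′ : Fin k) (w : Vec ℕ k) → lookup (lower j i w) i′ ≤ lookup w i′
lookup-lower-≤ j zero    zero     (b ∷ w) = ℕ.m∸n≤m b j
lookup-lower-≤ j zero    (suc i′) (b ∷ w) = ℕ.≤-refl
lookup-lower-≤ j (suc i) zero     (b ∷ w) = ℕ.≤-refl
lookup-lower-≤ j (suc i) (suc i′) (b ∷ w) = lookup-lower-≤ j i i′ w

lookup-≤-firstPart : ∀ {η} → Linked _≥_ η → ∀ i → List.lookup η i ≤ firstPart η
lookup-≤-firstPart {_ ∷ _} _          zero    = ℕ.≤-refl
lookup-≤-firstPart         (h≥ ∷ η↘) (suc i) = ℕ.≤-trans (lookup-≤-firstPart η↘ i) h≥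

ℚ-ring : CommutativeRing _ _
ℚ-ring = ℚ.+-*-commutativeRing

open SymmetricPolynomials ℚ-ring public using () renaming (fromℕᴿ to fromℕ′)

fromℕ′≡fromℕ : ∀ n → fromℕ′ n ≡ fromℕ n
fromℕ′≡fromℕ zero    = ≡.refl
fromℕ′≡fromℕ (suc n) = ≡.trans (≡.cong (1ℚ ℚ.+_) (fromℕ′≡fromℕ n)) (≡.sym (fromℕ-suc n))

1/n*n≡1′ : ∀ n .{{_ : NonZero n}} → ℤ.1ℤ /ℚ n ℚ.* fromℕ′ n ≡ 1ℚ
1/n*n≡1′ n = ≡.trans (≡.cong (ℤ.1ℤ /ℚ n ℚ.*_) (fromℕ′≡fromℕ n)) (1/n*n≡1 n)

module ElementaryTerms (η : List ℕ) where
  open ≡.≡-Reasoning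
  private
    R = ℚ[u] (length η)
    module R = RawRing R
    open Sums R using () renaming (∑ to ∑ᴿ; _^_ to _^ᴿ_)
    open Multivariate ℚ.+-*-rawRing (length η) using (const)

  u^ : ∀ (i : Fin (length η)) j → u i ^ᴿ j ≡ (1ℚ , unit i j) ∷ []
  u^ i zero    = ≡.cong (λ v → (1ℚ , v) ∷ []) (≡.sym (unit-0 i))
  u^ i (suc j) = ≡.trans (≡.cong (u i R.*_) (u^ i j)) (≡.cong (λ v → (1ℚ , v) ∷ []) (unit-+ᵥ i 1 j))

  1/_! : ℕ → ℚ
  1/ j ! = (ℤ.1ℤ /ℚ (j !)) {{j ℕ.!≢0}}

  largeParts : ℕ → List (Fin (length η))
  largeParts j = filter (λ i → j ℕ.≤? List.lookup η i) (allFin (length η))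

  -- An equality of lists, not only of coefficients: products with `E η j` can be expanded term by
  -- term, and `E η j` is literally the empty sum when no part is large enough.
  E-terms : ∀ j → E η j ≡ map (λ i → 1/ j ! , unit i j) (largeParts j)
  E-terms j = begin
    const (1/ j !) R.* ∑ᴿ (largeParts j) (λ i → u i ^ᴿ j)
      ≡⟨ ≡.cong (const (1/ j !) R.*_) (powers (largeParts j)) ⟩
    const (1/ j !) R.* map (λ i → 1ℚ , unit i j) (largeParts j)
      ≡⟨ ++-identityʳ _ ⟩
    map (λ (b , v) → 1/ j ! ℚ.* b , replicate (length η) 0 +ᵥ v) (map (λ i → 1ℚ , unit i j) (largeParts j))
      ≡⟨ map-∘ (largeParts j) ⟨
    map (λ i → 1/ j ! ℚ.* 1ℚ , replicate (length η) 0 +ᵥ unit i j) (largeParts j)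
      ≡⟨ map-cong (λ i → ≡.cong₂ _,_ (ℚ.*-identityʳ (1/ j !)) (Vec.zipWith-identityˡ ℕ.+-identityˡ (unit i j))) (largeParts j) ⟩
    map (λ i → 1/ j ! , unit i j) (largeParts j)
      ∎
    where
    powers : ∀ is → ∑ᴿ is (λ i → u i ^ᴿ j) ≡ map (λ i → 1ℚ , unit i j) is
    powers []       = ≡.refl
    powers (i ∷ is) = ≡.cong₂ List._++_ (u^ i j) (powers is)

module ElementaryCoefficients (η : List ℕ) where
  open ElementaryTerms η
  open FiniteSums ℚ-ring
  open Distributions ℚ-ring using (distributions; distributions-[]; distributions-0∷; distributions-suc∷)
  open Colourings ℚ-ring using (fact)
  private
    R = ℚ[u] (length η)
    module R = RawRing R
    open Sums R using () renaming (∏ to ∏ᴿ)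
    open Multivariate ℚ.+-*-rawRing (length η) using (coeff)
    open Coefficients ℚ-ring (Vec.≡-dec {n = length η} ℕ._≟_) (zipWith _+_) (replicate (length η) 0)

  coeff-E-* : ∀ j w q → [u^ w ] (E η j R.* q) ≡
    ∑[ i ∈ largeParts j ] (ind (j ℕ.≤? lookup w i) ⊗ (1/ j ! ⊗ [u^ lower j i w ] q))
  coeff-E-* j w q = ≡.trans (≡.cong (λ p → coeff w (p R.* q)) (E-terms j)) (terms (largeParts j))
    where
    terms : ∀ is → coeff w (map (λ i → 1/ j ! , unit i j) is R.* q) ≡
      ∑[ i ∈ is ] (ind (j ℕ.≤? lookup w i) ⊗ (1/ j ! ⊗ [u^ lower j i w ] q))
    terms []       = ≡.refl
    terms (i ∷ is) = ≡.trans (coeff-∷-* w (1/ j ! , unit i j) (map (λ i → 1/ j ! , unit i j) is) q) (≡.cong₂ _⊕_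
      (coeff-shift-ind (j ℕ.≤? lookup w i) w (lower j i w) (1/ j !) (unit i j) q
        (λ v → unit-+ᵥ-≡ i j v w) (unit-+ᵥ-lower i j w))
      (terms is))

  -- An absent colour must contribute e_0 = 1, whereas `E η 0` is the number of parts.
  E′ : ℕ → R.Carrier
  E′ zero    = R.1#
  E′ (suc j) = E η (suc j)

  Es : Vec ℕ N → R.Carrier
  Es α = ∏ᴿ (toList α) E′

  -- Choosing a term of each factor E_j assigns that colour to a part, and the scalars 1/j! cancel
  -- against α!. The monomial u_i^j contributes to u^w only if j ≤ w_i, and `w` is bounded by `η`,
  -- so the restriction to parts of size at least j excludes nothing. The general `w` is what
  -- remains of u^η after some colours have been assigned.
  coeff-Es : (α : Vec ℕ N) (w : Vec ℕ (length η)) → (∀ i → lookup w i ≤ List.lookup η i) →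
             fact α ⊗ [u^ w ] (Es α) ≡ distributions w α
  coeff-Es []          w _   = begin
    1ℚ ⊗ coeff w R.1#                     ≈⟨ *-identityˡ (coeff w R.1#) ⟩
    coeff w R.1#                          ≈⟨ coeff-∑-terms w R.1# ⟩
    ind (replicate (length η) 0 ≟ᵥ w) ⊗ 1ℚ ⊕ 0ℚ  ≈⟨ ≡.trans (+-identityʳ _) (*-identityʳ (ind (replicate (length η) 0 ≟ᵥ w))) ⟩
    ind (replicate (length η) 0 ≟ᵥ w)     ≈⟨ distributions-[] w ⟨
    distributions w []                    ∎
  coeff-Es (zero ∷ α)  w w≤η = begin
    (1ℚ ⊗ fact α) ⊗ coeff w (R.1# R.* Es α)
      ≈⟨ ≡.cong₂ _⊗_ (*-identityˡ (fact α)) (≡.trans (coeff-const-* (Vec.zipWith-identityˡ ℕ.+-identityˡ) w 1ℚ (Es α)) (*-identityˡ (coeff w (Es α)))) ⟩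
    fact α ⊗ coeff w (Es α)
      ≈⟨ coeff-Es α w w≤η ⟩
    distributions w α
      ≈⟨ distributions-0∷ w α ⟨
    distributions w (0 ∷ α)
      ∎
  coeff-Es (suc a ∷ α) w w≤η = begin
    (fromℕ′ (suc a !) ⊗ fact α) ⊗ coeff w (E η (suc a) R.* Es α)
      ≈⟨ ≡.trans (≡.cong ((fromℕ′ (suc a !) ⊗ fact α) ⊗_) (coeff-E-* (suc a) w (Es α)))
           (∑-⊗ˡ (fromℕ′ (suc a !) ⊗ fact α) (largeParts (suc a)) (λ i → ind (suc a ℕ.≤? lookup w i) ⊗ (1/ suc a ! ⊗ [u^ lower (suc a) i w ] (Es α)))) ⟩
    ∑[ i ∈ largeParts (suc a) ] ((fromℕ′ (suc a !) ⊗ fact α) ⊗ (ind (suc a ℕ.≤? lookup w i) ⊗ (1/ suc a ! ⊗ [u^ lower (suc a) i w ] (Es α))))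
      ≈⟨ ∑-cong (largeParts (suc a)) step ⟩
    ∑[ i ∈ largeParts (suc a) ] (ind (suc a ℕ.≤? lookup w i) ⊗ distributions (lower (suc a) i w) α)
      ≈⟨ ∑-filter (λ i → suc a ℕ.≤? List.lookup η i) (allFin (length η)) (λ i → ind (suc a ℕ.≤? lookup w i) ⊗ distributions (lower (suc a) i w) α) ⟩
    ∑[ i ∈ allFin (length η) ] (ind (suc a ℕ.≤? List.lookup η i) ⊗ (ind (suc a ℕ.≤? lookup w i) ⊗ distributions (lower (suc a) i w) α))
      ≈⟨ ∑-cong (allFin (length η)) (λ i → ≡.trans (⊗-swap (ind (suc a ℕ.≤? List.lookup η i)) (ind (suc a ℕ.≤? lookup w i)) (distributions (lower (suc a) i w) α))
           (ind-⊗-cong (suc a ℕ.≤? lookup w i) λ a<wᵢ →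
           ind-true-⊗ (suc a ℕ.≤? List.lookup η i) (ℕ.≤-trans a<wᵢ (w≤η i)))) ⟩
    ∑[ i ∈ allFin (length η) ] (ind (suc a ℕ.≤? lookup w i) ⊗ distributions (lower (suc a) i w) α)
      ≈⟨ distributions-suc∷ w a α ⟨
    distributions w (suc a ∷ α)
      ∎
    where
    regroup : ∀ f x i g y → (f ⊗ x) ⊗ (i ⊗ (g ⊗ y)) ≡ i ⊗ ((g ⊗ f) ⊗ (x ⊗ y))
    regroup = solve 5 (λ f x i g y → (f :* x) :* (i :* (g :* y)) := i :* ((g :* f) :* (x :* y))) ≡.refl
    step : ∀ i → (fromℕ′ (suc a !) ⊗ fact α) ⊗ (ind (suc a ℕ.≤? lookup w i) ⊗ (1/ suc a ! ⊗ [u^ lower (suc a) i w ] (Es α))) ≡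
           ind (suc a ℕ.≤? lookup w i) ⊗ distributions (lower (suc a) i w) α
    step i = ≡.trans
      (regroup (fromℕ′ (suc a !)) (fact α) (ind (suc a ℕ.≤? lookup w i)) (1/ suc a !) ([u^ lower (suc a) i w ] (Es α)))
      (≡.cong (ind (suc a ℕ.≤? lookup w i) ⊗_) (≡.trans
        (≡.cong₂ _⊗_ (1/n*n≡1′ (suc a !) {{suc a ℕ.!≢0}})
          (coeff-Es α (lower (suc a) i w) (λ i′ → ℕ.≤-trans (lookup-lower-≤ (suc a) i i′ w) (w≤η i′))))
        (*-identityˡ (distributions (lower (suc a) i w) α))))

-- Homogeneity, cancellation of α!, and the coefficients of the chromatic symmetric function.

module Degrees where
  open FiniteSums ℚ-ring
  open Distributions ℚ-ring using (distributions)
  open Colourings ℚ-ring using (fact; colourings)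
  open SymmetricPolynomials ℚ-ring using (∑-ind)

  distributions-degree : (w : Vec ℕ k) (α : Vec ℕ N) → sumᵛ w ≢ sumᵛ α → distributions w α ≡ 0ℚ
  distributions-degree []      α |w|≢|α| = ind-false (AllV.all? (ℕ._≟ 0) α) (|w|≢|α| ∘ ≡.sym ∘ all-≡0⇒sum≡0)
  distributions-degree (h ∷ w) α |w|≢|α| = ≡.trans (∑-cong-∈ (below α) λ β β∈ → ≡.trans
    (≡.cong (ind (disjoint? β (α ∸ᵥ β)) ⊗_) (≡.trans
      (ind-⊗-cong (sumᵛ β ℕ.≟ h) λ |β|≡h → distributions-degree w (α ∸ᵥ β) λ |w|≡ → |w|≢|α|
        (≡.trans (≡.cong₂ _+_ (≡.sym |β|≡h) |w|≡) (sum-∸ᵥ {α = α} (∈-below β∈))))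
      (zeroʳ (ind (sumᵛ β ℕ.≟ h)))))
    (zeroʳ (ind (disjoint? β (α ∸ᵥ β))))) (∑-0 (below α))

  fact⁻¹ : (α : Vec ℕ N) → ∃[ r ] r ⊗ fact α ≡ 1ℚ
  fact⁻¹ []      = 1ℚ , ≡.refl
  fact⁻¹ (a ∷ α) with fact⁻¹ α
  ... | r , r*α!≡1 = (s ⊗ r) , (begin
    (s ⊗ r) ⊗ (fromℕ′ (a !) ⊗ fact α)    ≈⟨ ⊗-interchange s r (fromℕ′ (a !)) (fact α) ⟩
    (s ⊗ fromℕ′ (a !)) ⊗ (r ⊗ fact α)    ≈⟨ ≡.cong₂ _⊗_ (1/n*n≡1′ (a !) {{a ℕ.!≢0}}) r*α!≡1 ⟩
    1ℚ ⊗ 1ℚ                              ≈⟨ *-identityˡ 1ℚ ⟩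
    1ℚ                                   ∎)
    where s = (ℤ.1ℤ /ℚ (a !)) {{a ℕ.!≢0}}

  fact-cancelˡ : (α : Vec ℕ N) {x y : ℚ} → fact α ⊗ x ≡ fact α ⊗ y → x ≡ y
  fact-cancelˡ α {x} {y} eq with fact⁻¹ α
  ... | r , r*α!≡1 = ≡.trans (≡.sym (undo x)) (≡.trans (≡.cong (r ⊗_) eq) (undo y))
    where
    undo : ∀ z → r ⊗ (fact α ⊗ z) ≡ z
    undo z = ≡.trans (≡.sym (*-assoc r (fact α) z)) (≡.trans (≡.cong (_⊗ z) r*α!≡1) (*-identityˡ z))

  X-colourings : ∀ η (α : Vec ℕ N) → X (K η) α ≡ colourings η α
  X-colourings {N} η α = ≡.sym (begin
    ∑[ κ ∈ words (K η) N (sum η) ] (ind (proper? (K η) κ) ⊗ ind (counts κ ≟ᵥ α))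
      ≈⟨ ∑-cong (words (K η) N (sum η)) (λ κ → ind-× (proper? (K η) κ) (counts κ ≟ᵥ α)) ⟨
    ∑[ κ ∈ words (K η) N (sum η) ] ind (proper? (K η) κ ×-dec (counts κ ≟ᵥ α))
      ≈⟨ ∑-ind (λ κ → proper? (K η) κ ×-dec (counts κ ≟ᵥ α)) (words (K η) N (sum η)) ⟩
    fromℕ′ (length (filter (λ κ → proper? (K η) κ ×-dec (counts κ ≟ᵥ α)) (words (K η) N (sum η))))
      ≈⟨ fromℕ′≡fromℕ (length (filter (λ κ → proper? (K η) κ ×-dec (counts κ ≟ᵥ α)) (words (K η) N (sum η)))) ⟩
    X (K η) α
      ∎)

  sum-fromList : ∀ η → sumᵛ (fromList η) ≡ sum η
  sum-fromList []      = ≡.refl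
  sum-fromList (h ∷ η) = ≡.cong (h +_) (sum-fromList η)

-- From the splitting algebra back to ℚ[u].

module Splitting {c ℓ} (η : List ℕ) (η↘ : Linked _≥_ η)
  (𝒮 : SplittingAlgebra (ℚ[u] (length η)) (rootPolynomial η) (firstPart η) c ℓ) where
  open SplittingAlgebra 𝒮 using (S; ι; y; isRingMonomorphism; splits)
  open FiniteSums S
  open SymmetricPolynomials S using (esym; aug; IsSubring; aug-closed; fromℕᴿ)
  open AugmentedMonomials S using (aug-m)
  open Vieta S using (vieta; esym->; linearFactors)
  open ElementaryTerms η using (E-terms; largeParts; 1/_!)
  open ElementaryCoefficients η using (E′; Es)
  private
    R = ℚ[u] (length η)
    module R = RawRing R
    module ∑ᴿ = Sums R
    open Multivariate ℚ.+-*-rawRing (length η) using (const; coeff)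
    module Cᵤ = Coefficients ℚ-ring (Vec.≡-dec {n = length η} ℕ._≟_) (zipWith _+_) (replicate (length η) 0)
    module C_z = Coefficients S ℕ._≟_ _+_ 0
    module Uz = Univariate rawRing
  open RingMorphisms.IsRingMonomorphism isRingMonomorphism public using (injective)
  open RingMorphisms.IsRingMonomorphism isRingMonomorphism using (isRingHomomorphism)
  private module ι = RingMorphisms.IsRingHomomorphism isRingHomomorphism

  -- Constants make `S` an algebra over ℚ. This carries the rational coefficients of e_μ into `S`
  -- and allows division by `stabiliser`.
  q : ℚ → Carrier
  q b = ι (const b)

  q-isRingHomomorphism : RingMorphisms.IsRingHomomorphism ℚ.+-*-rawRing rawRing q
  q-isRingHomomorphism = record
    { isSemiringHomomorphism = record
      { isNearSemiringHomomorphism = record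
        { +-isMonoidHomomorphism = record
          { isMagmaHomomorphism = record
            { isRelHomomorphism = record { cong = λ { ≡.refl → ≈-refl } }
            ; homo              = λ b b′ → ≈-trans (ι.⟦⟧-cong (const-+ b b′)) (ι.+-homo (const b) (const b′))
            }
          ; ε-homo = ≈-trans (ι.⟦⟧-cong const-0) ι.0#-homo
          }
        -- The product of two constants has as exponent the sum of two zero vectors, which has to be
        -- rewritten to the zero vector.
        ; *-homo = λ b b′ → ≈-trans (ι.⟦⟧-cong (λ v → ≡.cong (λ ε → coeff v ((b ℚ.* b′ , ε) ∷ [])) zeros)) (ι.*-homo (const b) (const b′))
        }
      ; 1#-homo = ι.1#-homo
      }
    ; -‿homo = λ b → ι.-‿homo (const b)
    }
    where
    const-+ : ∀ b b′ → const (b ℚ.+ b′) R.≈ (const b R.+ const b′)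
    const-+ b b′ v with does (Vec.≡-dec ℕ._≟_ (replicate (length η) 0) v)
    ... | true  = ℚ.+-assoc b b′ 0ℚ
    ... | false = ≡.refl
    const-0 : const 0ℚ R.≈ R.0#
    const-0 v with does (Vec.≡-dec ℕ._≟_ (replicate (length η) 0) v)
    ... | true  = ≡.refl
    ... | false = ≡.refl
    zeros = ≡.sym (Vec.zipWith-identityˡ ℕ.+-identityˡ (replicate (length η) 0))

  open Cauchy S q q-isRingHomomorphism using (esyms; dual-cauchy)
  private module q = RingMorphisms.IsRingHomomorphism q-isRingHomomorphism

  ι-∑ : (xs : List A) (f : A → R.Carrier) → ι (∑ᴿ.∑ xs f) ≈ ∑[ x ∈ xs ] ι (f x)
  ι-∑ []       f = ι.0#-homo
  ι-∑ (x ∷ xs) f = ≈-trans (ι.+-homo _ _) (+-congˡ (ι-∑ xs f))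

  ι-sign : ∀ j → ι ((R.- R.1#) ∑ᴿ.^ j) ≈ (⊖ 1#) ^ j
  ι-sign zero    = ι.1#-homo
  ι-sign (suc j) = ≈-trans (ι.*-homo _ _) (*-cong (≈-trans (ι.-‿homo _) (-‿cong ι.1#-homo)) (ι-sign j))

  signs-cancel : ∀ j → (⊖ 1#) ^ j ⊗ (⊖ 1#) ^ j ≈ 1#
  signs-cancel zero    = *-identityˡ 1#
  signs-cancel (suc j) = begin
    ⊖ 1# ⊗ (⊖ 1#) ^ j ⊗ (⊖ 1# ⊗ (⊖ 1#) ^ j)    ≈⟨ solve 2 (λ s x → s :* x :* (s :* x) := s :* s :* (x :* x)) ≈-refl (⊖ 1#) _ ⟩
    ⊖ 1# ⊗ ⊖ 1# ⊗ ((⊖ 1#) ^ j ⊗ (⊖ 1#) ^ j)    ≈⟨ *-cong (≈-trans (-1*x≈-x (⊖ 1#)) (-‿involutive 1#)) (signs-cancel j) ⟩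
    1# ⊗ 1#                                    ≈⟨ *-identityˡ 1# ⟩
    1#                                         ∎
    where open RingProperties (CommutativeRing.ring S) using (-1*x≈-x; -‿involutive)

  -- The leading term lies in a strictly higher degree. Truncated subtraction is injective on the
  -- indices up to `firstPart η`, so just one of the other terms has the required degree.
  coeff-rootPolynomial : ∀ {j} → j < firstPart η →
    Uz.coeff (firstPart η ∸ suc j) (map (map₁ ι) (rootPolynomial η)) ≈ (⊖ 1#) ^ suc j ⊗ ι (E η (suc j))
  coeff-rootPolynomial {j} j<d = begin
    Uz.coeff t (map (map₁ ι) (rootPolynomial η))
      ≈⟨ C_z.coeff-∑-terms t (map (map₁ ι) (rootPolynomial η)) ⟩
    ind (firstPart η ℕ.≟ t) ⊗ ι R.1# ⊕ ∑ (map (map₁ ι) (map term (map suc (upTo (firstPart η))))) coeffAt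
      ≈⟨ +-cong (ind-false-⊗ (firstPart η ℕ.≟ t) d≢t) (≈-reflexive (≡.trans (∑-map (map₁ ι) (map term (map suc (upTo (firstPart η)))) coeffAt)
           (≡.trans (∑-map term (map suc (upTo (firstPart η))) _) (∑-map suc (upTo (firstPart η)) _)))) ⟩
    0# ⊕ ∑[ i ∈ upTo (firstPart η) ] (ind (firstPart η ∸ suc i ℕ.≟ t) ⊗ signed (suc i))
      ≈⟨ ≈-trans (+-identityˡ _) (∑-cong-∈ (upTo (firstPart η)) λ i i∈ → *-congʳ
           (ind-cong (firstPart η ∸ suc i ℕ.≟ t) (i ℕ.≟ j)
             (λ eq → ℕ.suc-injective (ℕ.∸-cancelˡ-≡ (∈-upTo⁻ i∈) j<d eq)) (≡.cong (λ i → firstPart η ∸ suc i)))) ⟩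
    ∑[ i ∈ upTo (firstPart η) ] (ind (i ℕ.≟ j) ⊗ signed (suc i))
      ≈⟨ ∑-upTo-ind (firstPart η) j<d (λ i → signed (suc i)) ⟩
    signed (suc j)
      ≈⟨ ≈-trans (ι.*-homo _ _) (*-congʳ (ι-sign (suc j))) ⟩
    (⊖ 1#) ^ suc j ⊗ ι (E η (suc j))
      ∎
    where
    t = firstPart η ∸ suc j
    term : ℕ → R.Carrier × ℕ
    term j = (R.- R.1#) ∑ᴿ.^ j R.* E η j , firstPart η ∸ j
    signed : ℕ → Carrier
    signed j = ι ((R.- R.1#) ∑ᴿ.^ j R.* E η j)
    coeffAt : Carrier × ℕ → Carrier
    coeffAt (b , m) = ind (m ℕ.≟ t) ⊗ b
    d≢t : firstPart η ≢ t
    d≢t eq = ℕ.<-irrefl (≡.sym eq) (ℕ.∸-monoʳ-< {firstPart η} {suc j} {0} (s≤s z≤n) j<d)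

  -- For j below `firstPart η` both sides are the same coefficient of the root polynomial up to a
  -- sign that squares to 1. Beyond that both vanish: no part is large enough, and there are too few
  -- roots. The second range matters because an entry of `α` can exceed the largest part.
  ι-E : ∀ j → ι (E η (suc j)) ≈ esym (suc j) y
  ι-E j = [ small , large ]′ (ℕ.<-≤-connex j (firstPart η))
    where
    small : j < firstPart η → ι (E η (suc j)) ≈ esym (suc j) y
    small j<d = begin
      ι (E η (suc j))                                    ≈⟨ cancel (ι (E η (suc j))) ⟨
      s ⊗ (s ⊗ ι (E η (suc j)))                          ≈⟨ *-congˡ (coeff-rootPolynomial j<d) ⟨
      s ⊗ Uz.coeff t (map (map₁ ι) (rootPolynomial η))   ≈⟨ *-congˡ (splits t) ⟩
      s ⊗ Uz.coeff t (linearFactors y)                   ≈⟨ *-congˡ (vieta (suc j) t y (ℕ.m+[n∸m]≡n j<d)) ⟩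
      s ⊗ (s ⊗ esym (suc j) y)                           ≈⟨ cancel (esym (suc j) y) ⟩
      esym (suc j) y                                     ∎
      where
      t = firstPart η ∸ suc j
      s = (⊖ 1#) ^ suc j
      cancel : ∀ x → s ⊗ (s ⊗ x) ≈ x
      cancel x = ≈-trans (≈-sym (*-assoc s s x)) (≈-trans (*-congʳ (signs-cancel (suc j))) (*-identityˡ x))
    large : firstPart η ≤ j → ι (E η (suc j)) ≈ esym (suc j) y
    large d≤j = begin
      ι (E η (suc j))  ≡⟨ ≡.cong ι (≡.trans (E-terms (suc j)) (≡.cong (map (λ i → 1/ suc j ! , unit i (suc j))) noParts)) ⟩
      ι R.0#           ≈⟨ ι.0#-homo ⟩
      0#               ≈⟨ esym-> y (s≤s d≤j) ⟨
      esym (suc j) y   ∎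
      where
      noParts : largeParts (suc j) ≡ []
      noParts = filter-none (λ i → suc j ℕ.≤? List.lookup η i)
        {xs = allFin (length η)} (All.tabulate λ {i} _ j<ηᵢ → ℕ.<⇒≱ j<ηᵢ (ℕ.≤-trans (lookup-≤-firstPart η↘ i) d≤j))

  ι-Es : (α : Vec ℕ N) → ι (Es α) ≈ esyms α y
  ι-Es []      = ι.1#-homo
  ι-Es (a ∷ α) = ≈-trans (ι.*-homo _ _) (*-cong (ι-E′ a) (ι-Es α))
    where
    ι-E′ : ∀ a → ι (E′ a) ≈ esym a y
    ι-E′ zero    = ι.1#-homo
    ι-E′ (suc j) = ι-E j

  Image : Carrier → Set _
  Image x = ∃[ r ] ι r ≈ x

  image-isSubring : IsSubring Image
  image-isSubring = record
    { resp     = λ { x≈y (r , eq) → r , ≈-trans eq x≈y }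
    ; 1-closed = R.1# , ι.1#-homo
    ; ⊕-closed = λ { (r , eq) (r′ , eq′) → (r R.+ r′) , ≈-trans (ι.+-homo r r′) (+-cong eq eq′) }
    ; ⊗-closed = λ { (r , eq) (r′ , eq′) → (r R.* r′) , ≈-trans (ι.*-homo r r′) (*-cong eq eq′) }
    ; ⊖-closed = λ { (r , eq) → (R.- r) , ≈-trans (ι.-‿homo r) (-‿cong eq) }
    }

  q-fromℕ′ : ∀ n → q (fromℕ′ n) ≈ fromℕᴿ n
  q-fromℕ′ zero    = q.0#-homo
  q-fromℕ′ (suc n) = ≈-trans (q.+-homo 1ℚ (fromℕ′ n)) (+-cong q.1#-homo (q-fromℕ′ n))

  -- Passing from `aug` to `m` divides by a product of factorials of multiplicities, which is
  -- invertible because the constants include ℚ.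
  m-image : ∀ {μ} → All (1 ≤_) μ → Image (m rawRing μ y)
  m-image {μ} μ≥1 = resp (begin
    q s⁻¹ ⊗ aug μ y                                           ≈⟨ *-congˡ (aug-m μ y μ≥1) ⟩
    q s⁻¹ ⊗ (fromℕᴿ (stabiliser μ) ⊗ m rawRing μ y)           ≈⟨ *-assoc _ _ _ ⟨
    q s⁻¹ ⊗ fromℕᴿ (stabiliser μ) ⊗ m rawRing μ y             ≈⟨ *-congʳ (*-congˡ (q-fromℕ′ (stabiliser μ))) ⟨
    q s⁻¹ ⊗ q (fromℕ′ (stabiliser μ)) ⊗ m rawRing μ y         ≈⟨ *-congʳ (q.*-homo s⁻¹ (fromℕ′ (stabiliser μ))) ⟨
    q (s⁻¹ ℚ.* fromℕ′ (stabiliser μ)) ⊗ m rawRing μ y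
      ≈⟨ *-congʳ (≈-trans (q.⟦⟧-cong (1/n*n≡1′ (stabiliser μ) {{stabiliser-nonZero μ}})) q.1#-homo) ⟩
    1# ⊗ m rawRing μ y                                        ≈⟨ *-identityˡ _ ⟩
    m rawRing μ y                                             ∎)
    (⊗-closed (const s⁻¹ , ≈-refl) (aug-closed image-isSubring y (λ j → E η (suc j) , ι-E j) (length μ) μ ≡.refl))
    where
    open IsSubring image-isSubring using (resp; ⊗-closed)
    s⁻¹ = (ℤ.1ℤ /ℚ stabiliser μ) {{stabiliser-nonZero μ}}

  -- The value for μ with a zero part is irrelevant.
  mᵧ : List ℕ → R.Carrier
  mᵧ μ = preimage (All.all? (1 ℕ.≤?_) μ)
    where
    preimage : Dec (All (1 ≤_) μ) → R.Carrier
    preimage (yes μ≥1) = proj₁ (m-image μ≥1)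
    preimage (no _)    = R.0#

  ι-mᵧ : ∀ {μ} → All (1 ≤_) μ → ι (mᵧ μ) ≈ m rawRing μ y
  ι-mᵧ {μ} μ≥1 with All.all? (1 ℕ.≤?_) μ
  ... | yes μ≥1′ = proj₂ (m-image μ≥1′)
  ... | no  μ≱1  = contradiction μ≥1 μ≱1

  -- The dual Cauchy identity holds among elements of `S`, but both of its sides are images under
  -- `ι`; injectivity turns it into an identity in ℚ[u], where coefficients can be taken.
  Es-expand : (α : Vec ℕ N) → Es α R.≈ ∑ᴿ.∑ (partitions (sumᵛ α)) (λ μ → const (e μ α) R.* mᵧ μ)
  Es-expand α = injective (begin
    ι (Es α)
      ≈⟨ ι-Es α ⟩
    esyms α y
      ≈⟨ dual-cauchy α y ⟨
    ∑[ μ ∈ Π ] (q (e μ α) ⊗ m rawRing μ y)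
      ≈⟨ ∑-cong-∈ Π (λ μ μ∈ → ≈-trans (ι.*-homo _ _) (*-congˡ (ι-mᵧ (proj₁ (proj₂ (∈-partitions {n = sumᵛ α} μ∈)))))) ⟨
    ∑[ μ ∈ Π ] ι (const (e μ α) R.* mᵧ μ)
      ≈⟨ ι-∑ Π _ ⟨
    ι (∑ᴿ.∑ Π (λ μ → const (e μ α) R.* mᵧ μ))
      ∎)
    where Π = partitions (sumᵛ α)

  coeff-Es-expand : (α : Vec ℕ N) (w : Vec ℕ (length η)) →
    [u^ w ] (Es α) ≡ Sums.∑ +-*-rawRing (partitions (sumᵛ α)) (λ μ → [u^ w ] (mᵧ μ) * e μ α)
  coeff-Es-expand α w = ≡.trans (Es-expand α w) (≡.trans (Cᵤ.coeff-∑ w Π (λ μ → const (e μ α) R.* mᵧ μ))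
    (FiniteSums.∑-cong ℚ-ring Π λ μ → ≡.trans
      (Cᵤ.coeff-const-* (Vec.zipWith-identityˡ ℕ.+-identityˡ) w (e μ α) (mᵧ μ)) (ℚ.*-comm (e μ α) ([u^ w ] (mᵧ μ)))))
    where Π = partitions (sumᵛ α)

lookup-fromList : (η : List ℕ) (i : Fin (length η)) → lookup (fromList η) i ≤ List.lookup η i
lookup-fromList (h ∷ η) zero    = ℕ.≤-refl
lookup-fromList (h ∷ η) (suc i) = lookup-fromList η i

-- Comparison of the coefficients of x^α, according to the degree of α.

theorem3p2 : ∀ {c ℓ} (n : ℕ) (η : List ℕ) → η ⊢ n →
    (A : SplittingAlgebra (ℚ[u] (length η)) (rootPolynomial η) (firstPart η) c ℓ) →
    let open SplittingAlgebra A in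
    Σ[ mᵧ ∈ (List ℕ → RawRing.Carrier (ℚ[u] (length η))) ]
    (∀ μ → μ ⊢ n → ι (mᵧ μ) ≈ m rawRing μ y) ×
    (∀ {N} (α : Vec ℕ N) →
    X (K η) α ≡
    fromℕ (product (map _! η)) *
    Sums.∑ +-*-rawRing (partitions n) (λ μ → [u^ fromList η ] (mᵧ μ) * e μ α))
theorem3p2 n η (η↘ , _ , |η|≡n) A = mᵧ , (λ μ (_ , μ≥1 , _) → ι-mᵧ μ≥1) , coefficient
  where
  open Splitting η η↘ A using (mᵧ; ι-mᵧ; coeff-Es-expand)
  open ElementaryCoefficients η using (Es; coeff-Es)
  open Distributions ℚ-ring using (distributions)
  open Colourings ℚ-ring using (fact; fact-colourings)
  open FiniteSums ℚ-ring
  open Degrees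

  η! : ℚ
  η! = fromℕ (product (map _! η))

  rhs : ∀ {N} → Vec ℕ N → ℚ
  rhs α = ∑[ μ ∈ partitions n ] ([u^ fromList η ] (mᵧ μ) ⊗ e μ α)

  fact-X : ∀ {N} (α : Vec ℕ N) → fact α ⊗ X (K η) α ≡ η! ⊗ distributions (fromList η) α
  fact-X α = ≡.trans (≡.cong (fact α ⊗_) (X-colourings η α)) (≡.trans (fact-colourings η α)
    (≡.cong (_⊗ distributions (fromList η) α) (fromℕ′≡fromℕ (product (map _! η)))))

  same-degree : ∀ {N} (α : Vec ℕ N) → n ≡ sumᵛ α → X (K η) α ≡ η! ⊗ rhs α
  same-degree α n≡|α| = fact-cancelˡ α (begin
    fact α ⊗ X (K η) α                               ≈⟨ fact-X α ⟩
    η! ⊗ distributions (fromList η) α                ≈⟨ ≡.cong (η! ⊗_) (coeff-Es α (fromList η) (lookup-fromList η)) ⟨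
    η! ⊗ (fact α ⊗ [u^ fromList η ] (Es α))          ≈⟨ ⊗-swap η! (fact α) ([u^ fromList η ] (Es α)) ⟩
    fact α ⊗ (η! ⊗ [u^ fromList η ] (Es α))          ≈⟨ ≡.cong (λ x → fact α ⊗ (η! ⊗ x)) (≡.trans (coeff-Es-expand α (fromList η))
                                                          (≡.cong (λ k → ∑[ μ ∈ partitions k ] ([u^ fromList η ] (mᵧ μ) ⊗ e μ α)) (≡.sym n≡|α|))) ⟩
    fact α ⊗ (η! ⊗ rhs α)                            ∎)

  -- The expansion of `Es α` runs over partitions of the degree of `α`, not of `n`. Here both sides
  -- vanish for reasons of degree: the demands of the parts do not add up to the available colours,
  -- and each e_μ is homogeneous of degree `n`.
  other-degree : ∀ {N} (α : Vec ℕ N) → n ≢ sumᵛ α → X (K η) α ≡ η! ⊗ rhs α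
  other-degree α n≢|α| = fact-cancelˡ α (begin
    fact α ⊗ X (K η) α                               ≈⟨ fact-X α ⟩
    η! ⊗ distributions (fromList η) α                ≈⟨ ≡.cong (η! ⊗_) (distributions-degree (fromList η) α λ eq → n≢|α|
                                                          (≡.trans (≡.sym |η|≡n) (≡.trans (≡.sym (sum-fromList η)) eq))) ⟩
    η! ⊗ 0ℚ                                          ≈⟨ zeroʳ η! ⟩
    0ℚ                                               ≈⟨ zeroʳ (fact α) ⟨
    fact α ⊗ 0ℚ                                      ≈⟨ ≡.cong (fact α ⊗_) (zeroʳ η!) ⟨
    fact α ⊗ (η! ⊗ 0ℚ)                               ≈⟨ ≡.cong (λ x → fact α ⊗ (η! ⊗ x)) vanishes ⟨
    fact α ⊗ (η! ⊗ rhs α)                            ∎)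
    where
    vanishes : rhs α ≡ 0ℚ
    vanishes = ≡.trans (∑-cong-∈ (partitions n) λ μ μ∈ → ≡.trans
      (≡.cong ([u^ fromList η ] (mᵧ μ) ⊗_) (e-degree μ α λ |μ|≡|α| → n≢|α|
        (≡.trans (≡.sym (proj₂ (proj₂ (∈-partitions {n = n} μ∈)))) |μ|≡|α|)))
      (zeroʳ ([u^ fromList η ] (mᵧ μ)))) (∑-0 (partitions n))

  coefficient : ∀ {N} (α : Vec ℕ N) → X (K η) α ≡ η! ⊗ rhs α
  coefficient α = byDegree (n ℕ.≟ sumᵛ α)
    where
    byDegree : Dec (n ≡ sumᵛ α) → X (K η) α ≡ η! ⊗ rhs α
    byDegree (yes n≡|α|) = same-degree α n≡|α|
    byDegree (no n≢|α|)  = other-degree α n≢|α|
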